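{- Let $G=(V,E)$ be an $\eta$-hyperbolic graph (in the sense of Gromov) of bounded degree, with graph distance $\delta_G$, and let $v_0\in V$. Then there exists a bounded segment tree graph which realizes $G$. If moreover $\delta_G(v,v_0)$ and the set of neighbors of $v$ can be computed in time $O(1)$ (for $v\in V$), then this segment tree graph is efficient.
   Context: **Hyperbolicity.** A geodesic in a graph is a path $(\gamma_0,\ldots,\gamma_d)$ that is a shortest path from $\gamma_0$ to $\gamma_d$. A geodesic triangle is a triple of geodesics $(\gamma^1,\gamma^2,\gamma^3)$ such that for some vertices $v_1,v_2,v_3$ the endpoints of $\gamma^1$ are $v_1,v_2$, those of $\gamma^2$ are $v_2,v_3$, and those of $\gamma^3$ are $v_3,v_1$. For $A\subseteq V$, $N^d(A)$ is the set of all vertices at distance at most $d$ from $A$. The graph is $\eta$-hyperbolic if for every geodesic triangle $\gamma^3\subseteq N^\eta(\gamma^1\cup\gamma^2)$. **Segment tree graphs.** Let $\mathbb N=\{0,1,\ldots\}$. An $(m_N,m_d)$-bounded segment tree graph is a tuple $(\mathcal S,V,v_0,P,\delta_0,N,\delta_N,\delta)$ such that: - $V\subseteq\mathcal S$ is the set of vertices (elements of $\mathcal S$ are called segments); $v_0\in V$ is the root vertex; - $P\colon\mathcal S\setminus\{v_0\}\to\mathcal S$ is the parent segment function; $P^d$ is $P$ iterated $d$ times, and $P^{ -d}(s)=\{s' : P^d(s')=s\}$; - $\delta_0\colon\mathcal S\to\mathbb N$ is the depth function: for every $s\in\mathcal S$, $P^{\delta_0(s)}(s)=v_0$; - $N\subseteq\bigcup_{d\in\mathbb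 N}(P^{ -d}(v_0))^2$ is a symmetric and reflexive relation on $\mathcal S$ such that if $(s_1,s_2)\in N$ and $s_1\ne v_0$, then $(P(s_1),P(s_2))\in N$; - $\delta_N\colon N\to\mathbb N$ is the near distance function; - with $N(s)=\{t:(s,t)\in N\}$, $|N(s)|$ is bounded by $m_N$, and $\delta_N$ is bounded by $m_d$; - $\delta(s_1,s_2)=k+l+\delta_N(P^k(s_1),P^l(s_2))$, where $k,l\in\mathbb N$ are the smallest such that $(P^k(s_1),P^l(s_2))\in N$ (necessarily $k-l=\delta_0(s_1)-\delta_0(s_2)$, so the smallest pair is well defined). "Bounded" means $(m_N,m_d)$-bounded for some constants $m_N,m_d$. A segment tree graph realizes a graph $G$ if its vertex set $V$ equals the vertex set of $G$ and $\delta(v_1,v_2)=\delta_G(v_1,v_2)$ for all vertices $v_1,v_2$. It is efficient if all the operations: deciding $s\in V$, computing $P(s)$, $P^{ -1}(s)$, $\delta_0(s)$, $N(s)$, $\delta_N(s_1,s_2)$, can be performed in amortized time $O(1)$. -}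

module Defs where

open import Data.Bool.Base using (Bool; true; false; if_then_else_)
open import Data.Fin.Base using (Fin)
open import Data.List.Base using (List; []; _∷_; length; map; foldr)
open import Data.List.Membership.Propositional using (_∈_)
open import Data.List.Relation.Unary.Unique.Propositional using (Unique)
open import Data.Nat.Base using (ℕ; zero; suc; _+_; _*_; _∸_; _≤_)
open import Data.Product.Base using (Σ; ∃; ∃-syntax; _×_; _,_; proj₁; proj₂)
open import Data.Sum.Base using (_⊎_)
open import Data.Vec.Base using (Vec; []; _∷_; lookup; _[_]≔_)
open import Function.Base using (_∘_)
open import Function.Bundles using (_⇔_)
open import Function.Definitions using (Injective)
open import Relation.Binary.Definitions using (Symmetric; Reflexive)
open import Relation.Binary.PropositionalEquality using (_≡_; _≢_)
open import Relation.Nullary.Negation using (¬_)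

------------------------------------------------------------------------
-- Graphs

-- Loops are not excluded: they affect neither distances nor geodesics.
record Graph : Set₁ where
  field
    V     : Set
    E     : V → V → Set
    E-sym : Symmetric E

AtMost : {A : Set} → ℕ → (A → Set) → Set
AtMost {A} m P = Σ (List A) λ l → length l ≤ m × (∀ x → P x → x ∈ l)

module _ (G : Graph) where
  open Graph G

  data Walk : V → V → ℕ → Set where
    stop : ∀ {x} → Walk x x 0
    step : ∀ {x y z n} → E x y → Walk y z n → Walk x z (suc n)

  vertices : ∀ {x y n} → Walk x y n → List V
  vertices {x} stop       = x ∷ []
  vertices {x} (step _ w) = x ∷ vertices w

  IsGeodesic : ∀ {x y n} → Walk x y n → Set
  IsGeodesic {x} {y} {n} _ = ∀ m → Walk x y m → n ≤ m

  -- Distances are finite, so a graph that has a distance function in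
  -- this sense is connected.
  IsGraphDistance : (V → V → ℕ) → Set
  IsGraphDistance δ = ∀ x y → Σ (Walk x y (δ x y)) IsGeodesic

  BoundedDegree : Set
  BoundedDegree = ∃[ D ] (∀ v → AtMost D (E v))

  Neighbourhood : (V → V → ℕ) → ℕ → (V → Set) → V → Set
  Neighbourhood δ d A x = ∃[ a ] (A a × δ a x ≤ d)

  -- Distances are integers, so a natural number η loses no generality.
  Hyperbolic : (V → V → ℕ) → ℕ → Set
  Hyperbolic δ η =
    ∀ {v₁ v₂ v₃ n₁ n₂ n₃}
      (γ₁ : Walk v₁ v₂ n₁) (γ₂ : Walk v₂ v₃ n₂) (γ₃ : Walk v₃ v₁ n₃) →
    IsGeodesic γ₁ → IsGeodesic γ₂ → IsGeodesic γ₃ →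
    ∀ x → x ∈ vertices γ₃ →
    Neighbourhood δ η (λ a → a ∈ vertices γ₁ ⊎ a ∈ vertices γ₂) x

------------------------------------------------------------------------
-- Segment tree graphs

-- Iterates of a parent function that is undefined at the root:
-- Iter root parent d s t means that P^d(s) is defined and equal to t.
data Iter {S : Set} (root : S) (parent : (s : S) → .(s ≢ root) → S) :
          ℕ → S → S → Set where
  here : ∀ {s} → Iter root parent 0 s s
  up   : ∀ {d s t} (s≢root : s ≢ root) →
         Iter root parent d (parent s s≢root) t →
         Iter root parent (suc d) s t

-- An (mN , md)-bounded segment tree graph whose set of vertices is
-- (the injective image of) V.  The irrelevant arguments make parent
-- and nearDist functions on the subset S ∖ {v₀} and on the relation N,
-- independent of the proof of membership.
record SegmentTreeGraph (V : Set) (v₀ : V) (mN md : ℕ) : Set₁ where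
  field
    S          : Set
    vertex     : V → S
    vertex-inj : Injective _≡_ _≡_ vertex

  root : S
  root = vertex v₀

  field
    parent : (s : S) → .(s ≢ root) → S

  Ancestor : ℕ → S → S → Set
  Ancestor = Iter root parent

  field
    depth          : S → ℕ
    depth-ancestor : ∀ s → Ancestor (depth s) s root

    Near        : S → S → Set
    near-level  : ∀ {s t} → Near s t →
                  ∃[ d ] (Ancestor d s root × Ancestor d t root)
    near-sym    : Symmetric Near
    near-refl   : Reflexive Near
    -- t ≢ root is automatic here, by near-level.
    near-parent : ∀ {s t} → Near s t → (p : s ≢ root) (q : t ≢ root) →
                  Near (parent s p) (parent t q)

    nearDist    : (s t : S) → .(Near s t) → ℕ

    near-bounded     : ∀ s → AtMost mN (Near s)
    nearDist-bounded : ∀ s t (p : Near s t) → nearDist s t p ≤ md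

  -- The graph of δ : IsDistance s₁ s₂ n means δ(s₁ , s₂) = n.
  record IsDistance (s₁ s₂ : S) (n : ℕ) : Set where
    field
      k l      : ℕ
      t₁ t₂    : S
      anc₁     : Ancestor k s₁ t₁
      anc₂     : Ancestor l s₂ t₂
      near     : Near t₁ t₂
      smallest : ∀ {k′ l′ t₁′ t₂′} → Ancestor k′ s₁ t₁′ →
                 Ancestor l′ s₂ t₂′ → Near t₁′ t₂′ → k ≤ k′ × l ≤ l′
      value    : n ≡ k + l + nearDist t₁ t₂ near

Realizes : ∀ {V v₀ mN md} → SegmentTreeGraph V v₀ mN md →
           (V → V → ℕ) → Set
Realizes T δ = ∀ v w → IsDistance (vertex v) (vertex w) (δ v w)
  where open SegmentTreeGraph T

------------------------------------------------------------------------
-- Model of computation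

-- A unit-cost machine on words and immutable pairs (pointers to cells).
-- Word arithmetic is restricted to addition and truncated subtraction.
-- Without mutable memory this is no stronger than a unit-cost RAM; for
-- worst-case O(1) computations the two agree, since such a computation
-- touches only boundedly many memory cells.
data Val : Set where
  word : ℕ → Val
  pair : Val → Val → Val

-- prim stands for any further unit-cost facilities of the machine, for
-- instance multiplication or access to an externally given graph.
data Op₁ : Set where
  car cdr isPair prim : Op₁

data Op₂ : Set where
  cons plus minus : Op₂

data Exp (n : ℕ) : Set where
  var   : Fin n → Exp n
  lit   : ℕ → Exp n
  op₁   : Op₁ → Exp n → Exp n
  op₂   : Op₂ → Exp n → Exp n → Exp n
  ite   : Exp n → Exp n → Exp n → Exp n
  bind  : Exp n → Exp (suc n) → Exp n
  -- call a closed one-argument procedure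
  call  : Exp 1 → Exp n → Exp n
  -- while i c e: repeat xᵢ := e as long as c is true; return xᵢ
  while : Fin n → Exp n → Exp n → Exp n

Program : Set
Program = Exp 1

toℕ : Val → ℕ
toℕ (word n)   = n
toℕ (pair _ _) = 0

truth : Val → Bool
truth (word zero) = false
truth _           = true

⟦_⟧₁ : Op₁ → (Val → Val) → Val → Val
⟦ car ⟧₁    _ (pair u _) = u
⟦ car ⟧₁    _ (word _)   = word 0
⟦ cdr ⟧₁    _ (pair _ v) = v
⟦ cdr ⟧₁    _ (word _)   = word 0
⟦ isPair ⟧₁ _ (pair _ _) = word 1
⟦ isPair ⟧₁ _ (word _)   = word 0
⟦ prim ⟧₁   π v          = π v

⟦_⟧₂ : Op₂ → Val → Val → Val
⟦ cons ⟧₂  u v = pair u v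
⟦ plus ⟧₂  u v = word (toℕ u + toℕ v)
⟦ minus ⟧₂ u v = word (toℕ u ∸ toℕ v)

-- π , ρ ⊢ e ⇓ v [ t ]: with prim interpreted by π, in environment ρ,
-- e evaluates to v in t elementary steps.
data _,_⊢_⇓_[_] (π : Val → Val) {n : ℕ} (ρ : Vec Val n) :
                Exp n → Val → ℕ → Set where
  var   : ∀ {i} → π , ρ ⊢ var i ⇓ lookup ρ i [ 1 ]
  lit   : ∀ {k} → π , ρ ⊢ lit k ⇓ word k [ 1 ]
  op₁   : ∀ {o e v t} → π , ρ ⊢ e ⇓ v [ t ] →
          π , ρ ⊢ op₁ o e ⇓ ⟦ o ⟧₁ π v [ suc t ]
  op₂   : ∀ {o e f u v s t} →
          π , ρ ⊢ e ⇓ u [ s ] → π , ρ ⊢ f ⇓ v [ t ] →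
          π , ρ ⊢ op₂ o e f ⇓ ⟦ o ⟧₂ u v [ suc (s + t) ]
  ite   : ∀ {c e f u v s t} →
          π , ρ ⊢ c ⇓ u [ s ] →
          π , ρ ⊢ (if truth u then e else f) ⇓ v [ t ] →
          π , ρ ⊢ ite c e f ⇓ v [ suc (s + t) ]
  bind  : ∀ {e f u v s t} →
          π , ρ ⊢ e ⇓ u [ s ] → π , (u ∷ ρ) ⊢ f ⇓ v [ t ] →
          π , ρ ⊢ bind e f ⇓ v [ suc (s + t) ]
  call  : ∀ {p e u v s t} →
          π , ρ ⊢ e ⇓ u [ s ] → π , (u ∷ []) ⊢ p ⇓ v [ t ] →
          π , ρ ⊢ call p e ⇓ v [ suc (s + t) ]
  done  : ∀ {i c e v t} →
          π , ρ ⊢ c ⇓ v [ t ] → truth v ≡ false →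
          π , ρ ⊢ while i c e ⇓ lookup ρ i [ suc t ]
  again : ∀ {i c e u v w s t r} →
          π , ρ ⊢ c ⇓ v [ s ] → truth v ≡ true →
          π , ρ ⊢ e ⇓ u [ t ] →
          π , (ρ [ i ]≔ u) ⊢ while i c e ⇓ w [ r ] →
          π , ρ ⊢ while i c e ⇓ w [ suc (s + t + r) ]

record Task : Set₁ where
  field
    Input   : Set
    encode  : Input → Val
    Correct : Input → Val → Set

-- Solvable in worst-case time O(1).
ConstantTime : (Val → Val) → Task → Set
ConstantTime π task =
  ∃[ p ] ∃[ C ] (∀ x → ∃[ v ] ∃[ t ]
    (π , (encode x ∷ []) ⊢ p ⇓ v [ t ] × Correct x v × t ≤ C))
  where open Task task

-- A data structure serving a family of operations: every program maps
-- (state , input) to (new state , output).  Serves σ rs t means that,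
-- from state σ, the requests rs are answered correctly in total time t.
data Serves (π : Val → Val) {I : Set} (task : I → Task)
            (prog : I → Program) :
            Val → List (Σ I (Task.Input ∘ task)) → ℕ → Set where
  []  : ∀ {σ} → Serves π task prog σ [] 0
  _∷_ : ∀ {σ σ′ i x v rs s t} →
        π , (pair σ (Task.encode (task i) x) ∷ []) ⊢
          prog i ⇓ pair σ′ v [ s ] × Task.Correct (task i) x v →
        Serves π task prog σ′ rs t →
        Serves π task prog σ ((i , x) ∷ rs) (s + t)

AmortizedConstantTime : (Val → Val) → {I : Set} → (I → Task) → Set
AmortizedConstantTime π task =
  ∃[ prog ] ∃[ σ₀ ] ∃[ C ] (∀ rs → ∃[ t ]
    (Serves π task prog σ₀ rs t × t ≤ C * length rs))

Decides : Set → Val → Set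
Decides P v = (P × v ≡ word 1) ⊎ (¬ P × v ≡ word 0)

-- A finite set is output as a repetition-free list of its elements.
Enumerates : {A : Set} → (A → Val) → (A → Set) → Val → Set
Enumerates {A} enc P v =
  Σ (List A) λ l → Unique l × (∀ x → x ∈ l ⇔ P x) ×
    v ≡ foldr pair (word 0) (map enc l)

distanceTo : {V : Set} → (V → V → ℕ) → V → (V → ℕ) → Task
distanceTo {V} δ v₀ code = record
  { Input   = V
  ; encode  = word ∘ code
  ; Correct = λ v out → out ≡ word (δ v v₀)
  }

neighbours : (G : Graph) → (Graph.V G → ℕ) → Task
neighbours G code = record
  { Input   = Graph.V G
  ; encode  = word ∘ code
  ; Correct = λ v → Enumerates (word ∘ code) (Graph.E G v)
  }

------------------------------------------------------------------------
-- Efficiency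

data Operation : Set where
  isVertex getParent getChildren getDepth getNear getNearDist : Operation

module _ {V v₀ mN md} (T : SegmentTreeGraph V v₀ mN md) where
  open SegmentTreeGraph T

  operation : (S → Val) → Operation → Task
  operation enc isVertex = record
    { Input   = S
    ; encode  = enc
    ; Correct = λ s → Decides (∃[ v ] vertex v ≡ s)
    }
  operation enc getParent = record
    { Input   = Σ S (λ s → s ≢ root)
    ; encode  = enc ∘ proj₁
    ; Correct = λ (s , s≢root) out → out ≡ enc (parent s s≢root)
    }
  operation enc getChildren = record
    { Input   = S
    ; encode  = enc
    ; Correct = λ s → Enumerates enc
                  (λ t → Σ (t ≢ root) λ t≢root → parent t t≢root ≡ s)
    }
  operation enc getDepth = record
    { Input   = S
    ; encode  = enc
    ; Correct = λ s out → out ≡ word (depth s)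
    }
  operation enc getNear = record
    { Input   = S
    ; encode  = enc
    ; Correct = λ s → Enumerates enc (Near s)
    }
  operation enc getNearDist = record
    { Input   = Σ S λ s → Σ S λ t → Near s t
    ; encode  = λ (s , t , _) → pair (enc s) (enc t)
    ; Correct = λ (s , t , near) out → out ≡ word (nearDist s t near)
    }

  -- Vertices are represented by the machine words code v.  As vertices
  -- are segments, the representation of segments has to extend code.
  Efficient : (Val → Val) → (V → ℕ) → Set
  Efficient π code =
    Σ (S → Val) λ enc →
      Injective _≡_ _≡_ enc ×
      (∀ v → enc (vertex v) ≡ word (code v)) ×
      AmortizedConstantTime π (operation enc)

{-# OPTIONS --safe #-}

-- A segment of level j is a truncated distance function on the sphere of
-- radius j around v₀: the vertex v has the segment u ↦ δ v u, and the parent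
-- of a segment f of level j is w ↦ min_u f u + δ u w - 1 on level j - 1.
-- Hence the k-th ancestor of v is u ↦ δ v u - k.  Two segments of the same
-- level are near if their supports, and those of their first M ancestors,
-- are close to each other.  As rays to the root converge by hyperbolicity,
-- the same then holds for all further ancestors.  Let s and t be the k-th
-- and l-th ancestors of v and w, near, on the level farthest from the root
-- where this happens.  A geodesic from v to w meets this level, for otherwise
-- hyperbolicity would make the ancestors near one level before; and if it
-- does so at u, then δ v w = (k + s u) + (l + t u).  So nearDist s t can be
-- taken to be min_u s u + t u.
--
-- All of this is local: a segment is determined by its values on a ball
-- around any of its zeros, so every operation is a computation on boundedly
-- many vertices.
module Submission where

open import Defs
open import Algebra.Properties.CommutativeSemigroup using (interchange)
open import Data.Bool.Base using (Bool; true; false; T; if_then_else_; _∧_)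
open import Data.Bool.Properties using (T-∧)
open import Data.Empty using (⊥-elim)
open import Data.Fin.Base as Fin using (Fin; zero; suc; fromℕ<)
open import Data.Fin.Properties using (toℕ-injective; toℕ-fromℕ<; toℕ≤pred[n])
open import Data.List.Base as List using (List; []; _∷_; _++_; length; map; foldr;
  filter; concatMap; deduplicate; upTo; cartesianProductWith)
open import Data.List.Membership.Propositional using (_∈_; lose; find)
open import Data.List.Membership.Propositional.Properties
  using (∈-map⁺; ∈-map⁻; ∈-filter⁺; ∈-filter⁻; ∈-concatMap⁺; ∈-concatMap⁻; ∈-lookup;
         ∈-deduplicate⁺; ∈-deduplicate⁻; ∈-upTo⁺;
         ∈-cartesianProductWith⁺; ∈-cartesianProductWith⁻)
import Data.List.Membership.DecPropositional as DecMembership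
open import Data.List.Properties using (length-++; length-map; length-filter; length-upTo; map-∘)
open import Data.List.Relation.Unary.All as All using (All; []; _∷_)
open import Data.List.Relation.Unary.AllPairs using ([]; _∷_)
open import Data.List.Relation.Unary.Any as Any using (Any; here; there)
open import Data.List.Relation.Unary.Any.Properties using (lookup-index)
open import Data.List.Relation.Unary.Unique.Propositional using (Unique)
open import Data.List.Relation.Unary.Unique.DecPropositional.Properties using (deduplicate-!)
open import Data.List.Relation.Unary.Unique.Propositional.Properties
  using (map⁺; map⁻; filter⁺; cartesianProductWith⁺; upTo⁺)
open import Data.Nat.Base
open import Data.Nat.Properties
open import Data.Product.Base using (Σ; ∃-syntax; _×_; _,_; proj₁; proj₂)
open import Data.Sum.Base using (_⊎_; inj₁; inj₂; [_,_]′)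
open import Data.Vec.Base as Vec using (Vec; []; _∷_)
open import Data.Vec.N-ary using (N-ary; _$ⁿ_)
open import Data.Vec.Properties using (lookup∘tabulate; tabulate∘lookup; tabulate-cong)
open import Function.Base using (_∘_; id)
open import Function.Bundles using (module Equivalence; mk⇔)
open import Function.Definitions using (Injective)
open import Relation.Binary.Definitions using (DecidableEquality)
open import Relation.Binary.PropositionalEquality
open import Relation.Nullary.Decidable
  using (Dec; yes; no; does; dec-true; does-≡; map′; recompute; _×-dec_; _→-dec_)
open import Relation.Nullary.Negation using (¬_)

-- Linear arithmetic over ℕ

-- Two demands pull against each other. Nearness has to pass to parents, although hyperbolicity
-- controls the distance of rays only up to a constant; and it has to be decidable from boundedly
-- many vertices, although the ancestors reach to the root. Testing M levels meets both: points of
-- close supports are at most 3D apart, and after M steps with 2M > 3D + 2η the rays from them are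
-- within 4η, from which closeness with the same D follows again. The value D = 12η + 1 is 4η, for
-- passing from two support points to rays, plus the 8η + 1 of `escape`, the distance that rays can
-- still have at the level where the geodesic turns back. Having a zero and being near oneself is
-- local, passes to parents, and is enough for bounded near sets. Values above D are merged into one
-- infinite value, so that a segment is a finite amount of data around any of its zeros.

module Linear where

  infixl 7 _⊕_
  infixl 8 _⊛_
  infix  6 _⊑_
  infixr 5 _⊑_⇛_ _≐_⇛_

  data Expr (n : ℕ) : Set where
    var : Fin n → Expr n
    #_  : ℕ → Expr n
    _⊕_ : Expr n → Expr n → Expr n
    _⊛_ : ℕ → Expr n → Expr n

  data Claim (n : ℕ) : Set where
    _⊑_   : Expr n → Expr n → Claim n
    _⊑_⇛_ : Expr n → Expr n → Claim n → Claim n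
    _≐_⇛_ : Expr n → Expr n → Claim n → Claim n

  ⟦_⟧ : ∀ {n} → Expr n → Vec ℕ n → ℕ
  ⟦ var i ⟧ ρ = Vec.lookup ρ i
  ⟦ # k ⟧   ρ = k
  ⟦ a ⊕ b ⟧ ρ = ⟦ a ⟧ ρ + ⟦ b ⟧ ρ
  ⟦ k ⊛ a ⟧ ρ = k * ⟦ a ⟧ ρ

  Holds : ∀ {n} → Claim n → Vec ℕ n → Set
  Holds (a ⊑ b)     ρ = ⟦ a ⟧ ρ ≤ ⟦ b ⟧ ρ
  Holds (a ⊑ b ⇛ c) ρ = ⟦ a ⟧ ρ ≤ ⟦ b ⟧ ρ → Holds c ρ
  Holds (a ≐ b ⇛ c) ρ = ⟦ a ⟧ ρ ≡ ⟦ b ⟧ ρ → Holds c ρ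

  -- A linear form; the head is the constant term.
  Form : ℕ → Set
  Form n = Vec ℕ (suc n)

  dot : ∀ {n} → Vec ℕ n → Vec ℕ n → ℕ
  dot []       []       = 0
  dot (c ∷ cs) (x ∷ xs) = c * x + dot cs xs

  eval : ∀ {n} → Form n → Vec ℕ n → ℕ
  eval f ρ = dot f (1 ∷ ρ)

  unit : ∀ {n} → Fin n → Vec ℕ n
  unit {suc n} zero    = 1 ∷ Vec.replicate n 0
  unit         (suc i) = 0 ∷ unit i

  _⊞_ : ∀ {n} → Vec ℕ n → Vec ℕ n → Vec ℕ n
  _⊞_ = Vec.zipWith _+_

  norm : ∀ {n} → Expr n → Form n
  norm (var i) = 0 ∷ unit i
  norm (# k)   = k ∷ Vec.replicate _ 0
  norm (a ⊕ b) = norm a ⊞ norm b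
  norm (k ⊛ a) = Vec.map (k *_) (norm a)

  dot-zero : ∀ {n} (xs : Vec ℕ n) → dot (Vec.replicate n 0) xs ≡ 0
  dot-zero []       = refl
  dot-zero (x ∷ xs) = dot-zero xs

  dot-unit : ∀ {n} i (xs : Vec ℕ n) → dot (unit i) xs ≡ Vec.lookup xs i
  dot-unit zero    (x ∷ xs) =
    trans (cong₂ _+_ (*-identityˡ x) (dot-zero xs)) (+-identityʳ x)
  dot-unit (suc i) (x ∷ xs) = dot-unit i xs

  dot-⊞ : ∀ {n} (as bs xs : Vec ℕ n) →
          dot (as ⊞ bs) xs ≡ dot as xs + dot bs xs
  dot-⊞ []       []       []       = refl
  dot-⊞ (a ∷ as) (b ∷ bs) (x ∷ xs) =
    trans (cong ((a + b) * x +_) (dot-⊞ as bs xs)) (rearrange a b x _ _)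
    where
    rearrange : ∀ a b x p q → (a + b) * x + (p + q) ≡ a * x + p + (b * x + q)
    rearrange a b x p q = trans (cong (_+ (p + q)) (*-distribʳ-+ x a b))
      (interchange +-commutativeSemigroup (a * x) (b * x) p q)

  dot-scale : ∀ {n} k (as xs : Vec ℕ n) →
              dot (Vec.map (k *_) as) xs ≡ k * dot as xs
  dot-scale k []       []       = sym (*-zeroʳ k)
  dot-scale k (a ∷ as) (x ∷ xs) =
    trans (cong (k * a * x +_) (dot-scale k as xs)) (rearrange k a x _)
    where
    rearrange : ∀ k a x p → k * a * x + k * p ≡ k * (a * x + p)
    rearrange k a x p = sym (trans (*-distribˡ-+ k (a * x) p)
      (cong (_+ k * p) (sym (*-assoc k a x))))

  eval-norm : ∀ {n} (e : Expr n) ρ → eval (norm e) ρ ≡ ⟦ e ⟧ ρ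
  eval-norm (var i) ρ = dot-unit i ρ
  eval-norm (# k)   ρ = trans (cong₂ _+_ (*-identityʳ k) (dot-zero ρ)) (+-identityʳ k)
  eval-norm (a ⊕ b) ρ =
    trans (dot-⊞ (norm a) (norm b) (1 ∷ ρ)) (cong₂ _+_ (eval-norm a ρ) (eval-norm b ρ))
  eval-norm (k ⊛ a) ρ =
    trans (dot-scale k (norm a) (1 ∷ ρ)) (cong (k *_) (eval-norm a ρ))

  _≤ᶜ_ : ∀ {n} → Vec ℕ n → Vec ℕ n → Bool
  []       ≤ᶜ []       = true
  (a ∷ as) ≤ᶜ (b ∷ bs) = (a ≤ᵇ b) ∧ (as ≤ᶜ bs)

  dot-mono : ∀ {n} (as bs xs : Vec ℕ n) → T (as ≤ᶜ bs) → dot as xs ≤ dot bs xs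
  dot-mono []       []       []       _ = ≤-refl
  dot-mono (a ∷ as) (b ∷ bs) (x ∷ xs) p =
    let p₁ , p₂ = Equivalence.to T-∧ p in
    +-mono-≤ (*-monoˡ-≤ x (≤ᵇ⇒≤ a b p₁)) (dot-mono as bs xs p₂)

  -- The sum L ≤ R of the hypotheses has to imply the conclusion.
  follows : ∀ {n} → Claim n → Form n → Form n → Bool
  follows (a ⊑ b)     L R = (norm a ⊞ R) ≤ᶜ (norm b ⊞ L)
  follows (a ⊑ b ⇛ c) L R = follows c (L ⊞ norm a) (R ⊞ norm b)
  follows (a ≐ b ⇛ c) L R = follows c (L ⊞ norm a) (R ⊞ norm b)

  add-hypothesis : ∀ {n} (a b : Expr n) (L R : Form n) ρ →
                   eval L ρ ≤ eval R ρ → ⟦ a ⟧ ρ ≤ ⟦ b ⟧ ρ →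
                   eval (L ⊞ norm a) ρ ≤ eval (R ⊞ norm b) ρ
  add-hypothesis a b L R ρ L≤R a≤b = begin
    eval (L ⊞ norm a) ρ        ≡⟨ dot-⊞ L (norm a) (1 ∷ ρ) ⟩
    eval L ρ + eval (norm a) ρ ≡⟨ cong (eval L ρ +_) (eval-norm a ρ) ⟩
    eval L ρ + ⟦ a ⟧ ρ         ≤⟨ +-mono-≤ L≤R a≤b ⟩
    eval R ρ + ⟦ b ⟧ ρ         ≡⟨ cong (eval R ρ +_) (eval-norm b ρ) ⟨
    eval R ρ + eval (norm b) ρ ≡⟨ dot-⊞ R (norm b) (1 ∷ ρ) ⟨
    eval (R ⊞ norm b) ρ        ∎
    where open ≤-Reasoning

  sound : ∀ {n} (c : Claim n) ρ (L R : Form n) → T (follows c L R) →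
          eval L ρ ≤ eval R ρ → Holds c ρ
  sound (a ⊑ b) ρ L R p L≤R = +-cancelʳ-≤ (eval R ρ) _ _ (begin
    ⟦ a ⟧ ρ + eval R ρ         ≡⟨ cong (_+ eval R ρ) (eval-norm a ρ) ⟨
    eval (norm a) ρ + eval R ρ ≡⟨ dot-⊞ (norm a) R (1 ∷ ρ) ⟨
    eval (norm a ⊞ R) ρ        ≤⟨ dot-mono (norm a ⊞ R) (norm b ⊞ L) (1 ∷ ρ) p ⟩
    eval (norm b ⊞ L) ρ        ≡⟨ dot-⊞ (norm b) L (1 ∷ ρ) ⟩
    eval (norm b) ρ + eval L ρ ≡⟨ cong (_+ eval L ρ) (eval-norm b ρ) ⟩
    ⟦ b ⟧ ρ + eval L ρ         ≤⟨ +-monoʳ-≤ (⟦ b ⟧ ρ) L≤R ⟩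
    ⟦ b ⟧ ρ + eval R ρ         ∎)
    where open ≤-Reasoning
  sound (a ⊑ b ⇛ c) ρ L R p L≤R a≤b =
    sound c ρ (L ⊞ norm a) (R ⊞ norm b) p (add-hypothesis a b L R ρ L≤R a≤b)
  sound (a ≐ b ⇛ c) ρ L R p L≤R a≡b =
    sound c ρ (L ⊞ norm a) (R ⊞ norm b) p
      (add-hypothesis a b L R ρ L≤R (≤-reflexive a≡b))

  -- The certificate is the plain sum of the hypotheses, compared coefficientwise, so nothing is
  -- searched for: a hypothesis needed twice is supplied twice, and an equation counts only as the
  -- inequality from left to right. The implicit argument is found by evaluation.
  linear : ∀ {n} (ρ : Vec ℕ n) (f : N-ary n (Expr n) (Claim n)) →
           let c = f $ⁿ Vec.tabulate var ; z = Vec.replicate (suc n) 0 in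
           {_ : T (follows c z z)} → Holds c ρ
  linear ρ f {p} = sound (f $ⁿ Vec.tabulate var) ρ _ _ p ≤-refl

open Linear using (linear; #_; _⊕_; _⊛_; _⊑_; _⊑_⇛_; _≐_⇛_)

-- Walks and distances

module _ {G : Graph} where
  open Graph G

  infixr 5 _++ʷ_

  _++ʷ_ : ∀ {x y z m n} → Walk G x y m → Walk G y z n → Walk G x z (m + n)
  stop     ++ʷ w′ = w′
  step e w ++ʷ w′ = step e (w ++ʷ w′)

  reverseʷ : ∀ {x y n} → Walk G x y n → Walk G y x n
  reverseʷ stop = stop
  reverseʷ (step {n = n} e w) =
    subst (Walk G _ _) (+-comm n 1) (reverseʷ w ++ʷ step (E-sym e) stop)

  splitʷ : ∀ {x y} a {b} → Walk G x y (a + b) → ∃[ z ] Walk G x z a × Walk G z y b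
  splitʷ zero    w          = _ , stop , w
  splitʷ (suc a) (step e w) =
    let z , w₁ , w₂ = splitʷ a w in z , step e w₁ , w₂

  split-vertex : ∀ {x y n z} (w : Walk G x y n) → z ∈ vertices G w →
                 ∃[ a ] ∃[ b ] Walk G x z a × Walk G z y b × a + b ≡ n
  split-vertex stop       (here refl) = 0 , 0 , stop , stop , refl
  split-vertex (step e w) (here refl) = 0 , _ , stop , step e w , refl
  split-vertex (step e w) (there z∈w) =
    let a , b , w₁ , w₂ , eq = split-vertex w z∈w
    in suc a , b , step e w₁ , w₂ , cong suc eq

  start∈ : ∀ {x y n} (w : Walk G x y n) → x ∈ vertices G w
  start∈ stop       = here refl
  start∈ (step _ _) = here refl

  junction∈ : ∀ {x y z m n} (w : Walk G x y m) (w′ : Walk G y z n) →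
              y ∈ vertices G (w ++ʷ w′)
  junction∈ stop       w′ = start∈ w′
  junction∈ (step _ w) w′ = there (junction∈ w w′)

module Metric (G : Graph) (δ : Graph.V G → Graph.V G → ℕ)
              (isDist : IsGraphDistance G δ) where
  open Graph G

  geodesic : ∀ x y → Walk G x y (δ x y)
  geodesic x y = proj₁ (isDist x y)

  δ≤ : ∀ {x y n} → Walk G x y n → δ x y ≤ n
  δ≤ {x} {y} w = proj₂ (isDist x y) _ w

  δ-refl : ∀ x → δ x x ≡ 0
  δ-refl x = n≤0⇒n≡0 (δ≤ stop)

  δ-sym : ∀ x y → δ x y ≡ δ y x
  δ-sym x y = ≤-antisym (δ≤ (reverseʷ (geodesic y x))) (δ≤ (reverseʷ (geodesic x y)))

  δ-triangle : ∀ x y z → δ x z ≤ δ x y + δ y z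
  δ-triangle x y z = δ≤ (geodesic x y ++ʷ geodesic y z)

  δ≡0 : ∀ {x y} → δ x y ≡ 0 → x ≡ y
  δ≡0 {x} {y} eq = empty (subst (Walk G x y) eq (geodesic x y))
    where
    empty : ∀ {x y} → Walk G x y 0 → x ≡ y
    empty stop = refl

  E⇒δ≤1 : ∀ {x y} → E x y → δ x y ≤ 1
  E⇒δ≤1 e = δ≤ (step e stop)

  _≟ⱽ_ : DecidableEquality V
  x ≟ⱽ y = map′ δ≡0 (λ { refl → δ-refl x }) (δ x y ≟ 0)

  Between : V → V → V → Set
  Between x z y = δ x z + δ z y ≡ δ x y

  between : ∀ {x y z} → δ x z + δ z y ≤ δ x y → Between x z y
  between {x} {y} {z} le = ≤-antisym le (δ-triangle x z y)

  -- The lengths add up to the distance, so slack in one walk would violate the triangle inequality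
  -- through `z`.
  between-walk : ∀ {x y z a b} → Walk G x z a → Walk G z y b → a + b ≡ δ x y →
                 δ x z ≡ a × δ z y ≡ b
  between-walk {x} {y} {z} {a} {b} w₁ w₂ eq =
    ≤-antisym (δ≤ w₁)
      (linear (a ∷ b ∷ δ x z ∷ δ z y ∷ δ x y ∷ [])
        (λ a b p q s → a ⊕ b ≐ s ⇛ q ⊑ b ⇛ s ⊑ p ⊕ q ⇛ a ⊑ p)
        eq (δ≤ w₂) (δ-triangle x z y)) ,
    ≤-antisym (δ≤ w₂)
      (linear (a ∷ b ∷ δ x z ∷ δ z y ∷ δ x y ∷ [])
        (λ a b p q s → a ⊕ b ≐ s ⇛ p ⊑ a ⇛ s ⊑ p ⊕ q ⇛ b ⊑ q)
        eq (δ≤ w₁) (δ-triangle x z y))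

  split : ∀ {x y} a b → δ x y ≡ a + b → ∃[ z ] δ x z ≡ a × δ z y ≡ b
  split {x} {y} a b eq =
    let z , w₁ , w₂ = splitʷ a (subst (Walk G x y) eq (geodesic x y))
    in z , between-walk w₁ w₂ (sym eq)

  between-sym : ∀ {x y z} → Between x z y → Between y z x
  between-sym {x} {y} {z} b = trans (cong₂ _+_ (δ-sym y z) (δ-sym z x))
    (trans (+-comm (δ z y) (δ x z)) (trans b (δ-sym x y)))

  between-split : ∀ {x y z a b} → δ x y ≡ a + b → δ x z ≡ a → δ z y ≡ b → Between x z y
  between-split eq eq₁ eq₂ = trans (cong₂ _+_ eq₁ eq₂) (sym eq)

  between-trans : ∀ {x y z t} → Between x z y → Between x t z → Between x t y
  between-trans {x} {y} {z} {t} b₁ b₂ = between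
    (linear (δ x t ∷ δ t y ∷ δ x y ∷ δ x z ∷ δ z y ∷ δ t z ∷ [])
      (λ xt ty xy xz zy tz → xz ⊕ zy ≐ xy ⇛ xt ⊕ tz ≐ xz ⇛ ty ⊑ tz ⊕ zy ⇛ xt ⊕ ty ⊑ xy)
      b₁ b₂ (δ-triangle t z y))

  tri : ∀ {x z} y → δ x z ≤ δ y x + δ y z
  tri {x} {z} y = subst (λ d → δ x z ≤ d + δ y z) (δ-sym x y) (δ-triangle x y z)

  tri′ : ∀ {x z} y → δ x z ≤ δ x y + δ z y
  tri′ {x} {z} y = subst (λ d → δ x z ≤ δ x y + d) (δ-sym y z) (δ-triangle x y z)

  tri₂ : ∀ {x z} y → δ x z ≤ δ y x + δ z y
  tri₂ {x} {z} y = subst (λ d → δ x z ≤ δ y x + d) (δ-sym y z) (tri y)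

  -- Thin triangles and rays to the root

  module Hyperbolicity (η : ℕ) (hyperbolic : Hyperbolic G δ η) where

    -- A point metrically between `x` and `y` lies on the geodesic joined from two geodesics through
    -- it, so hyperbolicity applies to it and later arguments can deal with distances alone.
    thin : ∀ {x y p} z → Between x p y →
           ∃[ a ] (Between x a z ⊎ Between y a z) × δ a p ≤ η
    thin {x} {y} {p} z b =
      let γ₃ = geodesic x p ++ʷ geodesic p y
          a , a∈ , near = hyperbolic (geodesic y z) (geodesic z x) γ₃
            (proj₂ (isDist y z)) (proj₂ (isDist z x))
            (λ m w → subst (_≤ m) (sym b) (δ≤ w))
            p (junction∈ (geodesic x p) (geodesic p y))
      in a , [ (λ i → inj₂ (on i)) , (λ i → inj₁ (between-sym (on i))) ]′ a∈ , near
      where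
      on : ∀ {x y a} → a ∈ vertices G (geodesic x y) → Between x a y
      on {x} {y} a∈ =
        let k , l , w₁ , w₂ , eq = split-vertex (geodesic x y) a∈
            eq₁ , eq₂ = between-walk w₁ w₂ eq
        in between-split (sym eq) eq₁ eq₂

    module Levels (v₀ : V) where

      lev : V → ℕ
      lev v = δ v v₀

      lev-v₀ : lev v₀ ≡ 0
      lev-v₀ = δ-refl v₀

      lev≡0 : ∀ {u} → lev u ≡ 0 → u ≡ v₀
      lev≡0 = δ≡0

      lev≤ : ∀ {x} y → lev x ≤ δ x y + lev y
      lev≤ {x} y = δ-triangle x y v₀

      lev≤′ : ∀ {x} y → lev x ≤ δ y x + lev y
      lev≤′ {x} y = tri y

      -- Geodesics to the root branch, so this is a relation: a drop in level equal to the distance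
      -- says that `a` lies on one of them.
      record Above (i : ℕ) (u a : V) : Set where
        constructor above
        field
          dist  : δ u a ≡ i
          level : lev u ≡ i + lev a

      above-between : ∀ {i u a} → Above i u a → Between u a v₀
      above-between (above d l) = between-split l d refl

      ancestor : ∀ {u} i j → lev u ≡ i + j → ∃[ a ] Above i u a × lev a ≡ j
      ancestor {u} i j eq =
        let a , d , l = split i j eq in a , above d (trans eq (cong (i +_) (sym l))) , l

      -- Along an edge the level drops by at most one, so the geodesic cannot skip level `j`.
      crossing : ∀ {x y} j → j ≤ lev x → lev y ≤ j → ∃[ u ] Between x u y × lev u ≡ j
      crossing {x} {y} j j≤ ≤j =
        let u , a , b , w₁ , w₂ , eq , l = walk (geodesic x y) j≤ ≤j
            eq₁ , eq₂ = between-walk w₁ w₂ eq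
        in u , between-split (sym eq) eq₁ eq₂ , l
        where
        walk : ∀ {x y n} → Walk G x y n → j ≤ lev x → lev y ≤ j →
               ∃[ u ] ∃[ a ] ∃[ b ] Walk G x u a × Walk G u y b × a + b ≡ n × lev u ≡ j
        walk {x} w j≤ ≤j with lev x ≟ j
        ... | yes eq = x , 0 , _ , stop , w , refl , eq
        walk stop j≤ ≤j | no ≢j = ⊥-elim (≢j (≤-antisym ≤j j≤))
        walk {x} (step {y = z} e w) j≤ ≤j | no ≢j =
          let u , a , b , w₁ , w₂ , eq , l = walk w
                (≤-pred (≤-trans (≤∧≢⇒< j≤ (λ eq → ≢j (sym eq)))
                                 (≤-trans (lev≤ z) (+-monoˡ-≤ (lev z) (E⇒δ≤1 e))))) ≤j
          in u , suc a , b , step e w₁ , w₂ , cong suc eq , l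

      -- Some `r` within η of `a` lies on a geodesic from `u` to `u₁` or to `v₀`. Up to η it is `i`
      -- steps from `u₁`, respectively on the level of `a`, so the part of that geodesic between `r`
      -- and `u` has length at most η + c.
      near-above : ∀ {i u₁ a} u c → Above i u₁ a → lev u ≤ lev a + c →
                   δ u₁ u ≤ i + c → δ a u ≤ 2 * η + c
      near-above {i} {u₁} {a} u c A lu du = cases (thin u (above-between A))
        where
        cases : ∃[ r ] (Between u₁ r u ⊎ Between v₀ r u) × δ r a ≤ η → δ a u ≤ 2 * η + c
        cases (r , inj₁ b , rn) =
          linear (δ a u ∷ δ r a ∷ δ r u ∷ δ u₁ r ∷ δ u₁ u ∷ i ∷ c ∷ η ∷ δ u₁ a ∷ [])
            (λ au ra ru r₁ u₁u i c η ua →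
               au ⊑ ra ⊕ ru ⇛ ra ⊑ η ⇛ r₁ ⊕ ru ≐ u₁u ⇛ u₁u ⊑ i ⊕ c ⇛ i ≐ ua ⇛
               ua ⊑ r₁ ⊕ ra ⇛ ra ⊑ η ⇛ au ⊑ 2 ⊛ η ⊕ c)
            (tri r) rn b du (sym (Above.dist A)) (δ-triangle u₁ r a) rn
        cases (r , inj₂ b , rn) =
          linear (δ a u ∷ δ r a ∷ δ u r ∷ lev r ∷ lev u ∷ lev a ∷ c ∷ η ∷ [])
            (λ au ra ur lr lu la c η →
               au ⊑ ra ⊕ ur ⇛ ra ⊑ η ⇛ ur ⊕ lr ≐ lu ⇛ lu ⊑ la ⊕ c ⇛ la ⊑ ra ⊕ lr ⇛ ra ⊑ η ⇛
               au ⊑ 2 ⊛ η ⊕ c)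
            (tri₂ r) rn (between-sym b) lu (lev≤′ r) rn

      -- The point `r` near `a` cannot lie on the side from `x` to `y`: it would be at least i - η
      -- away from both ends, too much for length `L`. On the side to the root it has the level of
      -- `b` up to η, so `near-above` gives 3η, and the way from `r` to `a` adds η.
      contract : ∀ {i x y a b} L → Above i x a → Above i y b → lev x ≡ lev y →
                 δ x y ≤ L → L + 2 * η < 2 * i → δ a b ≤ 4 * η
      contract {i} {x} {y} {a} {b} L A B lxy dxy far = cases (thin y (above-between A))
        where
        cases : ∃[ r ] (Between x r y ⊎ Between v₀ r y) × δ r a ≤ η → δ a b ≤ 4 * η
        cases (r , inj₂ br , rn) =
          linear (δ a b ∷ δ r a ∷ δ b r ∷ η ∷ [])
            (λ ab ra br η → ab ⊑ ra ⊕ br ⇛ ra ⊑ η ⇛ br ⊑ 2 ⊛ η ⊕ η ⇛ ab ⊑ 4 ⊛ η)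
            (tri₂ r) rn
            (near-above r η B
              (linear (lev r ∷ δ r a ∷ lev a ∷ lev b ∷ η ∷ i ∷ lev x ∷ lev y ∷ [])
                (λ lr ra la lb η i lx ly →
                   lr ⊑ ra ⊕ la ⇛ ra ⊑ η ⇛ i ⊕ la ≐ lx ⇛ lx ≐ ly ⇛ ly ≐ i ⊕ lb ⇛
                   lr ⊑ lb ⊕ η)
                (lev≤ a) rn (sym (Above.level A)) lxy (Above.level B))
              (linear (lev r ∷ δ r a ∷ lev a ∷ δ y r ∷ η ∷ i ∷ lev x ∷ lev y ∷ [])
                (λ lr ra la yr η i lx ly →
                   yr ⊕ lr ≐ ly ⇛ la ⊑ ra ⊕ lr ⇛ ra ⊑ η ⇛ ly ≐ lx ⇛ lx ≐ i ⊕ la ⇛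
                   yr ⊑ i ⊕ η)
                (between-sym br) (lev≤′ r) rn (sym lxy) (Above.level A)))
        cases (r , inj₁ br , rn) = ⊥-elim (<⇒≱ far
          (linear (i ∷ L ∷ η ∷ δ x r ∷ δ r y ∷ δ x y ∷ δ r a ∷ lev y ∷ lev r ∷ lev a ∷
                   lev x ∷ δ x a ∷ [])
            (λ i L η xr ry xy ra ly lr la lx xa →
               i ≐ xa ⇛ xa ⊑ xr ⊕ ra ⇛ ra ⊑ η ⇛ ly ⊑ ry ⊕ lr ⇛ lr ⊑ ra ⊕ la ⇛ ra ⊑ η ⇛
               lx ≐ ly ⇛ i ⊕ la ≐ lx ⇛ xr ⊕ ry ≐ xy ⇛ xy ⊑ L ⇛ 2 ⊛ i ⊑ L ⊕ 2 ⊛ η)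
            (sym (Above.dist A)) (δ-triangle x r a) rn (lev≤′ r) (lev≤ a) rn
            lxy (sym (Above.level A)) br dxy))

      module _ {k l v w a b} h (A : Above k v a) (B : Above l w b)
               (la : lev a ≡ h) (lb : lev b ≡ h)
               (low : ∀ u → Between v u w → h ≤ lev u) where

        private
          close : ∀ {p a} → lev a ≡ h → δ p a ≤ η → lev p ≤ h + η
          close {p} {a} la pn =
            linear (lev p ∷ δ p a ∷ lev a ∷ h ∷ η ∷ [])
              (λ lp pa la h η → lp ⊑ pa ⊕ la ⇛ pa ⊑ η ⇛ la ≐ h ⇛ lp ⊑ h ⊕ η)
              (lev≤ a) pn la

          -- The level of `r` is at least h - η, so the ray from `p` needs at most 2η to get there.
          hop : ∀ {p q r} → lev p ≤ h + η → h ≤ lev q → Between p r v₀ → δ r q ≤ η →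
                δ p q ≤ 3 * η
          hop {p} {q} {r} lp lq b rn =
            linear (δ p q ∷ δ p r ∷ δ r q ∷ lev p ∷ lev r ∷ lev q ∷ h ∷ η ∷ [])
              (λ pq pr rq lp lr lq h η →
                 pq ⊑ pr ⊕ rq ⇛ pr ⊕ lr ≐ lp ⇛ lp ⊑ h ⊕ η ⇛ h ⊑ lq ⇛ lq ⊑ rq ⊕ lr ⇛
                 rq ⊑ η ⇛ rq ⊑ η ⇛ pq ⊑ 3 ⊛ η)
              (δ-triangle p r q) b lp lq (lev≤′ r) rn rn

          -- The obstacle is a long stretch of the geodesic just above level `h`. Its point `q` at
          -- distance 3η + 1 from `p` still lies between `v` and `w`, so `low` applies to it, and it
          -- is within η of a ray from `p` or from `p′`. The choice of the distance excludes the
          -- first case by `hop`; in the second `hop` bounds the rest of the stretch by 3η.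
          short : ∀ {p p′} → Between v p w → Between w p′ p → lev p ≤ h + η →
                  lev p′ ≤ h + η → δ p p′ ≤ 6 * η + 1
          short {p} {p′} bp bp′ lp lp′ =
            [ (λ le → linear (δ p p′ ∷ η ∷ [])
                 (λ d η → d ⊑ 3 ⊛ η ⊕ # 1 ⇛ d ⊑ 6 ⊛ η ⊕ # 1) le)
            , long ]′ (≤-total (δ p p′) (3 * η + 1))
            where
            middle : ∀ {q r} → Between p q p′ → δ p q ≡ 3 * η + 1 →
                     Between p r v₀ ⊎ Between p′ r v₀ → δ r q ≤ η → δ p p′ ≤ 6 * η + 1
            middle {q} bq e (inj₁ br) rn = ⊥-elim (<⇒≱
              (subst (_≤ 3 * η) (trans e (+-comm (3 * η) 1))
                (hop lp (low q (between-sym (between-trans (between-sym bp)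
                   (between-sym (between-trans (between-sym bp′) bq))))) br rn)) ≤-refl)
            middle {q} bq e (inj₂ br) rn =
              linear (δ p p′ ∷ δ p q ∷ δ p′ q ∷ η ∷ [])
                (λ pp pq p′q η → pp ⊑ pq ⊕ p′q ⇛ pq ≐ 3 ⊛ η ⊕ # 1 ⇛ p′q ⊑ 3 ⊛ η ⇛
                   pp ⊑ 6 ⊛ η ⊕ # 1)
                (tri′ q) e
                (hop lp′ (low q (between-sym (between-trans (between-sym bp)
                   (between-sym (between-trans (between-sym bp′) bq))))) br rn)

            long : 3 * η + 1 ≤ δ p p′ → δ p p′ ≤ 6 * η + 1
            long le =
              let eq = sym (m+[n∸m]≡n le)
                  q , e₁ , e₂ = split (3 * η + 1) (δ p p′ ∸ (3 * η + 1)) eq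
                  bq = between-split eq e₁ e₂
                  r , side , rn = thin v₀ bq
              in middle bq e₁ side rn

          on-geodesic : ∀ p → Between v p w → δ p a ≤ η →
                        ∃[ s ] (Between w s p ⊎ Between v₀ s p) × δ s b ≤ η →
                        δ a b ≤ 8 * η + 1
          on-geodesic p bp pn (s , inj₂ bs , sn) =
            linear (δ a b ∷ δ p a ∷ δ p s ∷ δ s b ∷ δ p b ∷ lev p ∷ lev s ∷ lev a ∷ lev b ∷
                    h ∷ η ∷ [])
              (λ ab pa ps sb pb lp ls la lb h η →
                 ab ⊑ pa ⊕ pb ⇛ pb ⊑ ps ⊕ sb ⇛ pa ⊑ η ⇛ sb ⊑ η ⇛ ps ⊕ ls ≐ lp ⇛
                 lb ⊑ sb ⊕ ls ⇛ lp ⊑ pa ⊕ la ⇛ la ≐ h ⇛ h ≐ lb ⇛ pa ⊑ η ⇛ sb ⊑ η ⇛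
                 ab ⊑ 8 ⊛ η ⊕ # 1)
              (tri p) (δ-triangle p s b) pn sn (between-sym bs) (lev≤′ s)
              (lev≤ a) la (sym lb) pn sn
          on-geodesic p bp pn (p′ , inj₁ bp′ , p′n) =
            linear (δ a b ∷ δ p a ∷ δ p p′ ∷ δ p′ b ∷ δ p b ∷ η ∷ [])
              (λ ab pa pp p′b pb η →
                 ab ⊑ pa ⊕ pb ⇛ pb ⊑ pp ⊕ p′b ⇛ pa ⊑ η ⇛ p′b ⊑ η ⇛ pp ⊑ 6 ⊛ η ⊕ # 1 ⇛
                 ab ⊑ 8 ⊛ η ⊕ # 1)
              (tri p) (δ-triangle p p′ b) pn p′n
              (short bp bp′ (close la pn) (close lb p′n))

        -- If `a` is close to the side from `w` to the root, `near-above` compares it with `b`.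
        -- Otherwise it is close to a point `p` between `v` and `w`, and the triangle for `b` is
        -- taken with corner `p` instead of `v`: if `b` is close to a point `p′` of the side from
        -- `w` to `p`, then `p` and `p′` lie on a common geodesic and `short` applies, with total η
        -- + (6η + 1) + η.
        escape : δ a b ≤ 8 * η + 1
        escape = cases (thin w (above-between A))
          where
          cases : ∃[ r ] (Between v r w ⊎ Between v₀ r w) × δ r a ≤ η → δ a b ≤ 8 * η + 1
          cases (p , inj₁ bp , pn) = on-geodesic p bp pn (thin p (above-between B))
          cases (r , inj₂ br , rn) =
            linear (δ a b ∷ δ r a ∷ δ b r ∷ η ∷ [])
              (λ ab ra br η → ab ⊑ ra ⊕ br ⇛ ra ⊑ η ⇛ br ⊑ 2 ⊛ η ⊕ η ⇛ ab ⊑ 8 ⊛ η ⊕ # 1)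
              (tri₂ r) rn
              (near-above r η B
                (linear (lev r ∷ δ r a ∷ lev a ∷ lev b ∷ η ∷ h ∷ [])
                  (λ lr ra la lb η h →
                     lr ⊑ ra ⊕ la ⇛ ra ⊑ η ⇛ la ≐ h ⇛ h ≐ lb ⇛ lr ⊑ lb ⊕ η)
                  (lev≤ a) rn la (sym lb))
                (linear (lev r ∷ δ r a ∷ lev a ∷ δ w r ∷ η ∷ l ∷ lev w ∷ h ∷ lev b ∷ [])
                  (λ lr ra la wr η l lw h lb →
                     wr ⊕ lr ≐ lw ⇛ la ⊑ ra ⊕ lr ⇛ ra ⊑ η ⇛ lw ≐ l ⊕ lb ⇛ lb ≐ h ⇛
                     h ≐ la ⇛ wr ⊑ l ⊕ η)
                  (between-sym br) (lev≤′ r) rn (Above.level B) lb (sym la)))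

-- Capped minima and balls as finite lists

minOver : {A : Set} → ℕ → List A → (A → ℕ) → ℕ
minOver cap xs g = foldr (λ a m → g a ⊓ m) cap xs

module _ {A : Set} (cap : ℕ) (g : A → ℕ) where

  minOver≤cap : ∀ xs → minOver cap xs g ≤ cap
  minOver≤cap []       = ≤-refl
  minOver≤cap (x ∷ xs) = ≤-trans (m⊓n≤n (g x) _) (minOver≤cap xs)

  minOver≤ : ∀ {xs x} → x ∈ xs → minOver cap xs g ≤ g x
  minOver≤ (here refl) = m⊓n≤m (g _) _
  minOver≤ (there x∈)  = ≤-trans (m⊓n≤n (g _) _) (minOver≤ x∈)

  -- The cap doubles as infinity and as the value of an empty minimum; a result below it therefore
  -- comes from an element.
  minOver-attained : ∀ xs {c} → minOver cap xs g ≤ c → c < cap → ∃[ x ] x ∈ xs × g x ≤ c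
  minOver-attained []       le c<cap = ⊥-elim (<⇒≱ c<cap le)
  minOver-attained (x ∷ xs) {c} le c<cap with ≤-total (g x) (minOver cap xs g)
  ... | inj₁ x≤ = x , here refl , subst (_≤ c) (m≤n⇒m⊓n≡m x≤) le
  ... | inj₂ ≤x =
    let y , y∈ , y≤ = minOver-attained xs (subst (_≤ c) (m≥n⇒m⊓n≡n ≤x) le) c<cap
    in y , there y∈ , y≤

lookup-injective : {A : Set} {xs : List A} → Unique xs → ∀ i j →
                   List.lookup xs i ≡ List.lookup xs j → i ≡ j
lookup-injective (x∉ ∷ uniq) zero    zero    eq = refl
lookup-injective (x∉ ∷ uniq) zero    (suc j) eq = ⊥-elim (All.lookup x∉ (∈-lookup j) eq)
lookup-injective (x∉ ∷ uniq) (suc i) zero    eq = ⊥-elim (All.lookup x∉ (∈-lookup i) (sym eq))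
lookup-injective (x∉ ∷ uniq) (suc i) (suc j) eq = cong suc (lookup-injective uniq i j eq)

length-concatMap : {A B : Set} (f : A → List B) {k : ℕ} (xs : List A) →
                   (∀ x → length (f x) ≤ k) → length (concatMap f xs) ≤ length xs * k
length-concatMap f []       short = z≤n
length-concatMap f (x ∷ xs) short =
  ≤-trans (≤-reflexive (length-++ (f x))) (+-mono-≤ (short x) (length-concatMap f xs short))

-- Used with two kinds of neighbour lists: those of the degree bound, which may contain further
-- vertices, for the existence of the tree, and the exact ones output by the neighbour program, for
-- its efficiency. Repetitions in a ball do no harm.
module Balls (G : Graph) (nb : Graph.V G → List (Graph.V G)) where
  open Graph G

  ball : V → ℕ → List V
  ball u zero    = u ∷ []
  ball u (suc r) = u ∷ concatMap (λ w → ball w r) (nb u)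

  centre∈ball : ∀ u r → u ∈ ball u r
  centre∈ball u zero    = here refl
  centre∈ball u (suc r) = here refl

  ballSize : ℕ → ℕ → ℕ
  ballSize d zero    = 1
  ballSize d (suc r) = suc (d * ballSize d r)

  length-ball : ∀ {d} → (∀ v → length (nb v) ≤ d) → ∀ u r → length (ball u r) ≤ ballSize d r
  length-ball short u zero    = ≤-refl
  length-ball {d} short u (suc r) = s≤s (≤-trans
    (length-concatMap (λ w → ball w r) (nb u) (λ w → length-ball short w r))
    (*-monoˡ-≤ (ballSize d r) (short u)))

  module _ (δ : V → V → ℕ) (isDist : IsGraphDistance G δ) where
    open Metric G δ isDist

    ∈-ball⁺ : (∀ {x y} → E x y → y ∈ nb x) → ∀ {u x} r → δ u x ≤ r → x ∈ ball u r
    ∈-ball⁺ complete {u} {x} r le = walk (geodesic u x) r le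
      where
      walk : ∀ {u x n} → Walk G u x n → ∀ r → n ≤ r → x ∈ ball u r
      walk stop r le = centre∈ball _ r
      walk (step e w) (suc r) (s≤s le) =
        there (∈-concatMap⁺ (λ w → ball w r) (lose (complete e) (walk w r le)))

    ∈-ball⁻ : (∀ {x y} → y ∈ nb x → δ x y ≤ 1) → ∀ {u x} r → x ∈ ball u r → δ u x ≤ r
    ∈-ball⁻ sound {u} zero    (here refl) = ≤-reflexive (δ-refl u)
    ∈-ball⁻ sound {u} (suc r) (here refl) = ≤-trans (≤-reflexive (δ-refl u)) z≤n
    ∈-ball⁻ sound {u} {x} (suc r) (there x∈) =
      let w , w∈ , x∈w = find (∈-concatMap⁻ (λ w → ball w r) x∈)
      in ≤-trans (δ-triangle u w x) (+-mono-≤ (sound w∈) (∈-ball⁻ sound r x∈w))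

-- Raw segments

module Raw (G : Graph) (δ : Graph.V G → Graph.V G → ℕ) (isDist : IsGraphDistance G δ)
           (η : ℕ) (hyperbolic : Hyperbolic G δ η) (degree : BoundedDegree G)
           (v₀ : Graph.V G) (D : ℕ) where
  open Graph G
  open Metric G δ isDist
  open Hyperbolicity η hyperbolic
  open Levels v₀

  nbᴳ : V → List V
  nbᴳ v = proj₁ (proj₂ degree v)

  nbᴳ-complete : ∀ {x y} → E x y → y ∈ nbᴳ x
  nbᴳ-complete {x} {y} = proj₂ (proj₂ (proj₂ degree x)) y

  open Balls G nbᴳ using () renaming (ball to ballᴳ; ∈-ball⁺ to ∈-ballᴳ⁺)
  open DecMembership _≟ⱽ_ using (_∈?_)

  sphere : ℕ → List V
  sphere j = deduplicate _≟ⱽ_ (filter (λ u → lev u ≟ j) (ballᴳ v₀ j))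

  sphere-unique : ∀ j → Unique (sphere j)
  sphere-unique j = deduplicate-! _≟ⱽ_ _

  ∈-sphere⁺ : ∀ {u j} → lev u ≡ j → u ∈ sphere j
  ∈-sphere⁺ {u} {j} eq = ∈-deduplicate⁺ _≟ⱽ_ (∈-filter⁺ (λ u → lev u ≟ j)
    (∈-ballᴳ⁺ δ isDist nbᴳ-complete j (≤-reflexive (trans (δ-sym v₀ u) eq))) eq)

  ∈-sphere⁻ : ∀ {u j} → u ∈ sphere j → lev u ≡ j
  ∈-sphere⁻ {u} {j} u∈ =
    proj₂ (∈-filter⁻ (λ u → lev u ≟ j) {xs = ballᴳ v₀ j} (∈-deduplicate⁻ _≟ⱽ_ _ u∈))

  Cap : ℕ
  Cap = suc D

  -- The entry Cap stands for infinity.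
  record Raw : Set where
    constructor raw
    field
      level : ℕ
      table : Vec (Fin (suc Cap)) (length (sphere level))
  open Raw public

  entry : ∀ j {u} → Vec (Fin (suc Cap)) (length (sphere j)) → Dec (u ∈ sphere j) → ℕ
  entry j t (yes u∈) = Fin.toℕ (Vec.lookup t (Any.index u∈))
  entry j t (no _)   = Cap

  entry≤Cap : ∀ j {u} (t : Vec (Fin (suc Cap)) (length (sphere j))) (d : Dec (u ∈ sphere j)) →
              entry j t d ≤ Cap
  entry≤Cap j t (yes u∈) = toℕ≤pred[n] (Vec.lookup t (Any.index u∈))
  entry≤Cap j t (no _)   = ≤-refl

  mk : ℕ → (V → ℕ) → Raw
  mk j f = raw j (Vec.tabulate λ i →
    fromℕ< {f (List.lookup (sphere j) i) ⊓ Cap} (s≤s (m⊓n≤n _ Cap)))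

  opaque

    val : Raw → V → ℕ
    val r u = entry (level r) (table r) (u ∈? sphere (level r))

    val≤Cap : ∀ r u → val r u ≤ Cap
    val≤Cap r u = entry≤Cap (level r) (table r) (u ∈? sphere (level r))

    val-off : ∀ r u → lev u ≢ level r → val r u ≡ Cap
    val-off r u off with u ∈? sphere (level r)
    ... | yes u∈ = ⊥-elim (off (∈-sphere⁻ u∈))
    ... | no _   = refl

    val-mk : ∀ j f u → lev u ≡ j → val (mk j f) u ≡ f u ⊓ Cap
    val-mk j f u eq with u ∈? sphere j
    ... | no u∉  = ⊥-elim (u∉ (∈-sphere⁺ eq))
    ... | yes u∈ = trans (cong Fin.toℕ (lookup∘tabulate _ (Any.index u∈)))
      (trans (toℕ-fromℕ< _) (cong (λ w → f w ⊓ Cap) (sym (lookup-index u∈))))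

    -- A finite table indexed by a list without repetitions is determined by its values, whereas
    -- functions on `V` would need function extensionality.
    raw-ext : ∀ {r r′} → level r ≡ level r′ → (∀ u → val r u ≡ val r′ u) → r ≡ r′
    raw-ext {raw j t} {raw .j t′} refl eq = cong (raw j)
      (trans (sym (tabulate∘lookup t)) (trans (tabulate-cong same) (tabulate∘lookup t′)))
      where
      at : ∀ i (s : Vec (Fin (suc Cap)) (length (sphere j))) →
           Fin.toℕ (Vec.lookup s i) ≡ val (raw j s) (List.lookup (sphere j) i)
      at i s with List.lookup (sphere j) i ∈? sphere j
      ... | no ∉  = ⊥-elim (∉ (∈-lookup i))
      ... | yes p = cong (λ i → Fin.toℕ (Vec.lookup s i))
        (lookup-injective (sphere-unique j) i (Any.index p) (lookup-index p))
      same : ∀ i → Vec.lookup t i ≡ Vec.lookup t′ i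
      same i = toℕ-injective (trans (at i t) (trans (eq _) (sym (at i t′))))

  val≤D⇒level : ∀ r {u} → val r u ≤ D → lev u ≡ level r
  val≤D⇒level r {u} le with lev u ≟ level r
  ... | yes eq = eq
  ... | no off = ⊥-elim (1+n≰n (subst (_≤ D) (val-off r u off) le))

  -- Above D there is only the value `Cap`, so the bounds `c` up to D determine a value. Equations
  -- between capped minima are proved in this way, without a separate case for infinity.
  cap-≡ : ∀ {a b} → a ≤ Cap → b ≤ Cap → (∀ c → c ≤ D → a ≤ c → b ≤ c) →
          (∀ c → c ≤ D → b ≤ c → a ≤ c) → a ≡ b
  cap-≡ a≤ b≤ to from = ≤-antisym (half b≤ a≤ from) (half a≤ b≤ to)
    where
    half : ∀ {a b} → a ≤ Cap → b ≤ Cap → (∀ c → c ≤ D → a ≤ c → b ≤ c) → b ≤ a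
    half {a} {b} a≤ b≤ to with a ≤? D
    ... | yes a≤D = to a a≤D ≤-refl
    ... | no a≰D  = ≤-trans b≤ (≰⇒> a≰D)

  ⊓Cap≤⇒≤ : ∀ {a c} → c ≤ D → a ⊓ Cap ≤ c → a ≤ c
  ⊓Cap≤⇒≤ {a} {c} c≤D le with ≤-total a Cap
  ... | inj₁ a≤ = subst (_≤ c) (m≤n⇒m⊓n≡m a≤) le
  ... | inj₂ ≤a = ⊥-elim (<⇒≱ (s≤s c≤D) (subst (_≤ c) (m≥n⇒m⊓n≡n ≤a) le))

  val-mk≤⁻ : ∀ j f {u c} → c ≤ D → val (mk j f) u ≤ c → lev u ≡ j × f u ≤ c
  val-mk≤⁻ j f {u} {c} c≤D le =
    let eq = val≤D⇒level (mk j f) (≤-trans le c≤D)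
    in eq , ⊓Cap≤⇒≤ c≤D (subst (_≤ c) (val-mk j f u eq) le)

  val-mk≤⁺ : ∀ j f {u c} → lev u ≡ j → f u ≤ c → val (mk j f) u ≤ c
  val-mk≤⁺ j f {u} eq le = ≤-trans (≤-reflexive (val-mk j f u eq)) (≤-trans (m⊓n≤m _ _) le)

  through : Raw → V → V → ℕ
  through r w u = val r u + (δ u w ∸ 1)

  rise : Raw → V → ℕ
  rise r w = minOver Cap (sphere (level r)) (through r w)

  -- Total, unlike the parent in a segment tree graph: `pred` and the truncated subtraction keep the
  -- root in place, so that `Thin` can speak of iterates beyond the root.
  parentᴿ : Raw → Raw
  parentᴿ r = mk (pred (level r)) (rise r)

  parentᴿ-sound : ∀ r {w c} → c ≤ D → val (parentᴿ r) w ≤ c →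
    lev w ≡ pred (level r) × ∃[ u ] lev u ≡ level r × val r u + (δ u w ∸ 1) ≤ c
  parentᴿ-sound r c≤D le =
    let eq , le′ = val-mk≤⁻ (pred (level r)) (rise r) c≤D le
        u , u∈ , ule = minOver-attained Cap (through r _) (sphere (level r)) le′ (s≤s c≤D)
    in eq , u , ∈-sphere⁻ u∈ , ule

  parentᴿ-complete : ∀ r {u w} → lev u ≡ level r → lev w ≡ pred (level r) →
                     val (parentᴿ r) w ≤ val r u + (δ u w ∸ 1)
  parentᴿ-complete r {w = w} eq eq′ =
    val-mk≤⁺ (pred (level r)) (rise r) eq′ (minOver≤ Cap (through r w) (∈-sphere⁺ eq))

  parentᴿ^ : ℕ → Raw → Raw
  parentᴿ^ zero    r = r
  parentᴿ^ (suc i) r = parentᴿ^ i (parentᴿ r)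

  parentᴿ^-suc : ∀ i r → parentᴿ^ (suc i) r ≡ parentᴿ (parentᴿ^ i r)
  parentᴿ^-suc zero    r = refl
  parentᴿ^-suc (suc i) r = parentᴿ^-suc i (parentᴿ r)

  level-parentᴿ^ : ∀ i r → level (parentᴿ^ i r) ≡ level r ∸ i
  level-parentᴿ^ zero    r = refl
  level-parentᴿ^ (suc i) r = trans (level-parentᴿ^ i (parentᴿ r)) (lemma (level r) i)
    where
    lemma : ∀ j i → pred j ∸ i ≡ j ∸ suc i
    lemma zero    i = 0∸n≡0 i
    lemma (suc j) i = refl

  ∸-suc-+ : ∀ a b i → (a + b) ∸ suc i ≤ (a ∸ 1) + (b ∸ i)
  ∸-suc-+ a b i = m≤n+o⇒m∸n≤o (a + b) (suc i) (≤-trans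
    (+-mono-≤ (m≤n+m∸n a 1) (m≤n+m∸n b i))
    (linear (a ∸ 1 ∷ b ∸ i ∷ i ∷ [])
      (λ p q i → # 1 ⊕ p ⊕ (i ⊕ q) ⊑ # 1 ⊕ i ⊕ (p ⊕ q))))

  -- The triangle inequality skips the intermediate points. Each step has taken one off its own
  -- distance, and truncating these subtractions separately only increases the sum.
  parentᴿ^-sound : ∀ i r {w c} → c ≤ D → val (parentᴿ^ i r) w ≤ c →
                   ∃[ u ] lev u ≡ level r × val r u + (δ u w ∸ i) ≤ c
  parentᴿ^-sound zero r {w} {c} c≤D le = w , val≤D⇒level r (≤-trans le c≤D) ,
    subst (_≤ c) (sym (trans (cong (val r w +_) (δ-refl w)) (+-identityʳ _))) le
  parentᴿ^-sound (suc i) r {w} {c} c≤D le =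
    let x , _ , xle = parentᴿ^-sound i (parentᴿ r) c≤D le
        _ , u , ulev , ule = parentᴿ-sound r (≤-trans (m≤m+n _ _) (≤-trans xle c≤D)) ≤-refl
    in u , ulev , linear
         (val r u ∷ δ u w ∸ suc i ∷ (δ u x + δ x w) ∸ suc i ∷ δ u x ∸ 1 ∷ δ x w ∸ i ∷
          val (parentᴿ r) x ∷ c ∷ [])
         (λ vu uw t ux xw vx c →
            vx ⊕ xw ⊑ c ⇛ vu ⊕ ux ⊑ vx ⇛ uw ⊑ t ⇛ t ⊑ ux ⊕ xw ⇛ vu ⊕ uw ⊑ c)
         xle ule (∸-monoˡ-≤ (suc i) (δ-triangle u x w)) (∸-suc-+ (δ u x) (δ x w) i)

  vertexᴿ : V → Raw
  vertexᴿ v = mk (lev v) (δ v)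

  vertexᴿ-self : ∀ v → val (vertexᴿ v) v ≡ 0
  vertexᴿ-self v = n≤0⇒n≡0 (val-mk≤⁺ (lev v) (δ v) refl (≤-reflexive (δ-refl v)))

  vertexᴿ-sound : ∀ i v {u c} → c ≤ D → val (parentᴿ^ i (vertexᴿ v)) u ≤ c → δ v u ≤ i + c
  vertexᴿ-sound i v {u} {c} c≤D le =
    let x , _ , xle = parentᴿ^-sound i (vertexᴿ v) c≤D le
        _ , vx = val-mk≤⁻ (lev v) (δ v) (≤-trans (m≤m+n _ _) (≤-trans xle c≤D)) ≤-refl
    in linear (δ v u ∷ δ v x ∷ δ x u ∷ δ x u ∸ i ∷ val (vertexᴿ v) x ∷ i ∷ c ∷ [])
         (λ vu vx xu t w i c → vu ⊑ vx ⊕ xu ⇛ xu ⊑ i ⊕ t ⇛ vx ⊑ w ⇛ w ⊕ t ⊑ c ⇛ vu ⊑ i ⊕ c)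
         (δ-triangle v x u) (m≤n+m∸n (δ x u) i) vx xle

  -- The minimum in the parent is realized by a vertex `x` where a geodesic from `v` to `u` crosses
  -- the level next to that of `u`. No subtraction is truncated there: `v` is `i` levels farther out
  -- than `x`, and `x` differs from `u`.
  vertexᴿ-complete : ∀ i v {u c} → lev v ≡ i + lev u → δ v u ≤ i + c →
                     val (parentᴿ^ i (vertexᴿ v)) u ≤ c
  vertexᴿ-complete zero    v eq le = val-mk≤⁺ (lev v) (δ v) (sym eq) le
  vertexᴿ-complete (suc i) v {u} {c} eq le =
    let x , b , xl = crossing {v} {u} (suc (lev u))
                       (subst (suc (lev u) ≤_) (sym eq) (s≤s (m≤n+m _ i))) (n≤1+n _)
        r = parentᴿ^ i (vertexᴿ v)
        rl = trans (level-parentᴿ^ i (vertexᴿ v)) 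
               (trans (cong (_∸ i) (trans eq (sym (+-suc i (lev u))))) (m+n∸m≡n i _))
        1≤ = +-cancelʳ-≤ (lev u) 1 (δ x u) (≤-trans (≤-reflexive (sym xl)) (lev≤ u))
        ih = vertexᴿ-complete i v {x} {δ v x ∸ i}
               (trans eq (trans (sym (+-suc i (lev u))) (cong (i +_) (sym xl)))) (m≤n+m∸n _ i)
    in subst (λ r → val r u ≤ c) (sym (parentᴿ^-suc i (vertexᴿ v)))
         (≤-trans (parentᴿ-complete r (trans xl (sym rl)) (sym (cong pred rl)))
           (linear (val r x ∷ δ v x ∸ i ∷ δ v x ∷ δ x u ∷ δ x u ∸ 1 ∷ δ v u ∷ i ∷ c ∷ [])
             (λ w t vx xu s vu i c →
                w ⊑ t ⇛ i ⊕ t ≐ vx ⇛ # 1 ⊕ s ≐ xu ⇛ vx ⊕ xu ≐ vu ⇛ vu ⊑ # 1 ⊕ i ⊕ c ⇛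
                w ⊕ s ⊑ c)
             ih (m+[n∸m]≡n (i≤ x xl)) (m+[n∸m]≡n 1≤) b le))
    where
    i≤ : ∀ x → lev x ≡ suc (lev u) → i ≤ δ v x
    i≤ x xl = linear (i ∷ lev v ∷ lev u ∷ lev x ∷ δ v x ∷ [])
      (λ i lv lu lx vx → # 1 ⊕ i ⊕ lu ≐ lv ⇛ lv ⊑ vx ⊕ lx ⇛ lx ≐ # 1 ⊕ lu ⇛ i ⊑ vx)
      (sym eq) (lev≤ x) xl

-- Valid segments, nearness and the segment tree graph

module Segments (G : Graph) (δ : Graph.V G → Graph.V G → ℕ) (isDist : IsGraphDistance G δ)
                (η : ℕ) (hyperbolic : Hyperbolic G δ η) (degree : BoundedDegree G)
                (v₀ : Graph.V G)
                (D : ℕ) (D-large : 12 * η + 1 ≤ D)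
                (M : ℕ) (M-large : D + (D + D) + 2 * η < 2 * M) where
  open Graph G
  open Metric G δ isDist
  open Hyperbolicity η hyperbolic
  open Levels v₀
  open Raw G δ isDist η hyperbolic degree v₀ D

  Zero : Raw → Set
  Zero r = ∃[ u ] val r u ≡ 0

  -- The tolerance grows with the values because a point of value `c` is only known to be within 2η
  -- + c of a ray. For two zeros it is D.
  Close : Raw → Raw → Set
  Close r r′ = ∀ u → val r u ≤ D → ∀ u′ → val r′ u′ ≤ D → δ u u′ ≤ D + (val r u + val r′ u′)

  -- The bound M makes this a local condition; contraction removes it.
  Thin : Raw → Raw → Set
  Thin r r′ = ∀ {i} → i < M → Close (parentᴿ^ i r) (parentᴿ^ i r′)

  -- `Thin r r` is reflexivity of nearness; together with a zero it confines the support to a ball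
  -- of radius 2D.
  Valid : Raw → Set
  Valid r = Zero r × Thin r r

  0<M : 0 < M
  0<M = n≢0⇒n>0 λ eq → n≮0 (subst (λ m → D + (D + D) + 2 * η < 2 * m) eq M-large)

  all-support? : ∀ r {P : V → Set} → (∀ u → Dec (P u)) → Dec (∀ u → val r u ≤ D → P u)
  all-support? r P? = map′
    (λ all u le → All.lookup all (∈-sphere⁺ (val≤D⇒level r le)) le)
    (λ f → All.tabulate λ {u} _ → f u)
    (All.all? (λ u → val r u ≤? D →-dec P? u) (sphere (level r)))

  Zero? : ∀ r → Dec (Zero r)
  Zero? r = map′
    (λ z → Any.satisfied z)
    (λ { (u , eq) → lose (∈-sphere⁺ (val≤D⇒level r (subst (_≤ D) (sym eq) z≤n))) eq })
    (Any.any? (λ u → val r u ≟ 0) (sphere (level r)))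

  Thin? : ∀ r r′ → Dec (Thin r r′)
  Thin? r r′ = allUpTo? (λ i → let s = parentᴿ^ i r ; s′ = parentᴿ^ i r′ in
    all-support? s λ u → all-support? s′ λ u′ → δ u u′ ≤? D + (val s u + val s′ u′)) M

  Valid? : ∀ r → Dec (Valid r)
  Valid? r = Zero? r ×-dec Thin? r r

  zero-level : ∀ r {u} → val r u ≡ 0 → lev u ≡ level r
  zero-level r eq = val≤D⇒level r (subst (_≤ D) (sym eq) z≤n)

  Close-sym : ∀ {r r′} → Close r r′ → Close r′ r
  Close-sym {r} {r′} close u le u′ le′ =
    subst₂ _≤_ (δ-sym u′ u) (cong (D +_) (+-comm (val r u′) (val r′ u))) (close u′ le′ u le)

  -- From `u` to the ray of `x`, across to the ray of `x′`, and on to `u′`: by `near-above` each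
  -- outer part is at most 2η plus the value. The middle part `e` is taken as 4η in `contraction`
  -- and `vertex-thin`, and as 8η + 1 in `close-above`, which fixes `D`.
  fan : ∀ {i i′ x x′ u u′ c c′ e h} → lev x ≡ i + h → lev x′ ≡ i′ + h → lev u ≡ h → lev u′ ≡ h →
        δ x u ≤ i + c → δ x′ u′ ≤ i′ + c′ →
        (∀ {a b} → Above i x a → Above i′ x′ b → lev a ≡ h → lev b ≡ h → δ a b ≤ e) →
        4 * η + e ≤ D → δ u u′ ≤ D + (c + c′)
  fan {i} {i′} {x} {x′} {u} {u′} {c} {c′} {e} {h} lx lx′ lu lu′ xu xu′ f le =
    let a , A , la = ancestor i h lx
        b , B , lb = ancestor i′ h lx′
        reach : ∀ {a u c} → lev a ≡ h → lev u ≡ h → lev u ≤ lev a + c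
        reach la lu = ≤-trans (≤-reflexive (trans lu (sym la))) (m≤m+n _ _)
    in linear (δ u u′ ∷ δ a u ∷ δ a u′ ∷ δ a b ∷ δ b u′ ∷ η ∷ e ∷ D ∷ c ∷ c′ ∷ [])
         (λ uu au au′ ab bu′ η e D c c′ →
            uu ⊑ au ⊕ au′ ⇛ au′ ⊑ ab ⊕ bu′ ⇛ au ⊑ 2 ⊛ η ⊕ c ⇛ bu′ ⊑ 2 ⊛ η ⊕ c′ ⇛
            ab ⊑ e ⇛ 4 ⊛ η ⊕ e ⊑ D ⇛ uu ⊑ D ⊕ (c ⊕ c′))
         (tri a) (δ-triangle a b u′) (near-above u c A (reach la lu) xu)
         (near-above u′ c′ B (reach lb lu′) xu′) (f A B la lb) le

  8η≤D : 4 * η + 4 * η ≤ D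
  8η≤D = linear (η ∷ D ∷ []) (λ η D → 12 ⊛ η ⊕ # 1 ⊑ D ⇛ 4 ⊛ η ⊕ 4 ⊛ η ⊑ D) D-large

  deep : ∀ i r {u} → val (parentᴿ^ i r) u ≤ D → lev u ≡ level r ∸ i
  deep i r le = trans (val≤D⇒level (parentᴿ^ i r) le) (level-parentᴿ^ i r)

  beyond-root : ∀ i r r′ → level r ≡ level r′ → level r ≤ i →
                Close (parentᴿ^ i r) (parentᴿ^ i r′)
  beyond-root i r r′ lr le u ule u′ ule′ =
    subst₂ (λ x x′ → δ x x′ ≤ D + (val (parentᴿ^ i r) u + val (parentᴿ^ i r′) u′))
      (sym (lev≡0 (trans (deep i r ule) (m≤n⇒m∸n≡0 le))))
      (sym (lev≡0 (trans (deep i r′ ule′) (m≤n⇒m∸n≡0 (subst (_≤ i) lr le)))))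
      (≤-trans (≤-reflexive (δ-refl v₀)) z≤n)

  -- Points of the M-th ancestors come from support points that are at most 3D apart, and `M` is
  -- chosen for `contract` with L = 3D. So closeness on one level reproduces itself M levels
  -- further, with the same `D`.
  contraction : ∀ r r′ → level r ≡ level r′ → Close r r′ → Close (parentᴿ^ M r) (parentᴿ^ M r′)
  contraction r r′ lr close with ≤-total (level r) M
  ... | inj₁ le = beyond-root M r r′ lr le
  ... | inj₂ ge = far
    where
    far : Close (parentᴿ^ M r) (parentᴿ^ M r′)
    far u ule u′ ule′ =
      let x , lx , xle = parentᴿ^-sound M r ule ≤-refl
          x′ , lx′ , xle′ = parentᴿ^-sound M r′ ule′ ≤-refl
          vx = ≤-trans (m≤m+n _ _) (≤-trans xle ule)
          vx′ = ≤-trans (m≤m+n _ _) (≤-trans xle′ ule′)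
          eq = sym (m+[n∸m]≡n ge)
      in fan {M} {M} (trans lx eq) (trans lx′ (trans (sym lr) eq)) (deep M r ule)
           (trans (deep M r′ ule′) (cong (_∸ M) (sym lr)))
           (≤-trans (m≤n+m∸n (δ x u) M) (+-monoʳ-≤ M (≤-trans (m≤n+m _ _) xle)))
           (≤-trans (m≤n+m∸n (δ x′ u′) M) (+-monoʳ-≤ M (≤-trans (m≤n+m _ _) xle′)))
           (λ A B _ _ → contract (D + (D + D)) A B (trans lx (trans lr (sym lx′)))
              (≤-trans (close x vx x′ vx′) (+-monoʳ-≤ D (+-mono-≤ vx vx′))) M-large)
           8η≤D

  -- The window of M levels moves by one, and its only new level is supplied by `contraction`.
  parent-thin : ∀ r r′ → level r ≡ level r′ → Thin r r′ → Thin (parentᴿ r) (parentᴿ r′)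
  parent-thin r r′ lr thin i<M with m≤n⇒m<n∨m≡n i<M
  ... | inj₁ 1+i<M = thin 1+i<M
  ... | inj₂ refl  = contraction r r′ lr (thin 0<M)

  -- One step from a zero towards the root costs 1 - 1; at the root the zero stays where it is.
  parent-zero : ∀ r → Zero r → Zero (parentᴿ r)
  parent-zero r (b , eq) = go (level r) refl
    where
    up-to : ∀ {w} → lev w ≡ pred (level r) → δ b w ∸ 1 ≡ 0 → Zero (parentᴿ r)
    up-to {w} lw d = w , n≤0⇒n≡0 (≤-trans (parentᴿ-complete r (zero-level r eq) lw)
      (≤-reflexive (cong₂ _+_ eq d)))
    go : ∀ j → level r ≡ j → Zero (parentᴿ r)
    go zero lr = up-to (trans (zero-level r eq) (trans lr (cong pred (sym lr))))
      (cong (_∸ 1) (δ-refl b))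
    go (suc j) lr =
      let a , A , la = ancestor 1 j (trans (zero-level r eq) lr)
      in up-to (trans la (cong pred (sym lr))) (cong (_∸ 1) (Above.dist A))

  parent-valid : ∀ r → Valid r → Valid (parentᴿ r)
  parent-valid r (z , thin) = parent-zero r z , parent-thin r r refl thin

  vertex-thin : ∀ v → Thin (vertexᴿ v) (vertexᴿ v)
  vertex-thin v {i} _ with ≤-total (lev v) i
  ... | inj₁ le = beyond-root i (vertexᴿ v) (vertexᴿ v) refl le
  ... | inj₂ ge = λ u ule u′ ule′ →
    let eq = sym (m+[n∸m]≡n ge)
    in fan {i} {i} {v} {v} eq eq (deep i (vertexᴿ v) ule) (deep i (vertexᴿ v) ule′)
         (vertexᴿ-sound i v ule ≤-refl) (vertexᴿ-sound i v ule′ ≤-refl)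
         (λ {a} {b} A B la lb → ≤-trans
            (near-above b 0 A (≤-trans (≤-reflexive (trans lb (sym la))) (m≤m+n _ _))
               (≤-trans (≤-reflexive (Above.dist B)) (m≤m+n _ _)))
            (linear (η ∷ []) (λ η → 2 ⊛ η ⊕ # 0 ⊑ 4 ⊛ η)))
         8η≤D

  -- With an irrelevant validity proof, equality of segments is equality of tables; `validity`
  -- recomputes the proof by its decision procedure.
  record Segment : Set where
    constructor segment
    field
      body   : Raw
      .valid : Valid body
  open Segment public using (body)

  segment-ext : ∀ {s t} → body s ≡ body t → s ≡ t
  segment-ext refl = refl

  validity : ∀ s → Valid (body s)
  validity (segment r v) = recompute (Valid? r) v

  depthˢ : Segment → ℕ
  depthˢ s = level (body s)

  vertexˢ : V → Segment
  vertexˢ v = segment (vertexᴿ v) ((v , vertexᴿ-self v) , vertex-thin v)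

  zero-of-vertex : ∀ {v u} → val (vertexᴿ v) u ≡ 0 → u ≡ v
  zero-of-vertex {v} {u} eq = sym (δ≡0 (n≤0⇒n≡0 (vertexᴿ-sound 0 v z≤n (≤-reflexive eq))))

  vertexˢ-injective : ∀ {v w} → vertexˢ v ≡ vertexˢ w → v ≡ w
  vertexˢ-injective {v} eq =
    zero-of-vertex (subst (λ s → val (body s) v ≡ 0) eq (vertexᴿ-self v))

  parentˢ : Segment → Segment
  parentˢ (segment r v) = segment (parentᴿ r) (parent-valid r v)

  rootˢ : Segment
  rootˢ = vertexˢ v₀

  -- Level 0 consists of `v₀` alone, and validity demands a zero.
  level≡0⇒root : ∀ s → depthˢ s ≡ 0 → s ≡ rootˢ
  level≡0⇒root s eq = segment-ext (raw-ext (trans eq (sym lev-v₀)) same)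
    where
    at-root : val (body s) v₀ ≡ 0
    at-root = let (z , zeq) , _ = validity s in
      subst (λ u → val (body s) u ≡ 0) (lev≡0 (trans (zero-level (body s) zeq) eq)) zeq
    same : ∀ u → val (body s) u ≡ val (vertexᴿ v₀) u
    same u with lev u ≟ 0
    ... | yes l = subst (λ u → val (body s) u ≡ val (vertexᴿ v₀) u) (sym (lev≡0 l))
                    (trans at-root (sym (vertexᴿ-self v₀)))
    ... | no l  = trans (val-off (body s) u (λ e → l (trans e eq)))
                    (sym (val-off (vertexᴿ v₀) u (λ e → l (trans e lev-v₀))))

  depth-root : depthˢ rootˢ ≡ 0
  depth-root = lev-v₀

  Ancestorˢ : ℕ → Segment → Segment → Set
  Ancestorˢ = Iter rootˢ (λ s _ → parentˢ s)

  parentˢ^ : ℕ → Segment → Segment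
  parentˢ^ zero    s = s
  parentˢ^ (suc i) s = parentˢ^ i (parentˢ s)

  body-parentˢ^ : ∀ i s → body (parentˢ^ i s) ≡ parentᴿ^ i (body s)
  body-parentˢ^ zero    s = refl
  body-parentˢ^ (suc i) s = body-parentˢ^ i (parentˢ s)

  depth-parentˢ^ : ∀ i s → depthˢ (parentˢ^ i s) ≡ depthˢ s ∸ i
  depth-parentˢ^ i s = trans (cong level (body-parentˢ^ i s)) (level-parentᴿ^ i (body s))

  ancestorˢ : ∀ i s → i ≤ depthˢ s → Ancestorˢ i s (parentˢ^ i s)
  ancestorˢ zero    s le = here
  ancestorˢ (suc i) s le = up
    (λ { refl → n≮0 (subst (suc i ≤_) depth-root le) })
    (ancestorˢ i (parentˢ s) (pred-mono-≤ le))

  ancestorˢ⁻ : ∀ {i s t} → Ancestorˢ i s t → i ≤ depthˢ s × t ≡ parentˢ^ i s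
  ancestorˢ⁻ here = z≤n , refl
  ancestorˢ⁻ {suc i} {s} (up s≢root a) with ancestorˢ⁻ a
  ... | le , eq = deeper (depthˢ s) refl le , eq
    where
    deeper : ∀ j → depthˢ s ≡ j → i ≤ pred (depthˢ s) → suc i ≤ depthˢ s
    deeper zero    e _ = ⊥-elim (s≢root (level≡0⇒root s e))
    deeper (suc j) e l = subst (suc i ≤_) (sym e) (s≤s (subst (λ d → i ≤ pred d) e l))

  depth-ancestorˢ : ∀ s → Ancestorˢ (depthˢ s) s rootˢ
  depth-ancestorˢ s = subst (Ancestorˢ (depthˢ s) s)
    (level≡0⇒root _ (trans (depth-parentˢ^ (depthˢ s) s) (n∸n≡0 (depthˢ s))))
    (ancestorˢ (depthˢ s) s ≤-refl)

  Nearˢ : Segment → Segment → Set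
  Nearˢ s t = depthˢ s ≡ depthˢ t × Thin (body s) (body t)

  Near? : ∀ s t → Dec (Nearˢ s t)
  Near? s t = (depthˢ s ≟ depthˢ t) ×-dec Thin? (body s) (body t)

  both : Raw → Raw → V → ℕ
  both r r′ u = val r u + val r′ u

  nearDistᴿ : Raw → Raw → ℕ
  nearDistᴿ r r′ = minOver Cap (sphere (level r)) (both r r′)

  -- Finite lists of values that determine a segment

  Assignment : Set
  Assignment = List (V × ℕ)

  assignments : List V → List Assignment
  assignments []       = [] ∷ []
  assignments (u ∷ us) =
    cartesianProductWith (λ L c → (u , c) ∷ L) (assignments us) (upTo (suc Cap))

  entryAt : V → V × ℕ → ℕ
  entryAt w (u , c) = if does (u ≟ⱽ w) then c else Cap

  valueAt : Assignment → V → ℕ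
  valueAt L w = minOver Cap L (entryAt w)

  tabulation : Raw → List V → Assignment
  tabulation r = map (λ u → u , val r u)

  tabulation∈assignments : ∀ r us → tabulation r us ∈ assignments us
  tabulation∈assignments r []       = here refl
  tabulation∈assignments r (u ∷ us) = ∈-cartesianProductWith⁺ (λ L c → (u , c) ∷ L)
    (tabulation∈assignments r us) (∈-upTo⁺ (s≤s (val≤Cap r u)))

  entryAt-hit : ∀ u c → entryAt u (u , c) ≡ c
  entryAt-hit u c = cong (λ b → if b then c else Cap) (dec-true (u ≟ⱽ u) refl)

  entryAt≤D : ∀ {w u c} → entryAt w (u , c) ≤ D → u ≡ w
  entryAt≤D {w} {u} {c} = go (u ≟ⱽ w)
    where
    go : (d : Dec (u ≡ w)) → (if does d then c else Cap) ≤ D → u ≡ w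
    go (yes eq) _  = eq
    go (no _)   le = ⊥-elim (1+n≰n le)

  -- Entries above D carry no information, and only the support has to be listed. So a raw segment
  -- has many representations, among them lists much shorter than the sphere.
  Represents : Assignment → Raw → Set
  Represents L r = (∀ {u c} → (u , c) ∈ L → c ≤ D → val r u ≡ c) ×
                   (∀ {u} → val r u ≤ D → (u , val r u) ∈ L)

  valueAt-represents : ∀ {L r} → Represents L r → ∀ w → valueAt L w ≡ val r w
  valueAt-represents {L} {r} (sound , complete) w =
    cap-≡ (minOver≤cap Cap (entryAt w) L) (val≤Cap r w) to from
    where
    to : ∀ c → c ≤ D → valueAt L w ≤ c → val r w ≤ c
    to c c≤D le with minOver-attained Cap (entryAt w) L le (s≤s c≤D)
    ... | (u , c′) , i , le′ with entryAt≤D {w} {u} (≤-trans le′ c≤D)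
    ...   | refl = let le″ = subst (_≤ c) (entryAt-hit u c′) le′ in
                   ≤-trans (≤-reflexive (sound i (≤-trans le″ c≤D))) le″
    from : ∀ c → c ≤ D → val r w ≤ c → valueAt L w ≤ c
    from c c≤D le = ≤-trans (minOver≤ Cap (entryAt w) (complete (≤-trans le c≤D)))
      (≤-trans (≤-reflexive (entryAt-hit w _)) le)

  tabulation-represents : ∀ r us → (∀ {u} → val r u ≤ D → u ∈ us) →
                          Represents (tabulation r us) r
  tabulation-represents r us cover =
    (λ i _ → let _ , _ , eq = ∈-map⁻ _ i in
       trans (cong (val r) (cong proj₁ eq)) (sym (cong proj₂ eq))) ,
    (λ le → ∈-map⁺ _ (cover le))

  candidate : ℕ → Assignment → Raw
  candidate j L = mk j (valueAt L)

  mk-val : ∀ r {f} → (∀ u → f u ≡ val r u) → mk (level r) f ≡ r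
  mk-val r {f} eq = raw-ext refl same
    where
    same : ∀ u → val (mk (level r) f) u ≡ val r u
    same u with lev u ≟ level r
    ... | yes l = trans (val-mk (level r) f u l)
                    (trans (cong (_⊓ Cap) (eq u)) (m≤n⇒m⊓n≡m (val≤Cap r u)))
    ... | no l  = trans (val-off (mk (level r) f) u l) (sym (val-off r u l))

  candidate-represents : ∀ {L r} → Represents L r → candidate (level r) L ≡ r
  candidate-represents {L} {r} rep = mk-val r (valueAt-represents rep)

  candidates : ℕ → List V → List Raw
  candidates j us = map (candidate j) (assignments us)

  ∈-candidates : ∀ r us → (∀ {u} → val r u ≤ D → u ∈ us) → r ∈ candidates (level r) us
  ∈-candidates r us cover = subst (_∈ candidates (level r) us)
    (candidate-represents (tabulation-represents r us cover))
    (∈-map⁺ (candidate (level r)) (tabulation∈assignments r us))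

  length-cartesianProductWith : ∀ {A B C : Set} (f : A → B → C) xs ys →
    length (cartesianProductWith f xs ys) ≡ length xs * length ys
  length-cartesianProductWith f []       ys = refl
  length-cartesianProductWith f (x ∷ xs) ys = trans (length-++ (map (f x) ys))
    (cong₂ _+_ (length-map (f x) ys) (length-cartesianProductWith f xs ys))

  length-assignments : ∀ us → length (assignments us) ≡ suc Cap ^ length us
  length-assignments []       = refl
  length-assignments (u ∷ us) = trans
    (length-cartesianProductWith (λ L c → (u , c) ∷ L) (assignments us) _)
    (trans (cong₂ _*_ (length-assignments us) (length-upTo (suc Cap)))
           (*-comm (suc Cap ^ length us) (suc Cap)))

  segments : List Raw → List Segment
  segments []       = []
  segments (r ∷ rs) with Valid? r
  ... | yes v = segment r v ∷ segments rs
  ... | no _  = segments rs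

  ∈-segments⁺ : ∀ {s rs} → body s ∈ rs → s ∈ segments rs
  ∈-segments⁺ {s} {r ∷ rs} i with Valid? r | i
  ... | yes v | here eq  = here (segment-ext eq)
  ... | yes v | there i′ = there (∈-segments⁺ i′)
  ... | no ¬v | here eq  = ⊥-elim (¬v (subst Valid eq (validity s)))
  ... | no ¬v | there i′ = ∈-segments⁺ i′

  length-segments : ∀ rs → length (segments rs) ≤ length rs
  length-segments []       = z≤n
  length-segments (r ∷ rs) with Valid? r
  ... | yes v = s≤s (length-segments rs)
  ... | no _  = m≤n⇒m≤1+n (length-segments rs)

  open Balls G nbᴳ using (ballSize; length-ball) renaming (ball to ballᴳ; ∈-ball⁺ to ∈-ballᴳ⁺)

  -- At a zero of `r` the tolerance is D plus the value at `u`, hence at most 2D. Both `maxNear` and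
  -- the radius `ρ` of the encoding come from here.
  cover-near : ∀ {r r′ b} → val r b ≡ 0 → Close r r′ → ∀ {u} → val r′ u ≤ D → δ b u ≤ D + D
  cover-near {r} {r′} {b} eq close {u} le =
    ≤-trans (close b (subst (_≤ D) (sym eq) z≤n) u le)
      (+-monoʳ-≤ D (≤-trans (≤-reflexive (cong (_+ val r′ u) eq)) le))

  maxNear : ℕ
  maxNear = suc Cap ^ ballSize (proj₁ degree) (D + D)

  near-boundedˢ : ∀ s → AtMost maxNear (Nearˢ s)
  near-boundedˢ s =
    let (b , eq) , _ = validity s
        us = ballᴳ b (D + D)
        rs = candidates (depthˢ s) us
    in segments rs ,
       ≤-trans (length-segments rs) (≤-trans
         (≤-reflexive (trans (length-map (candidate (depthˢ s)) (assignments us))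
                             (length-assignments us)))
         (^-monoʳ-≤ (suc Cap) (length-ball (λ v → proj₁ (proj₂ (proj₂ degree v))) b (D + D)))) ,
       λ t (d , thin) → ∈-segments⁺ (subst (λ j → body t ∈ candidates j us) (sym d)
         (∈-candidates (body t) us
           (λ le → ∈-ballᴳ⁺ δ isDist nbᴳ-complete (D + D)
                     (cover-near {body s} {body t} eq (thin 0<M) le))))

  tree : SegmentTreeGraph V v₀ maxNear Cap
  tree = record
    { S                = Segment
    ; vertex           = vertexˢ
    ; vertex-inj       = vertexˢ-injective
    ; parent           = λ s _ → parentˢ s
    ; depth            = depthˢ
    ; depth-ancestor   = depth-ancestorˢ
    ; Near             = Nearˢ
    ; near-level       = λ {s} {t} (d , _) → depthˢ s , depth-ancestorˢ s ,
                           subst (λ j → Ancestorˢ j t rootˢ) (sym d) (depth-ancestorˢ t)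
    ; near-sym         = λ {s} {t} (d , thin) → sym d , λ {i} i<M →
                           Close-sym {parentᴿ^ i (body s)} {parentᴿ^ i (body t)} (thin i<M)
    ; near-refl        = λ {s} → refl , proj₂ (validity s)
    ; near-parent      = λ {s} {t} (d , thin) _ _ →
                           cong pred d , parent-thin (body s) (body t) d thin
    ; nearDist         = λ s t _ → nearDistᴿ (body s) (body t)
    ; near-bounded     = near-boundedˢ
    ; nearDist-bounded = λ s t _ → minOver≤cap Cap (both (body s) (body t)) (sphere (depthˢ s))
    }

-- The segment tree graph realizes the distance

module Realization (G : Graph) (δ : Graph.V G → Graph.V G → ℕ) (isDist : IsGraphDistance G δ)
                   (η : ℕ) (hyperbolic : Hyperbolic G δ η) (degree : BoundedDegree G)
                   (v₀ : Graph.V G)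
                   (D : ℕ) (D-large : 12 * η + 1 ≤ D)
                   (M : ℕ) (M-large : D + (D + D) + 2 * η < 2 * M) where
  open Graph G
  open Metric G δ isDist
  open Hyperbolicity η hyperbolic
  open Levels v₀
  open Raw G δ isDist η hyperbolic degree v₀ D
  open Segments G δ isDist η hyperbolic degree v₀ D D-large M M-large

  module _ (v w : V) where

    sᵛ sʷ : ℕ → Segment
    sᵛ k = parentˢ^ k (vertexˢ v)
    sʷ l = parentˢ^ l (vertexˢ w)

    -- The reason why a geodesic from `v` to `w` reaches the level of the meeting: an endpoint is on
    -- that level, or nearness fails one level farther out, which `close-above` would contradict.
    Top : ℕ → ℕ → Set
    Top k l = k ≡ 0 ⊎ l ≡ 0 ⊎
      ∃[ k₀ ] ∃[ l₀ ] k ≡ suc k₀ × l ≡ suc l₀ × ¬ Nearˢ (sᵛ k₀) (sʷ l₀)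

    Highest : ℕ → Set
    Highest j = ∀ {k′ l′ j′} → k′ + j′ ≡ lev v → l′ + j′ ≡ lev w →
                Nearˢ (sᵛ k′) (sʷ l′) → j′ ≤ j

    record Meeting : Set where
      field
        {j k l} : ℕ
        kj      : k + j ≡ lev v
        lj      : l + j ≡ lev w
        near    : Nearˢ (sᵛ k) (sʷ l)
        top     : Top k l
        highest : Highest j

    depth-sᵛ : ∀ {k j} → k + j ≡ lev v → depthˢ (sᵛ k) ≡ j
    depth-sᵛ {k} {j} eq = trans (depth-parentˢ^ k (vertexˢ v))
      (trans (cong (_∸ k) (sym eq)) (m+n∸m≡n k j))

    depth-sʷ : ∀ {l j} → l + j ≡ lev w → depthˢ (sʷ l) ≡ j
    depth-sʷ {l} {j} eq = trans (depth-parentˢ^ l (vertexˢ w))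
      (trans (cong (_∸ l) (sym eq)) (m+n∸m≡n l j))

    -- The descent ends at level 0 at the latest, where both ancestors are the root. `Highest`
    -- survives a failed level because the level determines the two numbers of steps, so the pair
    -- just rejected is the only one there.
    search : ∀ j k l → k + j ≡ lev v → l + j ≡ lev w → Top k l → Highest j → Meeting
    search j k l kj lj top highest = decide j kj lj highest (Near? (sᵛ k) (sʷ l))
      where
      decide : ∀ j → k + j ≡ lev v → l + j ≡ lev w → Highest j →
               Dec (Nearˢ (sᵛ k) (sʷ l)) → Meeting
      decide j kj lj highest (yes near) =
        record { kj = kj ; lj = lj ; near = near ; top = top ; highest = highest }
      decide zero kj lj highest (no ¬near) = ⊥-elim (¬near (subst₂ Nearˢ
        (sym (level≡0⇒root (sᵛ k) (depth-sᵛ {k} kj)))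
        (sym (level≡0⇒root (sʷ l) (depth-sʷ {l} lj)))
        (refl , proj₂ (validity rootˢ))))
      decide (suc j) kj lj highest (no ¬near) =
        search j (suc k) (suc l) (trans (sym (+-suc k j)) kj) (trans (sym (+-suc l j)) lj)
          (inj₂ (inj₂ (k , l , refl , refl , ¬near))) λ {k′} {l′} → higher {k′} {l′}
        where
        higher : Highest j
        higher {k′} {l′} kj′ lj′ near =
          [ ≤-pred
          , (λ { refl → ⊥-elim (¬near (subst₂ (λ k l → Nearˢ (sᵛ k) (sʷ l))
                   (+-cancelʳ-≡ (suc j) k′ k (trans kj′ (sym kj)))
                   (+-cancelʳ-≡ (suc j) l′ l (trans lj′ (sym lj))) near)) })
          ]′ (m≤n⇒m<n∨m≡n (highest {k′} {l′} kj′ lj′ near))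

    meeting : Meeting
    meeting with ≤-total (lev v) (lev w)
    ... | inj₁ le = search (lev v) 0 (lev w ∸ lev v) refl (m∸n+n≡m le) (inj₁ refl)
            (λ {k′} eq _ _ → subst (_ ≤_) eq (m≤n+m _ k′))
    ... | inj₂ ge = search (lev w) (lev v ∸ lev w) 0 (m∸n+n≡m ge) refl (inj₂ (inj₁ refl))
            (λ {k′} {l′} _ eq _ → subst (_ ≤_) eq (m≤n+m _ l′))

    -- Only the first level of the window is new, and there `escape` and `fan` need 4η + (8η + 1) ≤
    -- D. The other levels belong to the window of the parents.
    close-above : ∀ {k₀ l₀ j} → k₀ + suc j ≡ lev v → l₀ + suc j ≡ lev w →
                  Nearˢ (sᵛ (suc k₀)) (sʷ (suc l₀)) →
                  (∀ u → Between v u w → suc j ≤ lev u) → Nearˢ (sᵛ k₀) (sʷ l₀)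
    close-above {k₀} {l₀} {j} kj′ lj′ near low =
      trans (depth-sᵛ {k₀} kj′) (sym (depth-sʷ {l₀} lj′)) , thin₀
      where
      close : Close (parentᴿ^ k₀ (vertexᴿ v)) (parentᴿ^ l₀ (vertexᴿ w))
      close u ule u′ ule′ = fan {k₀} {l₀} {v} {w} (sym kj′) (sym lj′)
        (trans (deep k₀ (vertexᴿ v) ule) (trans (cong (_∸ k₀) (sym kj′)) (m+n∸m≡n k₀ (suc j))))
        (trans (deep l₀ (vertexᴿ w) ule′) (trans (cong (_∸ l₀) (sym lj′)) (m+n∸m≡n l₀ (suc j))))
        (vertexᴿ-sound k₀ v ule ≤-refl) (vertexᴿ-sound l₀ w ule′ ≤-refl)
        (λ A B la lb → escape (suc j) A B la lb low)
        (linear (η ∷ D ∷ []) (λ η D → 12 ⊛ η ⊕ # 1 ⊑ D ⇛ 4 ⊛ η ⊕ (8 ⊛ η ⊕ # 1) ⊑ D) D-large)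

      shift : ∀ i k v → parentᴿ^ i (body (parentˢ^ (suc k) (vertexˢ v))) ≡
                        parentᴿ^ (suc i) (body (parentˢ^ k (vertexˢ v)))
      shift i k v = cong (parentᴿ^ i) (trans (body-parentˢ^ (suc k) (vertexˢ v))
        (trans (parentᴿ^-suc k (vertexᴿ v)) (cong parentᴿ (sym (body-parentˢ^ k (vertexˢ v))))))

      thin₀ : Thin (body (sᵛ k₀)) (body (sʷ l₀))
      thin₀ {zero}  _ = subst₂ Close (sym (body-parentˢ^ k₀ (vertexˢ v)))
        (sym (body-parentˢ^ l₀ (vertexˢ w))) close
      thin₀ {suc i} lt = subst₂ Close (shift i k₀ v) (shift i l₀ w)
        (proj₂ near (≤-trans (n≤1+n _) lt))

    open Meeting meeting

    hit : ∃[ u ] Between v u w × lev u ≡ j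
    hit = [ (λ eq → v , cong (_+ δ v w) (δ-refl v) , trans (sym kj) (cong (_+ j) eq))
          , [ (λ eq → w , trans (cong (δ v w +_) (δ-refl w)) (+-identityʳ _) ,
                      trans (sym lj) (cong (_+ j) eq))
            , (λ (k₀ , l₀ , eq , eq′ , ¬near) → crosses λ low → ¬near
                (close-above {k₀} {l₀} {j}
                  (trans (+-suc k₀ j) (trans (cong (_+ j) (sym eq)) kj))
                  (trans (+-suc l₀ j) (trans (cong (_+ j) (sym eq′)) lj))
                  (subst₂ (λ k l → Nearˢ (sᵛ k) (sʷ l)) eq eq′ near) low)) ]′ ]′ top
      where
      crosses : ¬ (∀ u → Between v u w → suc j ≤ lev u) → ∃[ u ] Between v u w × lev u ≡ j
      -- The point has to be found constructively, so the finite sphere is searched. If that fails,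
      -- `crossing` from `v`, whose level is at least `j`, puts every point between `v` and `w`
      -- beyond level `j`.
      crosses ¬low with Any.any? (λ u → δ v u + δ u w ≟ δ v w) (sphere j)
      ... | yes any = let u , u∈ , b = find any in u , b , ∈-sphere⁻ u∈
      ... | no none = ⊥-elim (¬low λ u b → ≰⇒> λ le →
              let x , bx , lx = crossing {v} {u} j (subst (j ≤_) kj (m≤n+m j k)) le
              in none (lose (∈-sphere⁺ lx) (between-trans b bx)))

    s t : Raw
    s = parentᴿ^ k (vertexᴿ v)
    t = parentᴿ^ l (vertexᴿ w)

    nearDist≤ : k + l + nearDistᴿ s t ≤ δ v w
    nearDist≤ = let u , b , lu = hit in
      linear (k ∷ l ∷ nearDistᴿ s t ∷ val s u ∷ val t u ∷ δ v u ∷ δ u w ∷ δ w u ∷ δ v w ∷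
              δ v u ∸ k ∷ δ w u ∸ l ∷ [])
        (λ k l n s t vu uw wu vw a b →
           n ⊑ s ⊕ t ⇛ s ⊑ a ⇛ t ⊑ b ⇛ k ⊕ a ≐ vu ⇛ l ⊕ b ≐ wu ⇛ wu ≐ uw ⇛ vu ⊕ uw ≐ vw ⇛
           k ⊕ l ⊕ n ⊑ vw)
        (minOver≤ Cap (both s t) (∈-sphere⁺ (trans lu (sym (trans (level-parentᴿ^ k (vertexᴿ v))
                                   (trans (cong (_∸ k) (sym kj)) (m+n∸m≡n k j)))))))
        (vertexᴿ-complete k v (trans (sym kj) (cong (k +_) (sym lu))) (m≤n+m∸n _ k))
        (vertexᴿ-complete l w (trans (sym lj) (cong (l +_) (sym lu))) (m≤n+m∸n _ l))
        (m+[n∸m]≡n (drop v kj lu)) (m+[n∸m]≡n (drop w lj lu)) (δ-sym w u) b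
      where
      drop : ∀ {k u} v → k + j ≡ lev v → lev u ≡ j → k ≤ δ v u
      drop {k} {u} v kj lu = linear (k ∷ j ∷ lev v ∷ lev u ∷ δ v u ∷ [])
        (λ k j lv lu vu → k ⊕ j ≐ lv ⇛ lv ⊑ vu ⊕ lu ⇛ lu ≐ j ⇛ k ⊑ vu) kj (lev≤ u) lu

    -- Zeros of the two segments lie within `k` of `v`, within `l` of `w` and within D of each
    -- other. With `nearDist≤` this rough bound shows that the minimum is at most D, so it is
    -- attained and not an effect of the cap.
    near≤ : δ v w ≤ k + l + D
    near≤ =
      let (z , ez) , _ = validity (sᵛ k)
          (z′ , ez′) , _ = validity (sʷ l)
          ez₁ = trans (cong (λ r → val r z) (sym (body-parentˢ^ k (vertexˢ v)))) ez
          ez₁′ = trans (cong (λ r → val r z′) (sym (body-parentˢ^ l (vertexˢ w)))) ez′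
          zz = subst₂ (λ a b → δ z z′ ≤ D + (a + b)) ez ez′
                 (proj₂ near 0<M z (subst (_≤ D) (sym ez) z≤n) z′ (subst (_≤ D) (sym ez′) z≤n))
      in linear (δ v w ∷ δ v z ∷ δ z w ∷ δ z z′ ∷ δ w z′ ∷ k ∷ l ∷ D ∷ [])
           (λ vw vz zw zz wz k l D →
              vw ⊑ vz ⊕ zw ⇛ zw ⊑ zz ⊕ wz ⇛ vz ⊑ k ⊕ # 0 ⇛ wz ⊑ l ⊕ # 0 ⇛
              zz ⊑ D ⊕ # 0 ⇛ vw ⊑ k ⊕ l ⊕ D)
           (δ-triangle v z w) (tri′ z′) (vertexᴿ-sound k v z≤n (≤-reflexive ez₁))
           (vertexᴿ-sound l w z≤n (≤-reflexive ez₁′)) zz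

    ≤nearDist : δ v w ≤ k + l + nearDistᴿ s t
    ≤nearDist =
      let n≤D = +-cancelˡ-≤ (k + l) (nearDistᴿ s t) D (≤-trans nearDist≤ near≤)
          u , _ , le = minOver-attained Cap (both s t) (sphere (level s)) ≤-refl (s≤s n≤D)
      in linear (δ v w ∷ δ v u ∷ δ w u ∷ k ∷ l ∷ val s u ∷ val t u ∷ nearDistᴿ s t ∷ [])
           (λ vw vu wu k l s t n →
              vw ⊑ vu ⊕ wu ⇛ vu ⊑ k ⊕ s ⇛ wu ⊑ l ⊕ t ⇛ s ⊕ t ⊑ n ⇛ vw ⊑ k ⊕ l ⊕ n)
           (tri′ u)
           (vertexᴿ-sound k v (≤-trans (m≤m+n _ _) (≤-trans le n≤D)) ≤-refl)
           (vertexᴿ-sound l w (≤-trans (m≤n+m _ _) (≤-trans le n≤D)) ≤-refl) le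

    isDistance : SegmentTreeGraph.IsDistance tree (vertexˢ v) (vertexˢ w) (δ v w)
    isDistance = record
      { k = k ; l = l ; t₁ = sᵛ k ; t₂ = sʷ l
      ; anc₁ = ancestorˢ k (vertexˢ v) (subst (k ≤_) kj (m≤m+n k j))
      ; anc₂ = ancestorˢ l (vertexˢ w) (subst (l ≤_) lj (m≤m+n l j))
      ; near = near
      ; smallest = smallest
      ; value = trans (≤-antisym ≤nearDist nearDist≤) (cong (k + l +_)
          (sym (cong₂ nearDistᴿ (body-parentˢ^ k (vertexˢ v)) (body-parentˢ^ l (vertexˢ w)))))
      }
      where
      smallest : ∀ {k′ l′ t₁ t₂} → Ancestorˢ k′ (vertexˢ v) t₁ → Ancestorˢ l′ (vertexˢ w) t₂ →
                 Nearˢ t₁ t₂ → k ≤ k′ × l ≤ l′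
      smallest {k′} {l′} a₁ a₂ near′ with ancestorˢ⁻ a₁ | ancestorˢ⁻ a₂
      ... | le₁ , refl | le₂ , refl =
        let j′ = lev v ∸ k′
            kj′ = m+[n∸m]≡n le₁
            lj′ = trans (cong (l′ +_) (trans (sym (depth-parentˢ^ k′ (vertexˢ v)))
                    (trans (proj₁ near′) (depth-parentˢ^ l′ (vertexˢ w))))) (m+[n∸m]≡n le₂)
            j′≤j = highest {k′} {l′} kj′ lj′ near′
            cancel : ∀ {a b m} → a + j ≡ m → b + j′ ≡ m → a ≤ b
            cancel {a} {b} {m} e₁ e₂ = linear (a ∷ b ∷ j ∷ j′ ∷ m ∷ [])
              (λ a b j j′ m → a ⊕ j ≐ m ⇛ m ≐ b ⊕ j′ ⇛ j′ ⊑ j ⇛ a ⊑ b) e₁ (sym e₂) j′≤j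
        in cancel kj kj′ , cancel lj lj′

  realizes : Realizes tree δ
  realizes = isDistance

-- Functions computable in constant time

bit : Bool → Val
bit b = word (if b then 1 else 0)

encList : {A : Set} → (A → Val) → List A → Val
encList enc xs = foldr pair (word 0) (map enc xs)

module Machine (π : Val → Val) where

  infix 3 _↝_ _⊩_

  -- The machine sees only `e x`, while `x` can carry invariants, such as a bound on the length of a
  -- list, on which a running time independent of `x` rests.
  record _↝_ {X : Set} (e g : X → Val) : Set where
    constructor computes
    field
      prog  : Exp 1
      bound : ℕ
      run   : ∀ x → ∃[ t ] t ≤ bound × π , (e x ∷ []) ⊢ prog ⇓ g x [ t ]
  open _↝_ public

  module _ {X : Set} {e : X → Val} where

    idᶜ : e ↝ e
    idᶜ = computes (var zero) 1 λ x → 1 , ≤-refl , var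

    litᶜ : ∀ k → e ↝ λ _ → word k
    litᶜ k = computes (lit k) 1 λ x → 1 , ≤-refl , lit

    _⨾_ : ∀ {g h} → e ↝ g → g ↝ h → e ↝ h
    computes p C r ⨾ computes q C′ r′ = computes (call q p) (suc (C + C′)) λ x →
      let s , s≤ , d = r x ; t , t≤ , d′ = r′ x
      in suc (s + t) , s≤s (+-mono-≤ s≤ t≤) , call d d′

    op₁ᶜ : ∀ {g} o → e ↝ g → e ↝ λ x → ⟦ o ⟧₁ π (g x)
    op₁ᶜ o (computes p C r) = computes (op₁ o p) (suc C) λ x →
      let s , s≤ , d = r x in suc s , s≤s s≤ , op₁ d

    op₂ᶜ : ∀ {g h} o → e ↝ g → e ↝ h → e ↝ λ x → ⟦ o ⟧₂ (g x) (h x)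
    op₂ᶜ o (computes p C r) (computes q C′ r′) = computes (op₂ o p q) (suc (C + C′)) λ x →
      let s , s≤ , d = r x ; t , t≤ , d′ = r′ x
      in suc (s + t) , s≤s (+-mono-≤ s≤ t≤) , op₂ d d′

    pairᶜ : {g h : X → Val} → e ↝ g → e ↝ h → e ↝ λ x → pair (g x) (h x)
    pairᶜ = op₂ᶜ cons

    carᶜ : {g h : X → Val} → e ↝ (λ x → pair (g x) (h x)) → e ↝ g
    carᶜ = op₁ᶜ car

    cdrᶜ : {g h : X → Val} → e ↝ (λ x → pair (g x) (h x)) → e ↝ h
    cdrᶜ = op₁ᶜ cdr

    plusᶜ : ∀ {m n : X → ℕ} → e ↝ word ∘ m → e ↝ word ∘ n → e ↝ λ x → word (m x + n x)
    plusᶜ = op₂ᶜ plus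

    minusᶜ : ∀ {m n : X → ℕ} → e ↝ word ∘ m → e ↝ word ∘ n → e ↝ λ x → word (m x ∸ n x)
    minusᶜ = op₂ᶜ minus

    constᶜ : ∀ v → e ↝ λ _ → v
    constᶜ (word k)   = litᶜ k
    constᶜ (pair u v) = pairᶜ (constᶜ u) (constᶜ v)

    castᶜ : ∀ {e′ g g′} → (∀ x → e x ≡ e′ x) → (∀ x → g x ≡ g′ x) → e ↝ g → e′ ↝ g′
    castᶜ e≡ g≡ (computes p C r) = computes p C λ x →
      let t , t≤ , d = r x
      in t , t≤ , subst₂ (λ a v → π , (a ∷ []) ⊢ p ⇓ v [ t ]) (e≡ x) (g≡ x) d

    respᶜ : ∀ {g g′} → (∀ x → g x ≡ g′ x) → e ↝ g → e ↝ g′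
    respᶜ = castᶜ (λ _ → refl)

    reindex : ∀ {Y : Set} {g} (φ : Y → X) → e ↝ g → e ∘ φ ↝ g ∘ φ
    reindex φ (computes p C r) = computes p C λ y → r (φ y)

    -- A branch is required only on the inputs that reach it, so it can rely on the outcome of the
    -- test, for instance on a list being nonempty.
    iteᶜ : ∀ {g} (b : X → Bool) → e ↝ bit ∘ b →
           (λ ((x , _) : Σ X λ x → b x ≡ true) → e x) ↝ (λ (x , _) → g x) →
           (λ ((x , _) : Σ X λ x → b x ≡ false) → e x) ↝ (λ (x , _) → g x) →
           e ↝ g
    iteᶜ {g} b (computes c C₀ r₀) (computes p C₁ r₁) (computes q C₂ r₂) =
      computes (ite c p q) (suc (C₀ + (C₁ + C₂))) λ x → branch x (b x) refl (r₀ x)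
      where
      branch : ∀ x β → b x ≡ β → ∃[ t ] t ≤ C₀ × π , (e x ∷ []) ⊢ c ⇓ bit (b x) [ t ] →
               ∃[ t ] t ≤ suc (C₀ + (C₁ + C₂)) × π , (e x ∷ []) ⊢ ite c p q ⇓ g x [ t ]
      branch x true eq (s , s≤ , d) =
        let t , t≤ , d′ = r₁ (x , eq)
        in suc (s + t) , s≤s (+-mono-≤ s≤ (≤-trans t≤ (m≤m+n C₁ C₂))) ,
           ite (subst (λ β → π , _ ⊢ c ⇓ bit β [ s ]) eq d) d′
      branch x false eq (s , s≤ , d) =
        let t , t≤ , d′ = r₂ (x , eq)
        in suc (s + t) , s≤s (+-mono-≤ s≤ (≤-trans t≤ (m≤n+m C₂ C₁))) ,
           ite (subst (λ β → π , _ ⊢ c ⇓ bit β [ s ]) eq d) d′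

  record _⊩_ {X : Set} (e : X → Val) (P : X → Set) : Set where
    field
      dec : ∀ x → Dec (P x)
      ct  : e ↝ λ x → bit (does (dec x))
  open _⊩_ public

  module _ {X : Set} {e : X → Val} where

    ifᶜ : ∀ {P g h} (p : e ⊩ P) → e ↝ g → e ↝ h →
          e ↝ λ x → if does (dec p x) then g x else h x
    ifᶜ {g = g} {h} p t f = iteᶜ (λ x → does (dec p x)) (ct p)
      (respᶜ (λ (x , eq) → cong (λ β → if β then g x else h x) (sym eq)) (reindex proj₁ t))
      (respᶜ (λ (x , eq) → cong (λ β → if β then g x else h x) (sym eq)) (reindex proj₁ f))

    mapᵖ : ∀ {P Q : X → Set} → (∀ x → P x → Q x) → (∀ x → Q x → P x) → e ⊩ P → e ⊩ Q
    mapᵖ to from p = record { dec = λ x → map′ (to x) (from x) (dec p x) ; ct = ct p }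

    isZeroᵖ : ∀ {n : X → ℕ} → e ↝ word ∘ n → e ⊩ λ x → n x ≡ 0
    isZeroᵖ {n} (computes p C r) = record
      { dec = λ x → n x ≟ 0
      ; ct  = computes (ite p (lit 0) (lit 1)) (suc (C + 1)) λ x →
          let t , t≤ , d = r x in suc (t + 1) , s≤s (+-monoˡ-≤ 1 t≤) , test x (n x) d
      }
      where
      test : ∀ x m {t} → π , (e x ∷ []) ⊢ p ⇓ word m [ t ] →
             π , (e x ∷ []) ⊢ ite p (lit 0) (lit 1) ⇓ bit (does (m ≟ 0)) [ suc (t + 1) ]
      test x zero    d = ite d lit
      test x (suc m) d = ite d lit

    ≤ᵖ : ∀ {m n : X → ℕ} → e ↝ word ∘ m → e ↝ word ∘ n → e ⊩ λ x → m x ≤ n x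
    ≤ᵖ m n = mapᵖ (λ _ → m∸n≡0⇒m≤n) (λ _ → m≤n⇒m∸n≡0) (isZeroᵖ (minusᶜ m n))

    ×ᵖ : ∀ {P Q : X → Set} → e ⊩ P → e ⊩ Q → e ⊩ λ x → P x × Q x
    ×ᵖ p q = record
      { dec = λ x → dec p x ×-dec dec q x
      ; ct  = respᶜ (λ x → conj (does (dec p x)) _) (ifᶜ p (ct q) (litᶜ 0))
      }
      where
      conj : ∀ a b → (if a then bit b else word 0) ≡ bit (a ∧ b)
      conj true  b = refl
      conj false b = refl

    ≡ᵖ : ∀ {m n : X → ℕ} → e ↝ word ∘ m → e ↝ word ∘ n → e ⊩ λ x → m x ≡ n x
    ≡ᵖ m n = mapᵖ (λ _ (p , q) → ≤-antisym p q) (λ _ eq → ≤-reflexive eq , ≤-reflexive (sym eq))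
      (×ᵖ (≤ᵖ m n) (≤ᵖ n m))

    ⊓ᶜ : ∀ {m n : X → ℕ} → e ↝ word ∘ m → e ↝ word ∘ n → e ↝ λ x → word (m x ⊓ n x)
    ⊓ᶜ {m} {n} p q = respᶜ (λ x → smaller (dec (≤ᵖ p q) x)) (ifᶜ (≤ᵖ p q) p q)
      where
      smaller : ∀ {m n} (d : Dec (m ≤ n)) → (if does d then word m else word n) ≡ word (m ⊓ n)
      smaller (yes le) = cong word (sym (m≤n⇒m⊓n≡m le))
      smaller (no ≰)   = cong word (sym (m≥n⇒m⊓n≡n (<⇒≤ (≰⇒> ≰))))

  pullᵖ : ∀ {X Y : Set} {e : X → Val} {e′ : Y → Val} {P} (φ : Y → X) →
          e′ ↝ e ∘ φ → e ⊩ P → e′ ⊩ P ∘ φ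
  pullᵖ φ t p = record { dec = dec p ∘ φ ; ct = t ⨾ reindex φ (ct p) }

  -- Nested pairs serve as contexts, with `wk` and `vz` as de Bruijn weakening and last variable.
  _▹_ : ∀ {X A : Set} → (X → Val) → (A → Val) → X × A → Val
  (e ▹ enc) (x , a) = pair (e x) (enc a)

  infixl 5 _▹_

  wk : ∀ {X A : Set} {e : X → Val} {enc : A → Val} → e ▹ enc ↝ e ∘ proj₁
  wk = carᶜ idᶜ

  vz : ∀ {X A : Set} {e : X → Val} {enc : A → Val} → e ▹ enc ↝ enc ∘ proj₂
  vz = cdrᶜ idᶜ

  wkᶜ : ∀ {X A : Set} {e g : X → Val} {enc : A → Val} → e ↝ g → e ▹ enc ↝ g ∘ proj₁
  wkᶜ t = wk ⨾ reindex proj₁ t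

  module _ {X A : Set} {e : X → Val} {enc : A → Val} where

    private
      UpTo : ℕ → Set
      UpTo n = Σ (List A) λ ys → length ys ≤ n

      nonEmpty : List A → Bool
      nonEmpty []      = false
      nonEmpty (_ ∷ _) = true

      nonEmptyᶜ : ∀ {Y : Set} {e′ : Y → Val} {ys : Y → List A} → e′ ↝ encList enc ∘ ys →
                  e′ ↝ bit ∘ nonEmpty ∘ ys
      nonEmptyᶜ {ys = ys} t = respᶜ (λ y → isPair-list (ys y)) (op₁ᶜ isPair t)
        where
        isPair-list : ∀ ys → ⟦ isPair ⟧₁ π (encList enc ys) ≡ bit (nonEmpty ys)
        isPair-list []       = refl
        isPair-list (y ∷ ys) = refl

    -- Recursion over a list is unrolled as often as its length may require.
    foldᶜ : (F : X → List A → Val) (n : ℕ) → e ↝ (λ x → F x []) →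
            (λ ((x , a , ys , _) : X × A × UpTo n) → pair (e x) (pair (enc a) (F x ys))) ↝
              (λ (x , a , ys , _) → F x (a ∷ ys)) →
            (xs : X → List A) → (∀ x → length (xs x) ≤ n) → e ↝ encList enc ∘ xs →
            e ↝ λ x → F x (xs x)
    foldᶜ F n nil next xs short t =
      pairᶜ idᶜ t ⨾ reindex (λ x → x , xs x , short x) (loop n ≤-refl)
      where
      state : ∀ {m} → X × UpTo m → Val
      state (x , ys , _) = pair (e x) (encList enc ys)

      uncons : ∀ {m} → X × A × UpTo m → X × UpTo (suc m)
      uncons (x , a , ys , le) = x , a ∷ ys , s≤s le

      loop : ∀ m → m ≤ n → state {m} ↝ λ (x , ys , _) → F x ys
      loop zero    _   = carᶜ idᶜ ⨾ castᶜ (λ _ → refl) empty (reindex proj₁ nil)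
        where
        empty : ∀ ((x , ys , _) : X × UpTo 0) → F x [] ≡ F x ys
        empty (x , [] , _) = refl
      loop (suc m) m<n = iteᶜ {g = λ (x , ys , _) → F x ys} (λ (_ , ys , _) → nonEmpty ys)
        (nonEmptyᶜ (cdrᶜ idᶜ))
        (castᶜ same same′ (reindex split recur))
        (carᶜ idᶜ ⨾ respᶜ empty (reindex (λ ((x , _) , _) → x) nil))
        where
        recur : state ∘ uncons {m} ↝ λ (x , a , ys , _) → F x (a ∷ ys)
        recur = pairᶜ (carᶜ idᶜ) (pairᶜ (carᶜ (cdrᶜ idᶜ))
                  (pairᶜ (carᶜ idᶜ) (cdrᶜ (cdrᶜ idᶜ)) ⨾
                   reindex (λ (x , a , l) → x , l) (loop m (<⇒≤ m<n)))) ⨾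
                reindex (λ (x , a , ys , le) → x , a , ys , ≤-trans le (<⇒≤ m<n)) next

        split : Σ (X × UpTo (suc m)) (λ (_ , ys , _) → nonEmpty ys ≡ true) → X × A × UpTo m
        split ((x , a ∷ ys , le) , _) = x , a , ys , ≤-pred le

        same : ∀ p → state (uncons (split p)) ≡ state (proj₁ p)
        same ((x , a ∷ ys , le) , _) = refl

        same′ : ∀ p → (let (x , a , ys , _) = split p in F x (a ∷ ys)) ≡
                      (let ((x , ys , _) , _) = p in F x ys)
        same′ ((x , a ∷ ys , le) , _) = refl

        empty : ∀ (p : Σ (X × UpTo (suc m)) (λ (_ , ys , _) → nonEmpty ys ≡ false)) →
                F (proj₁ (proj₁ p)) [] ≡ (let ((x , ys , _) , _) = p in F x ys)
        empty ((x , [] , le) , _) = refl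

  record Listᶜ {X A : Set} (e : X → Val) (enc : A → Val) (xs : X → List A) : Set where
    constructor bounded
    field
      size  : ℕ
      short : ∀ x → length (xs x) ≤ size
      list  : e ↝ encList enc ∘ xs
  open Listᶜ public

  pullˡ : ∀ {X Y A : Set} {e : X → Val} {e′ : Y → Val} {enc : A → Val} {xs} (φ : Y → X) →
          e′ ↝ e ∘ φ → Listᶜ e enc xs → Listᶜ e′ enc (xs ∘ φ)
  pullˡ φ t (bounded n s l) = bounded n (s ∘ φ) (t ⨾ reindex φ l)

  module _ {X A : Set} {e : X → Val} {enc : A → Val} where

    mapᶜ : ∀ {B : Set} {encB : B → Val} {xs} (f : X → A → B) →
           e ▹ enc ↝ (λ (x , a) → encB (f x a)) → Listᶜ e enc xs →
           Listᶜ e encB (λ x → map (f x) (xs x))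
    mapᶜ {encB = encB} {xs} f t (bounded n s l) = bounded n
      (λ x → ≤-trans (≤-reflexive (length-map (f x) (xs x))) (s x))
      (foldᶜ (λ x ys → encList encB (map (f x) ys)) n (litᶜ 0)
        (pairᶜ (pairᶜ (carᶜ idᶜ) (carᶜ (cdrᶜ idᶜ)) ⨾ reindex (λ (x , a , _) → x , a) t)
               (cdrᶜ (cdrᶜ idᶜ)))
        xs s l)

    filterᶜ : ∀ {P : X × A → Set} {xs} (p : e ▹ enc ⊩ P) → Listᶜ e enc xs →
              Listᶜ e enc (λ x → filter (λ a → dec p (x , a)) (xs x))
    filterᶜ {xs = xs} p (bounded n s l) = bounded n
      (λ x → ≤-trans (length-filter (λ a → dec p (x , a)) (xs x)) (s x))
      (foldᶜ (λ x ys → encList enc (filter (λ a → dec p (x , a)) ys)) n (litᶜ 0)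
        (respᶜ (λ (x , a , ys , _) → choose x a ys)
          (ifᶜ (pullᵖ (λ (x , a , _) → x , a) (pairᶜ (carᶜ idᶜ) (carᶜ (cdrᶜ idᶜ))) p)
            (cdrᶜ idᶜ) (cdrᶜ (cdrᶜ idᶜ))))
        xs s l)
      where
      choose : ∀ x a ys → let rest = encList enc (filter (λ a → dec p (x , a)) ys) in
        (if does (dec p (x , a)) then pair (enc a) rest else rest) ≡
        encList enc (filter (λ a → dec p (x , a)) (a ∷ ys))
      choose x a ys with does (dec p (x , a))
      ... | true  = refl
      ... | false = refl

    appendᶜ : ∀ {xs ys} → Listᶜ e enc xs → e ↝ encList enc ∘ ys →
              e ↝ λ x → encList enc (xs x ++ ys x)
    appendᶜ {xs} {ys} (bounded n s l) t =
      foldᶜ (λ x zs → encList enc (zs ++ ys x)) n t (cdrᶜ idᶜ) xs s l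

    minOverᶜ : ∀ {xs} cap (g : X → A → ℕ) → e ▹ enc ↝ (λ (x , a) → word (g x a)) →
               Listᶜ e enc xs → e ↝ λ x → word (minOver cap (xs x) (g x))
    minOverᶜ {xs} cap g t (bounded n s l) =
      foldᶜ (λ x ys → word (minOver cap ys (g x))) n (litᶜ cap)
        (⊓ᶜ (pairᶜ (carᶜ idᶜ) (carᶜ (cdrᶜ idᶜ)) ⨾ reindex (λ (x , a , _) → x , a) t)
            (cdrᶜ (cdrᶜ idᶜ)))
        xs s l

    allᵖ : ∀ {P : X × A → Set} {xs} → e ▹ enc ⊩ P → Listᶜ e enc xs →
           e ⊩ λ x → All (λ a → P (x , a)) (xs x)
    allᵖ {xs = xs} p (bounded n s l) = record
      { dec = λ x → All.all? (λ a → dec p (x , a)) (xs x)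
      ; ct  = foldᶜ (λ x ys → bit (does (All.all? (λ a → dec p (x , a)) ys))) n (litᶜ 1)
          (respᶜ (λ (x , a , ys , _) → conj (does (dec p (x , a))) _)
            (ifᶜ (pullᵖ (λ (x , a , _) → x , a) (pairᶜ (carᶜ idᶜ) (carᶜ (cdrᶜ idᶜ))) p)
              (cdrᶜ (cdrᶜ idᶜ)) (litᶜ 0)))
          xs s l
      }
      where
      conj : ∀ a b → (if a then bit b else word 0) ≡ bit (a ∧ b)
      conj true  b = refl
      conj false b = refl

  concatMapᶜ : ∀ {X A B : Set} {e : X → Val} {enc : A → Val} {encB : B → Val} {xs}
               (f : X → A → List B) → Listᶜ (e ▹ enc) encB (λ (x , a) → f x a) →
               Listᶜ e enc xs → Listᶜ e encB (λ x → concatMap (f x) (xs x))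
  concatMapᶜ {e = e} {enc} {encB} {xs} f t (bounded n s l) = bounded (n * size t)
    (λ x → ≤-trans (length-concatMap (f x) (xs x) (λ a → short t (x , a)))
             (*-monoˡ-≤ (size t) (s x)))
    (foldᶜ (λ x ys → encList encB (concatMap (f x) ys)) n (litᶜ 0)
      (appendᶜ (pullˡ (λ (x , a , _) → x , a) (pairᶜ (carᶜ idᶜ) (carᶜ (cdrᶜ idᶜ))) t)
        (cdrᶜ (cdrᶜ idᶜ)))
      xs s l)

  singletonᶜ : ∀ {X A : Set} {e : X → Val} {enc : A → Val} {f : X → A} →
               e ↝ enc ∘ f → Listᶜ e enc (λ x → f x ∷ [])
  singletonᶜ t = bounded 1 (λ _ → ≤-refl) (pairᶜ t (litᶜ 0))

  consᶜ : ∀ {X A : Set} {e : X → Val} {enc : A → Val} {f : X → A} {xs} →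
          e ↝ enc ∘ f → Listᶜ e enc xs → Listᶜ e enc (λ x → f x ∷ xs x)
  consᶜ t (bounded n s l) = bounded (suc n) (λ x → s≤s (s x)) (pairᶜ t l)

-- Needed to bound the output of the neighbour program by the degree: that output has no
-- repetitions, and the list in `BoundedDegree` covers it.
unique-length : {A : Set} {xs ys : List A} → Unique xs → (∀ {x} → x ∈ xs → x ∈ ys) →
                length xs ≤ length ys
unique-length [] _ = z≤n
unique-length {A} {x ∷ xs} {ys} (x∉ ∷ uniq) sub =
  let ys′ , eq , keep = remove (sub (here refl))
  in subst (suc (length xs) ≤_) (sym eq) (s≤s (unique-length uniq λ y∈ →
       keep (sub (there y∈)) (λ { refl → All.lookup x∉ y∈ refl })))
  where
  remove : ∀ {x ys} → x ∈ ys →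
           ∃[ ys′ ] length ys ≡ suc (length ys′) × (∀ {y} → y ∈ ys → y ≢ x → y ∈ ys′)
  remove {ys = y ∷ ys} (here refl) = ys , refl , λ
    { (here eq) ≢x → ⊥-elim (≢x eq) ; (there y∈) _ → y∈ }
  remove {ys = y ∷ ys} (there x∈) =
    let ys′ , eq , keep = remove x∈
    in y ∷ ys′ , cong suc eq , λ
         { (here eq) _ → here eq ; (there y∈) ≢x → there (keep y∈ ≢x) }

-- Programs for vertices, balls and bounded distances

module Programs (G : Graph) (δ : Graph.V G → Graph.V G → ℕ) (isDist : IsGraphDistance G δ)
                (η : ℕ) (hyperbolic : Hyperbolic G δ η) (degree : BoundedDegree G)
                (v₀ : Graph.V G)
                (D : ℕ) (D-large : 12 * η + 1 ≤ D)
                (M : ℕ) (M-large : D + (D + D) + 2 * η < 2 * M)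
                (π : Val → Val) (code : Graph.V G → ℕ) (code-injective : Injective _≡_ _≡_ code)
                (distance-program : ConstantTime π (distanceTo δ v₀ code))
                (neighbour-program : ConstantTime π (neighbours G code)) where
  open Graph G
  open Metric G δ isDist
  open Hyperbolicity η hyperbolic
  open Levels v₀
  open Raw G δ isDist η hyperbolic degree v₀ D
  open Segments G δ isDist η hyperbolic degree v₀ D D-large M M-large
  open Machine π

  encV : V → Val
  encV = word ∘ code

  encEntry : V × ℕ → Val
  encEntry (u , c) = pair (encV u) (word c)

  levelᵛ : encV ↝ word ∘ lev
  levelᵛ = let p , C , run = distance-program in computes p C λ v →
    let out , t , d , eq , t≤ = run v in t , t≤ , subst (λ o → π , _ ⊢ p ⇓ o [ t ]) eq d

  nb : V → List V
  nb v = let _ , _ , run = neighbour-program ; _ , _ , _ , (l , _) , _ = run v in l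

  nb-unique : ∀ v → Unique (nb v)
  nb-unique v =
    let _ , _ , run = neighbour-program ; _ , _ , _ , (_ , uniq , _) , _ = run v in uniq

  nb⇒E : ∀ {x y} → y ∈ nb x → E x y
  nb⇒E {x} {y} = let _ , _ , run = neighbour-program ; _ , _ , _ , (_ , _ , iff , _) , _ = run x
    in Equivalence.to (iff y)

  E⇒nb : ∀ {x y} → E x y → y ∈ nb x
  E⇒nb {x} {y} = let _ , _ , run = neighbour-program ; _ , _ , _ , (_ , _ , iff , _) , _ = run x
    in Equivalence.from (iff y)

  nbᵛ : Listᶜ encV encV nb
  nbᵛ = bounded (proj₁ degree)
    (λ v → let _ , short , complete = proj₂ degree v in
       ≤-trans (unique-length (nb-unique v) (λ u∈ → complete _ (nb⇒E u∈))) short)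
    (let p , C , run = neighbour-program in computes p C λ v →
      let out , t , d , (_ , _ , _ , eq) , t≤ = run v
      in t , t≤ , subst (λ o → π , _ ⊢ p ⇓ o [ t ]) eq d)

  open Balls G nb

  ∈-ball : ∀ {u x} r → δ u x ≤ r → x ∈ ball u r
  ∈-ball = ∈-ball⁺ δ isDist E⇒nb

  ball⇒δ≤ : ∀ {u x} r → x ∈ ball u r → δ u x ≤ r
  ball⇒δ≤ = ∈-ball⁻ δ isDist (λ y∈ → E⇒δ≤1 (nb⇒E y∈))

  ballᵛ : ∀ r → Listᶜ encV encV (λ u → ball u r)
  ballᵛ zero    = singletonᶜ idᶜ
  ballᵛ (suc r) = consᶜ idᶜ (concatMapᶜ (λ _ w → ball w r) (pullˡ proj₂ vz (ballᵛ r)) nbᵛ)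

  module _ {X : Set} {e : X → Val} where

    levelᶜ : ∀ {u : X → V} → e ↝ encV ∘ u → e ↝ word ∘ lev ∘ u
    levelᶜ {u} t = t ⨾ reindex u levelᵛ

    ballᶜ : ∀ {u : X → V} r → e ↝ encV ∘ u → Listᶜ e encV (λ x → ball (u x) r)
    ballᶜ {u} r t = pullˡ u t (ballᵛ r)

    vertex≡ᵖ : ∀ {u w : X → V} → e ↝ encV ∘ u → e ↝ encV ∘ w → e ⊩ λ x → u x ≡ w x
    vertex≡ᵖ s t = mapᵖ (λ _ → code-injective) (λ _ → cong code) (≡ᵖ s t)

    ifℕᶜ : ∀ {P : X → Set} {m n : X → ℕ} (d : ∀ x → Dec (P x)) → e ⊩ P →
           e ↝ word ∘ m → e ↝ word ∘ n → e ↝ λ x → word (if does (d x) then m x else n x)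
    ifℕᶜ {m = m} {n} d p s t = respᶜ (λ x → float (does-≡ (dec p x) (d x))) (ifᶜ p s t)
      where
      float : ∀ {a b : Bool} {m n} → a ≡ b →
              (if a then word m else word n) ≡ word (if b then m else n)
      float {true}  refl = refl
      float {false} refl = refl

    -- Only distances to `v₀` are given, so `w` is searched for in the ball around `u`. The two
    -- truncated differences of codes add up to 0 exactly at `w`, and with cap 1 the minimum 0 can
    -- only come from such an element.
    δ≤ᵖ : ∀ {u w : X → V} r → e ↝ encV ∘ u → e ↝ encV ∘ w → e ⊩ λ x → δ (u x) (w x) ≤ r
    δ≤ᵖ {u} {w} r s t = mapᵖ
      (λ x eq → let a , a∈ , ga = minOver-attained 1 (differs x) (ball (u x) r)
                                    (≤-reflexive eq) ≤-refl
                in ball⇒δ≤ r (subst (_∈ ball (u x) r) (agree x (n≤0⇒n≡0 ga)) a∈))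
      (λ x le → n≤0⇒n≡0 (≤-trans (minOver≤ 1 (differs x) (∈-ball r le))
                  (≤-reflexive (cong₂ _+_ (n∸n≡0 (code (w x))) (n∸n≡0 (code (w x)))))))
      (isZeroᵖ (minOverᶜ 1 differs
        (plusᶜ (minusᶜ vz (wkᶜ t)) (minusᶜ (wkᶜ t) vz)) (ballᶜ r s)))
      where
      differs : X → V → ℕ
      differs x a = (code a ∸ code (w x)) + (code (w x) ∸ code a)
      agree : ∀ x {a} → differs x a ≡ 0 → a ≡ w x
      agree x {a} eq = code-injective (≤-antisym
        (m∸n≡0⇒m≤n (m+n≡0⇒m≡0 _ eq))
        (m∸n≡0⇒m≤n (m+n≡0⇒n≡0 (code a ∸ code (w x)) eq)))

    -- Counts the radii below `R` whose ball around the first vertex misses the second; the cap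
    -- keeps the number of tests constant.
    δᶜ : ∀ {u w : X → V} R → e ↝ encV ∘ u → e ↝ encV ∘ w → e ↝ λ x → word (δ (u x) (w x) ⊓ R)
    δᶜ {u} {w} zero    s t = respᶜ (λ x → cong word (sym (⊓-zeroʳ (δ (u x) (w x))))) (litᶜ 0)
    δᶜ {u} {w} (suc R) s t = respᶜ (λ x → cong word (extend (δ (u x) (w x)) (δ (u x) (w x) ≤? R)))
      (ifℕᶜ (λ x → δ (u x) (w x) ≤? R) (δ≤ᵖ R s t) (δᶜ R s t) (plusᶜ (litᶜ 1) (δᶜ R s t)))
      where
      extend : ∀ d (le : Dec (d ≤ R)) →
               (if does le then d ⊓ R else suc (d ⊓ R)) ≡ d ⊓ suc R
      extend d (yes le) = trans (m≤n⇒m⊓n≡m le) (sym (m≤n⇒m⊓n≡m (m≤n⇒m≤1+n le)))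
      extend d (no ≰)   = trans (cong suc (m≥n⇒m⊓n≡n (<⇒≤ (≰⇒> ≰)))) (sym (m≥n⇒m⊓n≡n (≰⇒> ≰)))

    →ᵖ : ∀ {P Q : X → Set} → e ⊩ P → e ⊩ Q → e ⊩ λ x → P x → Q x
    →ᵖ p q = record
      { dec = λ x → dec p x →-dec dec q x
      ; ct  = respᶜ (λ x → implies (dec p x) (dec q x)) (ifᶜ p (ct q) (litᶜ 1))
      }
      where
      implies : ∀ {P Q : Set} (a : Dec P) (b : Dec Q) →
                (if does a then bit (does b) else word 1) ≡ bit (does (a →-dec b))
      implies (yes _) (yes _) = refl
      implies (yes _) (no _)  = refl
      implies (no _)  (yes _) = refl
      implies (no _)  (no _)  = refl

    alwaysᵖ : ∀ {P : X → Set} → (∀ x → P x) → e ⊩ P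
    alwaysᵖ p = record { dec = λ x → yes (p x) ; ct = litᶜ 1 }

  -- Programs for raw segments, their parents and nearness

  infix 3 _⊨_

  -- The table of a raw segment extends over a whole sphere and cannot be written down in constant
  -- time; a bounded list representing it and its level take its place.
  record _⊨_ {X : Set} (e : X → Val) (r : X → Raw) : Set where
    field
      entries    : X → Assignment
      represents : ∀ x → Represents (entries x) (r x)
      entriesᶜ   : Listᶜ e encEntry entries
      depthᶜ     : e ↝ word ∘ level ∘ r
  open _⊨_

  pullˢ : ∀ {X Y : Set} {e : X → Val} {e′ : Y → Val} {r} (φ : Y → X) →
          e′ ↝ e ∘ φ → e ⊨ r → e′ ⊨ r ∘ φ
  pullˢ φ t s = record
    { entries    = entries s ∘ φ
    ; represents = represents s ∘ φ
    ; entriesᶜ   = pullˡ φ t (entriesᶜ s)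
    ; depthᶜ     = t ⨾ reindex φ (depthᶜ s)
    }

  wkˢ : ∀ {X A : Set} {e : X → Val} {enc : A → Val} {r} → e ⊨ r → e ▹ enc ⊨ r ∘ proj₁
  wkˢ = pullˢ proj₁ wk

  keyᶜ : ∀ {X : Set} {e : X → Val} → e ▹ encEntry ↝ encV ∘ proj₁ ∘ proj₂
  keyᶜ = carᶜ vz

  valueᶜ : ∀ {X : Set} {e : X → Val} → e ▹ encEntry ↝ word ∘ proj₂ ∘ proj₂
  valueᶜ = cdrᶜ vz

  valueAtᶜ : ∀ {X : Set} {e : X → Val} {L : X → Assignment} {u : X → V} →
             Listᶜ e encEntry L → e ↝ encV ∘ u → e ↝ λ x → word (valueAt (L x) (u x))
  valueAtᶜ {u = u} l t = minOverᶜ Cap (entryAt ∘ u)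
    (ifℕᶜ (λ (x , a , _) → a ≟ⱽ u x) (vertex≡ᵖ keyᶜ (wkᶜ t)) valueᶜ (litᶜ Cap)) l

  module _ {X : Set} {e : X → Val} where

    valᶜ : ∀ {r} {u : X → V} → e ⊨ r → e ↝ encV ∘ u → e ↝ λ x → word (val (r x) (u x))
    valᶜ {u = u} s t = respᶜ (λ x → cong word (valueAt-represents (represents s x) (u x)))
      (valueAtᶜ (entriesᶜ s) t)

    tabulationᶜ : ∀ {r : X → Raw} {us : X → List V} → Listᶜ e encV us →
                  e ▹ encV ↝ (λ (x , u) → word (val (r x) u)) →
                  Listᶜ e encEntry (λ x → tabulation (r x) (us x))
    tabulationᶜ {r} us t = mapᶜ (λ x u → u , val (r x) u) (pairᶜ vz t) us

    tabulated : ∀ {r : X → Raw} {us : X → List V} → Listᶜ e encV us →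
                e ▹ encV ↝ (λ (x , u) → word (val (r x) u)) → e ↝ word ∘ level ∘ r →
                (∀ x {u} → val (r x) u ≤ D → u ∈ us x) → e ⊨ r
    tabulated {r} {us} l t d cover = record
      { entries    = λ x → tabulation (r x) (us x)
      ; represents = λ x → tabulation-represents (r x) (us x) (cover x)
      ; entriesᶜ   = tabulationᶜ l t
      ; depthᶜ     = d
      }

    mkᶜ : ∀ {j : X → ℕ} {f : X → V → ℕ} {us : X → List V} → Listᶜ e encV us →
          e ↝ word ∘ j → (f≤ : ∀ x u → f x u ≤ Cap) →
          e ▹ encV ↝ (λ (x , u) → word (f x u)) →
          (∀ x {u} → lev u ≡ j x → f x u ≤ D → u ∈ us x) → e ⊨ λ x → mk (j x) (f x)
    mkᶜ {j} {f} l d f≤ t cover = tabulated l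
      (respᶜ (λ (x , u) → cong word (value x u (lev u ≟ j x)))
        (ifℕᶜ (λ (x , u) → lev u ≟ j x) (≡ᵖ (levelᶜ vz) (wkᶜ d)) t (litᶜ Cap)))
      d
      (λ x le → let eq , le′ = val-mk≤⁻ (j x) (f x) ≤-refl le in cover x eq le′)
      where
      value : ∀ x u (l : Dec (lev u ≡ j x)) →
              (if does l then f x u else Cap) ≡ val (mk (j x) (f x)) u
      value x u (yes eq) = sym (trans (val-mk (j x) (f x) u eq) (m≤n⇒m⊓n≡m (f≤ x u)))
      value x u (no off) = sym (val-off (mk (j x) (f x)) u off)

    vertexᴿᶜ : ∀ {v : X → V} → e ↝ encV ∘ v → e ⊨ vertexᴿ ∘ v
    vertexᴿᶜ {v} t = record
      { entries    = entries capped
      ; represents = λ x → subst (Represents (entries capped x)) (same x) (represents capped x)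
      ; entriesᶜ   = entriesᶜ capped
      ; depthᶜ     = levelᶜ t
      }
      where
      capped : e ⊨ λ x → mk (lev (v x)) (λ u → δ (v x) u ⊓ Cap)
      capped = mkᶜ (ballᶜ D t) (levelᶜ t) (λ x u → m⊓n≤n (δ (v x) u) Cap) (δᶜ Cap (wkᶜ t) vz)
        (λ x _ le → ∈-ball D (⊓Cap≤⇒≤ ≤-refl le))
      same : ∀ x → mk (lev (v x)) (λ u → δ (v x) u ⊓ Cap) ≡ vertexᴿ (v x)
      same x = raw-ext refl λ u → cap-≡ (val≤Cap _ u) (val≤Cap _ u)
        (λ c c≤D le → let eq , le′ = val-mk≤⁻ (lev (v x)) (λ u → δ (v x) u ⊓ Cap) c≤D le in
           val-mk≤⁺ (lev (v x)) (δ (v x)) eq (⊓Cap≤⇒≤ c≤D le′))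
        (λ c c≤D le → let eq , le′ = val-mk≤⁻ (lev (v x)) (δ (v x)) c≤D le in
           val-mk≤⁺ (lev (v x)) (λ u → δ (v x) u ⊓ Cap) eq (≤-trans (m⊓n≤m _ _) le′))

  -- Distances are only computed up to 2 + D: a larger one makes the sum infinite.
  throughAt : V → V × ℕ → ℕ
  throughAt w (u , c) = c + (δ u w ⊓ suc Cap ∸ 1)

  ⊓∸1≤⇒≤ : ∀ d {c} → c ≤ D → d ⊓ suc Cap ∸ 1 ≤ c → d ∸ 1 ≤ c
  ⊓∸1≤⇒≤ d {c} c≤D le with ≤-total d (suc Cap)
  ... | inj₁ d≤ = subst (λ d → d ∸ 1 ≤ c) (m≤n⇒m⊓n≡m d≤) le
  ... | inj₂ ≤d = ⊥-elim (<⇒≱ (s≤s c≤D) (subst (λ d → d ∸ 1 ≤ c) (m≥n⇒m⊓n≡n ≤d) le))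

  -- A point missing from the list has infinite value and cannot contribute to a minimum of at most
  -- D, so the list can replace the sphere.
  rise-represents : ∀ {L r} → Represents L r →
                    mk (pred (level r)) (λ w → minOver Cap L (throughAt w)) ≡ parentᴿ r
  rise-represents {L} {r} (sound , complete) = raw-ext refl λ w →
    cap-≡ (val≤Cap (mk (pred (level r)) f) w) (val≤Cap (parentᴿ r) w) (to w) (from w)
    where
    f : V → ℕ
    f w = minOver Cap L (throughAt w)
    to : ∀ w c → c ≤ D → val (mk (pred (level r)) f) w ≤ c → val (parentᴿ r) w ≤ c
    to w c c≤D le =
      let eq , le₁ = val-mk≤⁻ (pred (level r)) f c≤D le
          (u , c′) , i , le₂ = minOver-attained Cap (throughAt w) L le₁ (s≤s c≤D)
          c′≤D = ≤-trans (m≤m+n c′ _) (≤-trans le₂ c≤D)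
          vu = sound i c′≤D
          m = c ∸ c′
          eqm = m+[n∸m]≡n (≤-trans (m≤m+n c′ _) le₂)
          d≤ = +-cancelˡ-≤ c′ _ _ (≤-trans le₂ (≤-reflexive (sym eqm)))
      in ≤-trans (parentᴿ-complete r (val≤D⇒level r (subst (_≤ D) (sym vu) c′≤D)) eq)
           (≤-trans (+-mono-≤ (≤-reflexive vu) (⊓∸1≤⇒≤ (δ u w) (≤-trans (m∸n≤m c c′) c≤D) d≤))
             (≤-reflexive eqm))
    from : ∀ w c → c ≤ D → val (parentᴿ r) w ≤ c → val (mk (pred (level r)) f) w ≤ c
    from w c c≤D le =
      let eq , u , _ , le₁ = parentᴿ-sound r c≤D le
          i = complete (≤-trans (m≤m+n _ _) (≤-trans le₁ c≤D))
      in val-mk≤⁺ (pred (level r)) f eq (≤-trans (minOver≤ Cap (throughAt w) i)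
           (≤-trans (+-monoʳ-≤ (val r u) (∸-monoˡ-≤ 1 (m⊓n≤m (δ u w) (suc Cap)))) le₁))

  module _ {X : Set} {e : X → Val} where

    castˢ : ∀ {r r′} → (∀ x → r x ≡ r′ x) → e ⊨ r → e ⊨ r′
    castˢ eq s = record
      { entries    = entries s
      ; represents = λ x → subst (Represents (entries s x)) (eq x) (represents s x)
      ; entriesᶜ   = entriesᶜ s
      ; depthᶜ     = respᶜ (λ x → cong (word ∘ level) (eq x)) (depthᶜ s)
      }

    parentᶜ : ∀ {r} → e ⊨ r → e ⊨ parentᴿ ∘ r
    parentᶜ {r} s = castˢ (λ x → rise-represents (represents s x))
      -- A value of at most D at `w` means δ u w - 1 ≤ D for some entry at `u`, so balls of radius D
      -- + 1 = `Cap` around the entries cover the support of the parent.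
      (mkᶜ {us = λ x → concatMap (λ (u , _) → ball u Cap) (entries s x)}
        (concatMapᶜ (λ _ (u , _) → ball u Cap) (ballᶜ Cap keyᶜ) (entriesᶜ s))
        (minusᶜ (depthᶜ s) (litᶜ 1))
        (λ x w → minOver≤cap Cap (throughAt w) (entries s x))
        (minOverᶜ Cap (λ (_ , w) → throughAt w)
          (plusᶜ valueᶜ (minusᶜ (δᶜ (suc Cap) keyᶜ (wkᶜ vz)) (litᶜ 1)))
          (pullˡ proj₁ wk (entriesᶜ s)))
        (λ x {w} _ le →
          let (u , c) , i , le′ = minOver-attained Cap (throughAt w) (entries s x) le ≤-refl
          in ∈-concatMap⁺ (λ (u , _) → ball u Cap) (lose i (∈-ball Cap
               (m∸n≤o⇒m≤n+o 1 (⊓∸1≤⇒≤ (δ u w) ≤-refl (≤-trans (m≤n+m _ c) le′)))))))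
      where
      m∸n≤o⇒m≤n+o : ∀ n {m o} → m ∸ n ≤ o → m ≤ n + o
      m∸n≤o⇒m≤n+o n {m} le = ≤-trans (m≤n+m∸n m n) (+-monoʳ-≤ n le)

  parent^ᶜ : ∀ {X : Set} {e : X → Val} i {r} → e ⊨ r → e ⊨ parentᴿ^ i ∘ r
  parent^ᶜ zero    s = s
  parent^ᶜ (suc i) s = parent^ᶜ i (parentᶜ s)

  module _ {X : Set} {e : X → Val} {r r′ : X → Raw} (s : e ⊨ r) (s′ : e ⊨ r′) where

    closeᵖ : e ⊩ λ x → Close (r x) (r′ x)
    closeᵖ = mapᵖ to from (allᵖ
      (allᵖ (→ᵖ (≤ᵖ (wkᶜ valueᶜ) (litᶜ D)) (→ᵖ (≤ᵖ valueᶜ (litᶜ D))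
              (≤ᵖ (δᶜ R (wkᶜ keyᶜ) keyᶜ) (plusᶜ (litᶜ D) (plusᶜ (wkᶜ valueᶜ) valueᶜ)))))
            (pullˡ proj₁ wk (entriesᶜ s′)))
      (entriesᶜ s))
      where
      -- One more than the largest tolerance, so that a distance cut off at `R` fails the comparison
      -- exactly when the true one does.
      R : ℕ
      R = suc (D + (D + D))

      CloseAt : V × ℕ → V × ℕ → Set
      CloseAt (u , c) (u′ , c′) = c ≤ D → c′ ≤ D → δ u u′ ⊓ R ≤ D + (c + c′)

      CloseEntries : X → Set
      CloseEntries x = All (λ p → All (CloseAt p) (entries s′ x)) (entries s x)

      uncap : ∀ {d c c′} → c ≤ D → c′ ≤ D → d ⊓ R ≤ D + (c + c′) → d ≤ D + (c + c′)
      uncap {d} {c} {c′} c≤ c′≤ le with ≤-total d R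
      ... | inj₁ d≤ = subst (_≤ D + (c + c′)) (m≤n⇒m⊓n≡m d≤) le
      ... | inj₂ ≤d = ⊥-elim (<⇒≱ (s≤s (+-monoʳ-≤ D (+-mono-≤ c≤ c′≤)))
                        (subst (_≤ D + (c + c′)) (m≥n⇒m⊓n≡n ≤d) le))

      to : ∀ x → CloseEntries x → Close (r x) (r′ x)
      to x all u le u′ le′ = uncap le le′
        (All.lookup (All.lookup all (proj₂ (represents s x) le))
                    (proj₂ (represents s′ x) le′) le le′)

      from : ∀ x → Close (r x) (r′ x) → CloseEntries x
      from x close = All.tabulate λ {(u , c)} i → All.tabulate λ {(u′ , c′)} i′ c≤ c′≤ →
        let eq = proj₁ (represents s x) i c≤ ; eq′ = proj₁ (represents s′ x) i′ c′≤
        in ≤-trans (m⊓n≤m _ _) (subst₂ (λ c c′ → δ u u′ ≤ D + (c + c′)) eq eq′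
             (close u (subst (_≤ D) (sym eq) c≤) u′ (subst (_≤ D) (sym eq′) c′≤)))

    private
      below : (r₁ r₂ : X → Raw) → e ⊨ r₁ → e ⊨ r₂ → X → Set
      below r₁ r₂ s₁ s₂ x = All (λ (u , c) → c ≤ D → val (r₂ x) u ≡ c) (entries s₁ x)

    raw≡ᵖ : e ⊩ λ x → r x ≡ r′ x
    raw≡ᵖ = mapᵖ to from (×ᵖ (≡ᵖ (depthᶜ s) (depthᶜ s′)) (×ᵖ
      (allᵖ (→ᵖ (≤ᵖ valueᶜ (litᶜ D)) (≡ᵖ (valᶜ (wkˢ s′) keyᶜ) valueᶜ)) (entriesᶜ s))
      (allᵖ (→ᵖ (≤ᵖ valueᶜ (litᶜ D)) (≡ᵖ (valᶜ (wkˢ s) keyᶜ) valueᶜ)) (entriesᶜ s′))))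
      where
      Same : X → Set
      Same x = level (r x) ≡ level (r′ x) × below r r′ s s′ x × below r′ r s′ s x
      to : ∀ x → Same x → r x ≡ r′ x
      to x (l , all , all′) = raw-ext l λ u → cap-≡ (val≤Cap (r x) u) (val≤Cap (r′ x) u)
        (λ c c≤D le → subst (_≤ c)
           (sym (All.lookup all (proj₂ (represents s x) (≤-trans le c≤D)) (≤-trans le c≤D))) le)
        (λ c c≤D le → subst (_≤ c)
           (sym (All.lookup all′ (proj₂ (represents s′ x) (≤-trans le c≤D)) (≤-trans le c≤D))) le)
      from : ∀ x → r x ≡ r′ x → Same x
      from x eq = cong level eq ,
        All.tabulate (λ {(u , c)} i c≤ →
          trans (cong (λ r → val r u) (sym eq)) (proj₁ (represents s x) i c≤)) ,
        All.tabulate (λ {(u , c)} i c≤ →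
          trans (cong (λ r → val r u) eq) (proj₁ (represents s′ x) i c≤))

    nearDistᶜ : e ↝ λ x → word (nearDistᴿ (r x) (r′ x))
    nearDistᶜ = respᶜ (λ x → cong word (same x))
      (minOverᶜ Cap sumAt (plusᶜ valueᶜ (valᶜ (wkˢ s′) keyᶜ)) (entriesᶜ s))
      where
      sumAt : X → V × ℕ → ℕ
      sumAt x (u , c) = c + val (r′ x) u
      same : ∀ x → minOver Cap (entries s x) (sumAt x) ≡ nearDistᴿ (r x) (r′ x)
      same x = cap-≡ (minOver≤cap Cap (sumAt x) (entries s x))
        (minOver≤cap Cap (both (r x) (r′ x)) (sphere (level (r x))))
        (λ c c≤D le →
           let (u , c′) , i , le′ = minOver-attained Cap (sumAt x) (entries s x) le (s≤s c≤D)
               c′≤D = ≤-trans (m≤m+n c′ _) (≤-trans le′ c≤D)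
               eq = proj₁ (represents s x) i c′≤D
           in ≤-trans (minOver≤ Cap (both (r x) (r′ x))
                (∈-sphere⁺ (val≤D⇒level (r x) (subst (_≤ D) (sym eq) c′≤D))))
                (subst (λ a → a + val (r′ x) u ≤ c) (sym eq) le′))
        (λ c c≤D le →
           let u , _ , le′ = minOver-attained Cap (both (r x) (r′ x))
                             (sphere (level (r x))) le (s≤s c≤D)
           in ≤-trans (minOver≤ Cap (sumAt x)
                (proj₂ (represents s x) (≤-trans (m≤m+n _ _) (≤-trans le′ c≤D)))) le′)

  module _ {X : Set} {e : X → Val} where

    thinᵖ : ∀ {r r′} → e ⊨ r → e ⊨ r′ → e ⊩ λ x → Thin (r x) (r′ x)
    thinᵖ {r} {r′} s s′ = upToᵖ M
      where
      upToᵖ : ∀ m → e ⊩ λ x → ∀ {i} → i < m → Close (parentᴿ^ i (r x)) (parentᴿ^ i (r′ x))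
      upToᵖ zero    = alwaysᵖ λ x ()
      upToᵖ (suc m) = mapᵖ
        (λ x (close , closer) {i} i<1+m →
           last x close (λ {i} → closer {i}) i (m≤n⇒m<n∨m≡n (≤-pred i<1+m)))
        (λ x all → all ≤-refl , λ {i} i<m → all (m≤n⇒m≤1+n i<m))
        (×ᵖ (closeᵖ (parent^ᶜ m s) (parent^ᶜ m s′)) (upToᵖ m))
        where
        last : ∀ x → Close (parentᴿ^ m (r x)) (parentᴿ^ m (r′ x)) →
               (∀ {i} → i < m → Close (parentᴿ^ i (r x)) (parentᴿ^ i (r′ x))) →
               ∀ i → i < m ⊎ i ≡ m → Close (parentᴿ^ i (r x)) (parentᴿ^ i (r′ x))
        last x close closer i (inj₁ i<m)  = closer i<m
        last x close closer i (inj₂ refl) = close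

    zeroᵖ : ∀ {r} → e ⊨ r → e ⊩ λ x → Zero (r x)
    zeroᵖ {r} s = mapᵖ
      (λ x eq → let (u , c) , i , le = minOver-attained 1 proj₂ (entries s x)
                                       (≤-reflexive eq) ≤-refl
                    c≡0 = n≤0⇒n≡0 le
                in u , trans (proj₁ (represents s x) i (subst (_≤ D) (sym c≡0) z≤n)) c≡0)
      (λ x (u , eq) → n≤0⇒n≡0 (≤-trans
         (minOver≤ 1 proj₂ (proj₂ (represents s x) {u} (subst (_≤ D) (sym eq) z≤n)))
         (≤-reflexive eq)))
      (isZeroᵖ (minOverᶜ 1 (λ _ → proj₂) valueᶜ (entriesᶜ s)))

    validᵖ : ∀ {r} → e ⊨ r → e ⊩ λ x → Valid (r x)
    validᵖ s = ×ᵖ (zeroᵖ s) (thinᵖ s s)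

  -- The list that encodes a segment is taken from a ball around the zero with
  -- the least code, so that it does not depend on how the segment was found.

  pick : List V → V
  pick []      = v₀
  pick (u ∷ _) = u

  smaller : V → V → V
  smaller u b = if does (code u ≤? code b) then u else b

  least : V → List V → V
  least d us = foldr smaller d us

  smaller-cases : ∀ u b → (smaller u b ≡ u × code u ≤ code b) ⊎ (smaller u b ≡ b × code b ≤ code u)
  smaller-cases u b = go (code u ≤? code b)
    where
    go : (d : Dec (code u ≤ code b)) → let m = if does d then u else b in
         (m ≡ u × code u ≤ code b) ⊎ (m ≡ b × code b ≤ code u)
    go (yes le) = inj₁ (refl , le)
    go (no ≰)   = inj₂ (refl , <⇒≤ (≰⇒> ≰))

  least∈ : ∀ d us → least d us ≡ d ⊎ least d us ∈ us
  least∈ d []       = inj₁ refl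
  least∈ d (u ∷ us) with smaller-cases u (least d us) | least∈ d us
  ... | inj₁ (eq , _) | _       = inj₂ (here eq)
  ... | inj₂ (eq , _) | inj₁ e  = inj₁ (trans eq e)
  ... | inj₂ (eq , _) | inj₂ m∈ = inj₂ (there (subst (_∈ us) (sym eq) m∈))

  least≤ : ∀ d us {u} → u ∈ us → code (least d us) ≤ code u
  least≤ d (u ∷ us) i with smaller-cases u (least d us) | i
  ... | inj₁ (eq , _)  | here refl = ≤-reflexive (cong code eq)
  ... | inj₁ (eq , le) | there i′  =
    ≤-trans (≤-reflexive (cong code eq)) (≤-trans le (least≤ d us i′))
  ... | inj₂ (eq , le) | here refl = ≤-trans (≤-reflexive (cong code eq)) le
  ... | inj₂ (eq , _)  | there i′  = ≤-trans (≤-reflexive (cong code eq)) (least≤ d us i′)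

  pick∈ : ∀ {us : List V} {u} → u ∈ us → pick us ∈ us
  pick∈ {_ ∷ _} _ = here refl

  zerosOf : Assignment → List V
  zerosOf L = map proj₁ (filter (λ (_ , c) → c ≟ 0) L)

  baseOf : Assignment → V
  baseOf L = least (pick (zerosOf L)) (zerosOf L)

  baseOf∈ : ∀ {L u} → u ∈ zerosOf L → baseOf L ∈ zerosOf L
  baseOf∈ {L} u∈ with least∈ (pick (zerosOf L)) (zerosOf L)
  ... | inj₁ eq = subst (_∈ zerosOf L) (sym eq) (pick∈ u∈)
  ... | inj₂ i  = i

  zerosOf⁺ : ∀ {L r u} → Represents L r → val r u ≡ 0 → u ∈ zerosOf L
  zerosOf⁺ {L} {r} {u} (_ , complete) eq = ∈-map⁺ proj₁ (∈-filter⁺ (λ (_ , c) → c ≟ 0)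
    (complete (subst (_≤ D) (sym eq) z≤n)) eq)

  zerosOf⁻ : ∀ {L r u} → Represents L r → u ∈ zerosOf L → val r u ≡ 0
  zerosOf⁻ {L} {r} (sound , _) u∈ with ∈-map⁻ proj₁ u∈
  ... | (u , c) , i , refl = let i′ , c≡0 = ∈-filter⁻ (λ (_ , c) → c ≟ 0) {xs = L} i in
    trans (sound i′ (subst (_≤ D) (sym c≡0) z≤n)) c≡0

  -- Both lists name the same zeros and codes are injective, so the least code decides; without
  -- zeros both fall back on `v₀`.
  baseOf-unique : ∀ {L L′ r} → Represents L r → Represents L′ r → baseOf L ≡ baseOf L′
  baseOf-unique {L} {L′} {r} rep rep′ = go (zerosOf L) (zerosOf L′) refl refl
    where
    shared : ∀ {u} → u ∈ zerosOf L → baseOf L ≡ baseOf L′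
    shared u∈ =
      let b = zerosOf⁻ {L} {r} rep (baseOf∈ {L} u∈)
          u∈′ = zerosOf⁺ {L′} {r} rep′ b
          b′ = zerosOf⁻ {L′} {r} rep′ (baseOf∈ {L′} u∈′)
      in code-injective (≤-antisym
           (least≤ _ (zerosOf L) (zerosOf⁺ {L} {r} rep b′))
           (least≤ _ (zerosOf L′) (zerosOf⁺ {L′} {r} rep′ b)))
    go : ∀ zs zs′ → zerosOf L ≡ zs → zerosOf L′ ≡ zs′ → baseOf L ≡ baseOf L′
    go (z ∷ _) _        eq _   = shared (subst (z ∈_) (sym eq) (here refl))
    go []      []       eq eq′ = cong (λ zs → least (pick zs) zs) (trans eq (sym eq′))
    go []      (z ∷ _)  eq eq′ = shared (zerosOf⁺ {L} {r} rep
      (zerosOf⁻ {L′} {r} rep′ (subst (z ∈_) (sym eq′) (here refl))))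

  onSphere : Raw → Assignment
  onSphere r = tabulation r (sphere (level r))

  onSphere-represents : ∀ r → Represents (onSphere r) r
  onSphere-represents r = tabulation-represents r (sphere (level r))
    (λ le → ∈-sphere⁺ (val≤D⇒level r le))

  base : Raw → V
  base r = baseOf (onSphere r)

  base-zero : ∀ r → Zero r → val r (base r) ≡ 0
  base-zero r (u , eq) = zerosOf⁻ {onSphere r} {r} (onSphere-represents r)
    (baseOf∈ {onSphere r} (zerosOf⁺ {onSphere r} {r} (onSphere-represents r) eq))

  base-vertex : ∀ v → base (vertexᴿ v) ≡ v
  base-vertex v = zero-of-vertex (base-zero (vertexᴿ v) (v , vertexᴿ-self v))

  -- Radius 2D covers the support of the segment and of near ones, by `cover-near`; the extra step
  -- is for children, by `child-cover`.
  ρ : ℕ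
  ρ = suc (D + D)

  canonical : Raw → Assignment
  canonical r = tabulation r (ball (base r) ρ)

  support-near-base : ∀ r → Valid r → ∀ {u} → val r u ≤ D → δ (base r) u ≤ D + D
  support-near-base r (z , thin) = cover-near {r} {r} (base-zero r z) (thin 0<M)

  canonical-represents : ∀ r → Valid r → Represents (canonical r) r
  canonical-represents r v = tabulation-represents r (ball (base r) ρ)
    (λ le → ∈-ball ρ (m≤n⇒m≤1+n (support-near-base r v le)))

  smallerᶜ : ∀ {X : Set} {e : X → Val} {u w : X → V} →
             e ↝ encV ∘ u → e ↝ encV ∘ w → e ↝ λ x → encV (smaller (u x) (w x))
  smallerᶜ {u = u} {w} s t = respᶜ
    (λ x → float (u x) (w x) (does-≡ (dec (≤ᵖ s t) x) (code (u x) ≤? code (w x))))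
    (ifᶜ (≤ᵖ s t) s t)
    where
    float : ∀ u w {β} → β ≡ does (code u ≤? code w) →
            (if β then encV u else encV w) ≡ encV (smaller u w)
    float u w {true}  eq = cong (λ β → encV (if β then u else w)) eq
    float u w {false} eq = cong (λ β → encV (if β then u else w)) eq

  module _ {X : Set} {e : X → Val} where

    baseᶜ : ∀ {L : X → Assignment} {r : X → Raw} → Listᶜ e encEntry L →
            (∀ x → Represents (L x) (r x)) → e ↝ encV ∘ base ∘ r
    baseᶜ {L} {r} l rep = respᶜ
      (λ x → cong encV (baseOf-unique {L x} {onSphere (r x)} {r x} (rep x)
                           (onSphere-represents (r x))))
      (foldᶜ (λ x us → encV (least (pick (zerosOf (L x))) us)) (size zeros) first
        (smallerᶜ {u = λ (_ , u , _) → u} {λ (x , _ , us , _) → least (pick (zerosOf (L x))) us}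
          (carᶜ (cdrᶜ idᶜ)) (cdrᶜ (cdrᶜ idᶜ)))
        (zerosOf ∘ L) (short zeros) (list zeros))
      where
      zeros : Listᶜ e encV (zerosOf ∘ L)
      zeros = mapᶜ (λ _ → proj₁) keyᶜ (filterᶜ (isZeroᵖ valueᶜ) l)
      first : e ↝ λ x → encV (pick (zerosOf (L x)))
      first = foldᶜ (λ _ us → encV (pick us)) (size zeros) (litᶜ (code v₀)) (carᶜ (cdrᶜ idᶜ))
        (zerosOf ∘ L) (short zeros) (list zeros)

    baseˢ : ∀ {r} → e ⊨ r → e ↝ encV ∘ base ∘ r
    baseˢ s = baseᶜ (entriesᶜ s) (represents s)

    canonicalᶜ : ∀ {r} → e ⊨ r → Listᶜ e encEntry (canonical ∘ r)
    canonicalᶜ s = tabulationᶜ (ballᶜ ρ (baseˢ s)) (valᶜ (wkˢ s) vz)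

  -- The encoding of segments

  raw-≟ : (r r′ : Raw) → Dec (r ≡ r′)
  raw-≟ r r′ = map′
    (λ (l , all) → raw-ext l λ u → same l all u (lev u ≟ level r))
    (λ { refl → refl , All.tabulate (λ _ → refl) })
    ((level r ≟ level r′) ×-dec All.all? (λ u → val r u ≟ val r′ u) (sphere (level r)))
    where
    same : level r ≡ level r′ → All (λ u → val r u ≡ val r′ u) (sphere (level r)) →
           ∀ u → Dec (lev u ≡ level r) → val r u ≡ val r′ u
    same l all u (yes eq) = All.lookup all (∈-sphere⁺ eq)
    same l all u (no off) = trans (val-off r u off)
      (sym (val-off r′ u (λ eq → off (trans eq (sym l)))))

  opaque

    isVertex? : ∀ r → Dec (r ≡ vertexᴿ (base r))
    isVertex? r = raw-≟ r (vertexᴿ (base r))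

  select : Raw → Bool → Val
  select r b = if b then encV (base r) else encList encEntry (canonical r)

  encᴿ : Raw → Val
  encᴿ r = select r (does (isVertex? r))

  enc : Segment → Val
  enc s = encᴿ (body s)

  isVertexᵖ : ∀ {X : Set} {e : X → Val} {r} → e ⊨ r → e ⊩ λ x → r x ≡ vertexᴿ (base (r x))
  isVertexᵖ s = raw≡ᵖ s (vertexᴿᶜ (baseˢ s))

  encᴿᶜ : ∀ {X : Set} {e : X → Val} {r} → e ⊨ r → e ↝ encᴿ ∘ r
  encᴿᶜ {r = r} s = respᶜ
    (λ x → cong (select (r x)) (does-≡ (dec (isVertexᵖ s) x) (isVertex? (r x))))
    (ifᶜ (isVertexᵖ s) (baseˢ s) (list (canonicalᶜ s)))

  enc-vertex : ∀ v → enc (vertexˢ v) ≡ encV v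
  enc-vertex v = trans
    (cong (select (vertexᴿ v)) (dec-true (isVertex? (vertexᴿ v))
      (cong vertexᴿ (sym (base-vertex v)))))
    (cong encV (base-vertex v))

  vertexᵛ : encV ⊨ vertexᴿ
  vertexᵛ = vertexᴿᶜ {v = id} idᶜ

  -- Only the encodings of vertices are words.
  canonicalˢ : enc ↝ λ s → encList encEntry (canonical (body s))
  canonicalˢ = iteᶜ vertex vertexᶜ
    (castᶜ (λ (s , eq) → cong (select (body s)) (sym eq))
           (λ (s , eq) → cong (encList encEntry ∘ canonical)
              (sym (is-vertex (isVertex? (body s)) eq)))
           (reindex base′ (list (canonicalᶜ vertexᵛ))))
    (respᶜ (λ (s , eq) → cong (select (body s)) eq) idᶜ)
    where
    vertex : Segment → Bool
    vertex s = does (isVertex? (body s))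
    base′ : Σ Segment (λ s → vertex s ≡ true) → V
    base′ (s , _) = base (body s)
    is-vertex : ∀ {P : Set} (d : Dec P) → does d ≡ true → P
    is-vertex (yes p) _ = p
    isWord : Bool → ℕ
    isWord b = if b then 0 else 1
    kindᶜ : enc ↝ λ s → word (isWord (vertex s))
    kindᶜ = respᶜ (λ s → kind (body s) (vertex s)) (op₁ᶜ isPair idᶜ)
      where
      kind : ∀ r b → ⟦ isPair ⟧₁ π (select r b) ≡ word (isWord b)
      kind r true  = refl
      -- A ball starts with its centre, so the canonical list is nonempty and its encoding a pair.
      kind r false = refl
    vertexᶜ : enc ↝ bit ∘ vertex
    vertexᶜ = respᶜ (λ s → cong bit (flip (vertex s))) (ct (isZeroᵖ kindᶜ))
      where
      flip : ∀ b → does (isWord b ≟ 0) ≡ b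
      flip true  = refl
      flip false = refl

  segmentᶜ : enc ⊨ body
  segmentᶜ = record
    { entries    = canonical ∘ body
    ; represents = rep
    ; entriesᶜ   = l
    -- The encoding does not store the level: the base is a zero, so it lies on that level and the
    -- given distance program finds it.
    ; depthᶜ     = respᶜ
        (λ s → cong word (zero-level (body s) (base-zero (body s) (proj₁ (validity s)))))
        (levelᶜ (baseᶜ l rep))
    }
    where
    rep : ∀ s → Represents (canonical (body s)) (body s)
    rep s = canonical-represents (body s) (validity s)
    l : Listᶜ enc encEntry (canonical ∘ body)
    l = bounded (size (ballᵛ ρ))
      (λ s → ≤-trans (≤-reflexive (length-map _ (ball (base (body s)) ρ)))
               (short (ballᵛ ρ) (base (body s))))
      canonicalˢ

  encList-injective : ∀ {A : Set} {f : A → Val} → (∀ {x y} → f x ≡ f y → x ≡ y) →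
                      ∀ xs ys → encList f xs ≡ encList f ys → xs ≡ ys
  encList-injective inj []       []       eq = refl
  encList-injective inj (x ∷ xs) (y ∷ ys) eq =
    cong₂ _∷_ (inj (cong (⟦ car ⟧₁ π) eq)) (encList-injective inj xs ys (cong (⟦ cdr ⟧₁ π) eq))

  encV-injective : ∀ {u w} → encV u ≡ encV w → u ≡ w
  encV-injective eq = code-injective (cong toℕ eq)

  encEntry-injective : ∀ {p q} → encEntry p ≡ encEntry q → p ≡ q
  encEntry-injective eq =
    cong₂ _,_ (encV-injective (cong (⟦ car ⟧₁ π) eq)) (cong (toℕ ∘ ⟦ cdr ⟧₁ π) eq)

  enc-injective : ∀ {s t} → enc s ≡ enc t → s ≡ t
  enc-injective {s} {t} eq = segment-ext (go (isVertex? (body s)) (isVertex? (body t)) eq)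
    where
    same-list : canonical (body s) ≡ canonical (body t) → body s ≡ body t
    same-list eq =
      let rep = canonical-represents (body s) (validity s)
          rep′ = subst (λ L → Represents L (body t)) (sym eq)
                   (canonical-represents (body t) (validity t))
          vals = λ u → trans (sym (valueAt-represents rep u)) (valueAt-represents rep′ u)
          (z , zeq) , _ = validity s
      in raw-ext (trans (sym (zero-level (body s) zeq))
                         (zero-level (body t) (trans (sym (vals z)) zeq))) vals
    go : (d : Dec (body s ≡ vertexᴿ (base (body s))))
         (d′ : Dec (body t ≡ vertexᴿ (base (body t)))) →
         select (body s) (does d) ≡ select (body t) (does d′) → body s ≡ body t
    go (yes p) (yes q) eq = trans p (trans (cong vertexᴿ (encV-injective eq)) (sym q))
    go (yes _) (no _)  ()
    go (no _)  (yes _) ()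
    go (no _)  (no _)  eq = same-list (encList-injective encEntry-injective
      (canonical (body s)) (canonical (body t)) eq)

  -- Enumeration of near segments and children

  encA : Assignment → Val
  encA = encList encEntry

  keys-assignments : ∀ us {L} → L ∈ assignments us → map proj₁ L ≡ us
  keys-assignments []       (here refl) = refl
  keys-assignments (u ∷ us) L∈
    with ∈-cartesianProductWith⁻ (λ L c → (u , c) ∷ L) (assignments us) (upTo (suc Cap)) L∈
  ... | L , c , L∈′ , _ , refl = cong (u ∷_) (keys-assignments us L∈′)

  assignments-unique : ∀ us → Unique (assignments us)
  assignments-unique []       = [] ∷ []
  assignments-unique (u ∷ us) = cartesianProductWith⁺ (λ L c → (u , c) ∷ L)
    (λ { refl → refl , refl }) (assignments-unique us) (upTo⁺ (suc Cap))

  cartesianProductWith≡concatMap : ∀ {A B C : Set} (f : A → B → C) xs ys →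
    concatMap (λ x → map (f x) ys) xs ≡ cartesianProductWith f xs ys
  cartesianProductWith≡concatMap f []       ys = refl
  cartesianProductWith≡concatMap f (x ∷ xs) ys =
    cong (map (f x) ys ++_) (cartesianProductWith≡concatMap f xs ys)

  assignmentsᶜ : ∀ {X : Set} {e : X → Val} {us : X → List V} → Listᶜ e encV us →
                 e ↝ encList encA ∘ assignments ∘ us
  assignmentsᶜ {X} {e} {us} l = foldᶜ (λ _ vs → encList encA (assignments vs)) n
    (constᶜ (encList encA (assignments [])))
    (respᶜ (λ (x , u , vs , _) → cong (encList encA)
             (cartesianProductWith≡concatMap (λ L c → (u , c) ∷ L) (assignments vs)
               (upTo (suc Cap))))
      (list (concatMapᶜ (λ (x , u , _) L → map (λ c → (u , c) ∷ L) (upTo (suc Cap)))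
        (mapᶜ (λ ((x , u , _) , L) c → (u , c) ∷ L)
          (pairᶜ (pairᶜ (wkᶜ (wkᶜ (carᶜ (cdrᶜ idᶜ)))) vz) (wkᶜ vz))
          values)
        previous)))
    us (short l) (list l)
    where
    n : ℕ
    n = size l
    Shorter : Set
    Shorter = X × V × Σ (List V) (λ vs → length vs ≤ n)
    state : Shorter → Val
    state (x , u , vs , _) = pair (e x) (pair (encV u) (encList encA (assignments vs)))
    previous : Listᶜ state encA (λ (_ , _ , vs , _) → assignments vs)
    previous = bounded (suc Cap ^ n)
      (λ (_ , _ , vs , le) → ≤-trans (≤-reflexive (length-assignments vs)) (^-monoʳ-≤ (suc Cap) le))
      (cdrᶜ (cdrᶜ idᶜ))
    values : ∀ {Y : Set} {e : Y → Val} → Listᶜ e word (λ _ → upTo (suc Cap))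
    values = bounded (suc Cap) (λ _ → ≤-reflexive (length-upTo (suc Cap)))
      (constᶜ (encList word (upTo (suc Cap))))

  -- Assignments of bounded length: programs have to terminate in constant
  -- time on all assignments that they are given.
  Small : ℕ → Set
  Small n = Σ Assignment λ L → length L ≤ n

  encSmall : ∀ {n} → Small n → Val
  encSmall = encA ∘ proj₁

  smallᶜ : ∀ {X : Set} {e : X → Val} {n} → Listᶜ (e ▹ encSmall {n}) encEntry (proj₁ ∘ proj₂)
  smallᶜ {n = n} = bounded n (λ (_ , _ , le) → le) vz

  candidateᶜ : ∀ {X : Set} {e : X → Val} {n} {j : X → ℕ} → e ↝ word ∘ j →
               e ▹ encSmall {n} ⊨ λ (x , L , _) → candidate (j x) L
  candidateᶜ t = mkᶜ {us = λ (_ , L , _) → map proj₁ L} (mapᶜ (λ _ → proj₁) keyᶜ smallᶜ) (wkᶜ t)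
    (λ (_ , L , _) u → minOver≤cap Cap (entryAt u) L)
    (valueAtᶜ (pullˡ proj₁ wk smallᶜ) vz)
    (λ (_ , L , _) {u} _ le →
      let (u′ , c) , i , le′ = minOver-attained Cap (entryAt u) L le ≤-refl
      in subst (_∈ map proj₁ L) (entryAt≤D {u} {u′} {c} le′) (∈-map⁺ proj₁ i))

  attach : ∀ {A : Set} {P : A → Set} {xs} → All P xs → List (Σ A P)
  attach []       = []
  attach (p ∷ ps) = (_ , p) ∷ attach ps

  map-proj₁-attach : ∀ {A : Set} {P : A → Set} {xs} (ps : All P xs) → map proj₁ (attach ps) ≡ xs
  map-proj₁-attach []       = refl
  map-proj₁-attach (p ∷ ps) = cong (_ ∷_) (map-proj₁-attach ps)

  map-body-segments : ∀ {rs} → All Valid rs → map body (segments rs) ≡ rs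
  map-body-segments []                = refl
  map-body-segments {r ∷ rs} (v ∷ vs) with Valid? r
  ... | yes _ = cong (r ∷_) (map-body-segments vs)
  ... | no ¬v = ⊥-elim (¬v v)

  -- Brute force shared by near segments and children: all assignments on one ball are tried, `Qᵖ`
  -- tests the wanted relation, and `cover` ensures that nothing is missed.
  module Enumeration (j : Segment → ℕ) (jᶜ : enc ↝ word ∘ j) (Q : Segment → Raw → Set)
      (Qᵖ : ∀ {X : Set} {e : X → Val} {s : X → Segment} {r : X → Raw} →
            e ⊨ body ∘ s → e ⊨ r → e ⊩ λ x → Q (s x) (r x))
      (cover : ∀ s {r} → level r ≡ j s → Q s r → ∀ {u} → val r u ≤ D → δ (base (body s)) u ≤ ρ)
      where

    us : Segment → List V
    us s = ball (base (body s)) ρ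

    usᶜ : Listᶜ enc encV us
    usᶜ = ballᶜ ρ (baseˢ segmentᶜ)

    n : ℕ
    n = size usᶜ

    small : ∀ s → All (λ L → length L ≤ n) (assignments (us s))
    small s = All.tabulate λ {L} L∈ → subst (_≤ n)
      (trans (cong length (sym (keys-assignments (us s) L∈))) (length-map proj₁ L)) (short usᶜ s)

    smalls : Segment → List (Small n)
    smalls s = attach (small s)

    smallsᶜ : Listᶜ enc encSmall smalls
    smallsᶜ = bounded (suc Cap ^ n)
      (λ s → subst (_≤ suc Cap ^ n)
        (trans (sym (length-assignments (us s)))
          (trans (cong length (sym (map-proj₁-attach (small s)))) (length-map proj₁ (smalls s))))
        (^-monoʳ-≤ (suc Cap) (short usᶜ s)))
      (respᶜ (λ s → cong (foldr pair (word 0)) (trans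
          (cong (map encA) (sym (map-proj₁-attach (small s)))) (sym (map-∘ (smalls s)))))
        (assignmentsᶜ usᶜ))

    raw-of : Segment → Small n → Raw
    raw-of s (L , _) = candidate (j s) L

    -- Several assignments can give the same raw segment, since keys may repeat in a ball and values
    -- off the level are lost. Only the one that agrees with the raw segment on all its keys is
    -- kept, which keeps the output free of repetitions.
    Consistent : Segment × Small n → Set
    Consistent (s , L , _) = All (λ (u , c) → val (candidate (j s) L) u ≡ c) L

    Good : Segment × Small n → Set
    Good (s , L) = Consistent (s , L) × Valid (raw-of s L) × Q s (raw-of s L)

    candidateˢ : enc ▹ encSmall ⊨ λ (s , L) → raw-of s L
    candidateˢ = candidateᶜ jᶜ

    opaque

      goodᵖ : enc ▹ encSmall ⊩ Good
      goodᵖ = ×ᵖ (allᵖ (≡ᵖ (valᶜ (wkˢ candidateˢ) keyᶜ) valueᶜ) smallᶜ)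
        (×ᵖ (validᵖ candidateˢ) (Qᵖ (wkˢ segmentᶜ) candidateˢ))

    good? : ∀ s L → Dec (Good (s , L))
    good? s L = dec goodᵖ (s , L)

    chosen : Segment → List (Small n)
    chosen s = filter (good? s) (smalls s)

    raws : Segment → List Raw
    raws s = map (raw-of s) (chosen s)

    result : Segment → List Segment
    result s = segments (raws s)

    chosen⇒ : ∀ s {L} → L ∈ chosen s → map proj₁ (proj₁ L) ≡ us s × Good (s , L)
    chosen⇒ s {L} L∈ =
      let L∈′ , good = ∈-filter⁻ (good? s) {xs = smalls s} L∈
      in keys-assignments (us s)
           (subst (proj₁ L ∈_) (map-proj₁-attach (small s)) (∈-map⁺ proj₁ L∈′)) , good

    raws-valid : ∀ s → All Valid (raws s)
    raws-valid s = All.tabulate λ r∈ →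
      let L , L∈ , eq = ∈-map⁻ (raw-of s) r∈
          _ , _ , v , _ = chosen⇒ s L∈
      in subst Valid (sym eq) v

    resultᶜ : enc ↝ λ s → encList enc (result s)
    resultᶜ = respᶜ
      (λ s → cong (foldr pair (word 0)) (trans
        (cong (map encᴿ) (sym (map-body-segments (raws-valid s)))) (sym (map-∘ (result s)))))
      (list (mapᶜ raw-of (encᴿᶜ candidateˢ) (filterᶜ goodᵖ smallsᶜ)))

    consistent : ∀ {r} L → All (λ (u , c) → val r u ≡ c) L → tabulation r (map proj₁ L) ≡ L
    consistent []       []       = refl
    consistent (_ ∷ L) (eq ∷ eqs) = cong₂ _∷_ (cong (_ ,_) eq) (consistent L eqs)

    -- Tabulation on `us s` inverts `raw-of` on the chosen assignments, so their uniqueness passes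
    -- to the raw segments.
    recover : ∀ s {Ls} → (∀ {L} → L ∈ Ls → L ∈ chosen s) →
              map (λ r → tabulation r (us s)) (map (raw-of s) Ls) ≡ map proj₁ Ls
    recover s {[]}     sub = refl
    recover s {L ∷ Ls} sub = let keys , same , _ = chosen⇒ s (sub (here refl)) in
      cong₂ _∷_ (trans (cong (tabulation (raw-of s L)) (sym keys)) (consistent (proj₁ L) same))
        (recover s (λ i → sub (there i)))

    small-≡ : ∀ {L L′ : Small n} → proj₁ L ≡ proj₁ L′ → L ≡ L′
    small-≡ {L , p} {.L , q} refl = cong (L ,_) (≤-irrelevant p q)

    result-unique : ∀ s → Unique (result s)
    result-unique s = map⁻ {f = body} (subst Unique (sym (map-body-segments (raws-valid s)))
      (map⁻ {f = λ r → tabulation r (us s)} (subst Unique (sym (recover s id))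
        (map⁺ small-≡ (filter⁺ (good? s) (map⁻ {f = proj₁}
          (subst Unique (sym (map-proj₁-attach (small s))) (assignments-unique (us s)))))))))

    result⇒ : ∀ s {t} → t ∈ result s → depthˢ t ≡ j s × Q s (body t)
    result⇒ s {t} t∈ =
      let L , L∈ , eq = ∈-map⁻ (raw-of s)
            (subst (body t ∈_) (map-body-segments (raws-valid s)) (∈-map⁺ body t∈))
          _ , _ , _ , q = chosen⇒ s L∈
      in cong level eq , subst (Q s) (sym eq) q

    ⇒result : ∀ s {t} → depthˢ t ≡ j s → Q s (body t) → t ∈ result s
    ⇒result s {t} l q = ∈-segments⁺ (subst (_∈ raws s) is-t (∈-map⁺ (raw-of s) chosen-L))
      where
      L : Assignment
      L = tabulation (body t) (us s)
      L∈ : ∃[ a ] a ∈ smalls s × L ≡ proj₁ a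
      L∈ = ∈-map⁻ proj₁ (subst (L ∈_) (sym (map-proj₁-attach (small s)))
             (tabulation∈assignments (body t) (us s)))
      is-t′ : candidate (j s) L ≡ body t
      is-t′ = subst (λ i → candidate i L ≡ body t) l (candidate-represents
        (tabulation-represents (body t) (us s) (λ le → ∈-ball ρ (cover s l q le))))
      is-t : raw-of s (proj₁ L∈) ≡ body t
      is-t = trans (cong (candidate (j s)) (sym (proj₂ (proj₂ L∈)))) is-t′
      consistent-L : All (λ (u , c) → val (body t) u ≡ c) L
      consistent-L = All.tabulate λ i → let _ , _ , eq = ∈-map⁻ _ i in
        trans (cong (val (body t)) (cong proj₁ eq)) (sym (cong proj₂ eq))
      chosen-L : proj₁ L∈ ∈ chosen s
      chosen-L = ∈-filter⁺ (good? s) (proj₁ (proj₂ L∈))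
        ( subst₂ (λ r L → All (λ (u , c) → val r u ≡ c) L) (sym is-t) (proj₂ (proj₂ L∈))
            consistent-L
        , subst Valid (sym is-t) (validity t)
        , subst (Q s) (sym is-t) q )

    enumerates : ∀ s (P : Segment → Set) → (∀ {t} → P t → depthˢ t ≡ j s × Q s (body t)) →
                 (∀ {t} → depthˢ t ≡ j s → Q s (body t) → P t) →
                 Enumerates enc P (encList enc (result s))
    enumerates s P to from = result s , result-unique s ,
      (λ t → mk⇔ (λ t∈ → let l , q = result⇒ s t∈ in from l q)
                 (λ p → let l , q = to p in ⇒result s l q)) , refl

  module NearList = Enumeration depthˢ (depthᶜ segmentᶜ) (λ s r → Thin (body s) r) thinᵖ
    (λ s {r} _ thin le → m≤n⇒m≤1+n (cover-near {body s} {r}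
       (base-zero (body s) (proj₁ (validity s))) (thin 0<M) le))

  -- A neighbour `a` of `u` one level closer to the root has in the parent at most the value of `u`
  -- in the child. So `a` is in the support of `s`, within 2D of the base.
  child-cover : ∀ s {r} → level r ≡ suc (depthˢ s) → parentᴿ r ≡ body s →
                ∀ {u} → val r u ≤ D → δ (base (body s)) u ≤ ρ
  child-cover s {r} l eq {u} le =
    let a , A , la = ancestor 1 (depthˢ s) (trans (val≤D⇒level r le) l)
        up≤ = ≤-trans (parentᴿ-complete r (val≤D⇒level r le) (trans la (cong pred (sym l))))
                (≤-trans (≤-reflexive (trans (cong (λ d → val r u + (d ∸ 1)) (Above.dist A))
                                             (+-identityʳ _))) le)
        near = support-near-base (body s) (validity s) (subst (λ r → val r a ≤ D) eq up≤)
    in ≤-trans (tri′ a) (≤-trans (+-mono-≤ near (≤-reflexive (Above.dist A)))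
                          (≤-reflexive (+-comm _ 1)))

  module ChildList = Enumeration (λ s → suc (depthˢ s)) (plusᶜ (litᶜ 1) (depthᶜ segmentᶜ))
    (λ s r → parentᴿ r ≡ body s) (λ s r → raw≡ᵖ (parentᶜ r) s) child-cover

  -- The six operations

  solves : ∀ (task : Task) {g} → Task.encode task ↝ g → (∀ x → Task.Correct task x (g x)) →
           ConstantTime π task
  solves task (computes p C run) correct = p , C , λ x →
    let t , t≤ , d = run x in _ , t , d , correct x , t≤

  IsChildOf : Segment → Segment → Set
  IsChildOf s t = Σ (t ≢ rootˢ) λ _ → parentˢ t ≡ s

  -- The parent equation alone determines only `pred` of the level; excluding the root excludes
  -- level 0.
  child⇒ : ∀ {s t} → IsChildOf s t → depthˢ t ≡ suc (depthˢ s) × parentᴿ (body t) ≡ body s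
  child⇒ {s} {t} (t≢root , eq) = depth-child , cong body eq
    where
    depth-child : depthˢ t ≡ suc (depthˢ s)
    depth-child = trans
      (sym (suc-pred (depthˢ t) {{≢-nonZero (λ l → t≢root (level≡0⇒root t l))}}))
      (cong (λ s → suc (depthˢ s)) eq)

  ⇒child : ∀ {s t} → depthˢ t ≡ suc (depthˢ s) → parentᴿ (body t) ≡ body s → IsChildOf s t
  ⇒child {s} {t} l eq = t≢root , segment-ext eq
    where
    t≢root : t ≢ rootˢ
    t≢root t≡root = 1+n≢0 (trans (sym l) (trans (cong depthˢ t≡root) depth-root))

  children : ∀ s → Enumerates enc (IsChildOf s) (encList enc (ChildList.result s))
  children s = ChildList.enumerates s (IsChildOf s)
    (λ {t} → child⇒ {s} {t}) (λ {t} → ⇒child {s} {t})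

  nears : ∀ s → Enumerates enc (Nearˢ s) (encList enc (NearList.result s))
  nears s = NearList.enumerates s (Nearˢ s) (λ (l , thin) → sym l , λ {i} → thin {i})
    (λ l thin → sym l , λ {i} → thin {i})

  isVertexˢ : enc ⊩ λ s → body s ≡ vertexᴿ (base (body s))
  isVertexˢ = isVertexᵖ segmentᶜ

  decides : ∀ s (d : Dec (body s ≡ vertexᴿ (base (body s)))) →
            Decides (∃[ v ] vertexˢ v ≡ s) (bit (does d))
  decides s (yes p) = inj₁ ((base (body s) , segment-ext (sym p)) , refl)
  decides s (no ¬p) = inj₂ ((λ (v , eq) → ¬p (trans (cong body (sym eq))
    (cong vertexᴿ (trans (sym (base-vertex v)) (cong (base ∘ body) eq))))) , refl)

  nearDistˢ : (λ ((s , t , _) : Σ Segment λ s → Σ Segment λ t → Nearˢ s t) → pair (enc s) (enc t)) ↝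
              λ (s , t , _) → word (nearDistᴿ (body s) (body t))
  nearDistˢ = nearDistᶜ (pullˢ proj₁ (carᶜ idᶜ) segmentᶜ)
                        (pullˢ (proj₁ ∘ proj₂) (cdrᶜ idᶜ) segmentᶜ)

  operations : ∀ i → ConstantTime π (operation tree enc i)
  operations isVertex    = solves (operation tree enc isVertex) (ct isVertexˢ) λ s →
    decides s (dec isVertexˢ s)
  operations getParent   = solves (operation tree enc getParent)
    (reindex proj₁ (encᴿᶜ (parentᶜ segmentᶜ))) λ _ → refl
  operations getChildren = solves (operation tree enc getChildren) ChildList.resultᶜ children
  operations getDepth    = solves (operation tree enc getDepth) (depthᶜ segmentᶜ) λ _ → refl
  operations getNear     = solves (operation tree enc getNear) NearList.resultᶜ nears
  operations getNearDist = solves (operation tree enc getNearDist) nearDistˢ λ _ → refl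

-- Amortized time and the theorem

stateless : Program → Program
stateless p = op₂ cons (op₁ car (var zero)) (call p (op₁ cdr (var zero)))

-- The operations are constant-time in the worst case, so the state stays `word 0`; the wrapper
-- `stateless` adds 6 steps to each of them.
constant⇒amortized : ∀ {π} {I : Set} (task : I → Task) (K : ℕ)
                     (solve : ∀ i → ConstantTime π (task i)) →
                     (∀ i → proj₁ (proj₂ (solve i)) ≤ K) → AmortizedConstantTime π task
constant⇒amortized {π} {I} task K solve C≤K = prog , word 0 , 6 + K , serve
  where
  prog : I → Program
  prog i = stateless (proj₁ (solve i))

  serve : ∀ rs → ∃[ t ] Serves π task prog (word 0) rs t × t ≤ (6 + K) * length rs
  serve []             = 0 , [] , ≤-reflexive (sym (*-zeroʳ (6 + K)))
  serve ((i , x) ∷ rs) =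
    let v , s , run , correct , s≤ = proj₂ (proj₂ (solve i)) x
        t , served , t≤ = serve rs
    in 6 + s + t , (op₂ (op₁ var) (call (op₁ var) run) , correct) ∷ served ,
       ≤-trans (+-mono-≤ (+-monoʳ-≤ 6 (≤-trans s≤ (C≤K i))) t≤)
         (≤-reflexive (sym (*-suc (6 + K) (length rs))))

sum-bound : (f : Operation → ℕ) → ∃[ K ] (∀ i → f i ≤ K)
sum-bound f = foldr (λ i m → f i + m) 0 all , λ
  { isVertex    → bound (here refl)
  ; getParent   → bound (there (here refl))
  ; getChildren → bound (there (there (here refl)))
  ; getDepth    → bound (there (there (there (here refl))))
  ; getNear     → bound (there (there (there (there (here refl)))))
  ; getNearDist → bound (there (there (there (there (there (here refl))))))
  }
  where
  all : List Operation
  all = isVertex ∷ getParent ∷ getChildren ∷ getDepth ∷ getNear ∷ getNearDist ∷ []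
  summand : ∀ {i is} → i ∈ is → f i ≤ foldr (λ i m → f i + m) 0 is
  summand {i} {_ ∷ is} (here refl) = m≤m+n (f i) _
  summand {i} {k ∷ is} (there i∈)  = m≤n⇒m≤o+n (f k) (summand i∈)
  bound : ∀ {i} → i ∈ all → f i ≤ foldr (λ i m → f i + m) 0 all
  bound = summand

theorem12 : (G : Graph) → let open Graph G in
    (δ : V → V → ℕ) → IsGraphDistance G δ →
    (η : ℕ) → Hyperbolic G δ η →
    BoundedDegree G →
    (v₀ : V) →
    ∃[ mN ] ∃[ md ] Σ (SegmentTreeGraph V v₀ mN md) λ T →
    Realizes T δ ×
    (∀ (π : Val → Val) (code : V → ℕ) → Injective _≡_ _≡_ code →
    ConstantTime π (distanceTo δ v₀ code) →
    ConstantTime π (neighbours G code) →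
    Efficient T π code)
theorem12 G δ isDist η hyperbolic degree v₀ =
  maxNear , suc D , tree , realizes , λ π code code-injective distance-program neighbour-program →
    let open Programs G δ isDist η hyperbolic degree v₀ D ≤-refl M M-large
                      π code code-injective distance-program neighbour-program
        K , C≤K = sum-bound (λ i → proj₁ (proj₂ (operations i)))
    in enc , enc-injective , enc-vertex , constant⇒amortized (operation tree enc) K operations C≤K
  where
  D M : ℕ
  -- The least `D` that `close-above` admits; `M` may be any number above half of 3D + 2η.
  D = 12 * η + 1
  M = suc (D + (D + D) + 2 * η)
  M-large : D + (D + D) + 2 * η < 2 * M
  M-large = m≤m+n M _
  open Segments G δ isDist η hyperbolic degree v₀ D ≤-refl M M-large
  open Realization G δ isDist η hyperbolic degree v₀ D ≤-refl M M-large
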